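{- Let $n\ge 5$ be an integer. Then $ex_{\mathcal{P}}(n,\Theta_4^+)=ex_{\mathcal{P}}(n,\Theta_4)$ if $n\ge 6$, and $ex_{\mathcal{P}}(5,\Theta_4^+)=ex_{\mathcal{P}}(5,\Theta_4)+1=7$.
   Context: All graphs are finite and simple. $\Theta_4$ is the family of Theta graphs on 4 vertices, i.e. graphs obtained from $C_4$ by adding one chord; it consists of a single graph ($K_4$ minus an edge). For a graph $H$, $H^+$ denotes the graph obtained from $H$ by adding exactly one pendant edge (joining a new vertex) to a vertex of degree two, and $\Theta_4^+=\{H^+ : H\in\Theta_4\}$. For a family $\mathcal{F}$, $ex_{\mathcal{P}}(n,\mathcal{F})$ is the maximum number of edges in a planar graph on $n$ vertices containing no member of $\mathcal{F}$ as a subgraph. -}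

module Defs where

open import Data.Bool using (Bool; true; false; _∧_; _∨_; not; if_then_else_)
open import Data.Nat using (ℕ; zero; suc; _+_; _*_; _≤_; _<ᵇ_; _≤ᵇ_; _≡ᵇ_)
open import Data.Fin using (Fin; zero; suc; toℕ)
import Data.Fin as F
open import Data.List using (List; []; _∷_; length; map; concatMap; allFin; filterᵇ; upTo)
open import Data.Bool.ListAction using (all; any)
open import Data.Product using (Σ; ∃; ∃-syntax; _×_; _,_; proj₁; proj₂)
open import Relation.Nullary using (¬_; does)
open import Relation.Binary.PropositionalEquality using (_≡_; refl)
open import Function.Definitions using (Injective)

record Graph (n : ℕ) : Set where
  field
    adj    : Fin n → Fin n → Bool
    sym    : ∀ u v → adj u v ≡ adj v u
    irrefl : ∀ u → adj u u ≡ false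
open Graph public

_=ᶠ_ : ∀ {n} → Fin n → Fin n → Bool
i =ᶠ j = toℕ i ≡ᵇ toℕ j

allPairs : ∀ n → List (Fin n × Fin n)
allPairs n = concatMap (λ i → map (λ j → (i , j)) (allFin n)) (allFin n)

edgeList : ∀ {n} → Graph n → List (Fin n × Fin n)
edgeList {n} G = filterᵇ (λ p → (toℕ (proj₁ p) <ᵇ toℕ (proj₂ p)) ∧ adj G (proj₁ p) (proj₂ p)) (allPairs n)

numEdges : ∀ {n} → Graph n → ℕ
numEdges G = length (edgeList G)

degree : ∀ {n} → Graph n → Fin n → ℕ
degree {n} G v = length (filterᵇ (adj G v) (allFin n))

Contains : ∀ {k n} → Graph k → Graph n → Set
Contains {k} {n} H G =
  Σ (Fin k → Fin n) λ f →
    Injective _≡_ _≡_ f × (∀ i j → adj H i j ≡ true → adj G (f i) (f j) ≡ true)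

-- Planarity, via combinatorial embeddings (rotation systems) of genus 0.

iter : ∀ {A : Set} → ℕ → (A → A) → A → A
iter zero    f x = x
iter (suc k) f x = f (iter k f x)

-- rot u v : the neighbour of u following v in the cyclic order around u
IsRotationSystem : ∀ {n} → Graph n → (Fin n → Fin n → Fin n) → Set
IsRotationSystem {n} G rot =
  (∀ u v → adj G u v ≡ true → adj G u (rot u v) ≡ true) ×
  (∀ u v w → adj G u v ≡ true → adj G u w ≡ true → rot u v ≡ rot u w → v ≡ w) ×
  (∀ u v w → adj G u v ≡ true → adj G u w ≡ true → ∃[ k ] iter k (rot u) v ≡ w)

darts : ∀ {n} → Graph n → List (Fin n × Fin n)
darts {n} G = filterᵇ (λ p → adj G (proj₁ p) (proj₂ p)) (allPairs n)

faceStep : ∀ {n} → (Fin n → Fin n → Fin n) → Fin n × Fin n → Fin n × Fin n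
faceStep rot (u , v) = (v , rot v u)

dartCode : ∀ {n} → Fin n × Fin n → ℕ
dartCode {n} (u , v) = toℕ u * n + toℕ v

-- a dart is the representative of its face if it has the least code in its
-- face-orbit (orbits have length ≤ n*n, so iterating n*n times suffices)
isFaceRep : ∀ {n} → (Fin n → Fin n → Fin n) → Fin n × Fin n → Bool
isFaceRep {n} rot d = all (λ k → dartCode d ≤ᵇ dartCode (iter k (faceStep rot) d)) (upTo (n * n))

numFaces : ∀ {n} → Graph n → (Fin n → Fin n → Fin n) → ℕ
numFaces G rot = length (filterᵇ (isFaceRep rot) (darts G))

-- isolated vertices (each contributes one face of its own component)
numIsolated : ∀ {n} → Graph n → ℕ
numIsolated {n} G = length (filterᵇ (λ v → not (any (adj G v) (allFin n))) (allFin n))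

reach : ∀ {n} → Graph n → ℕ → Fin n → Fin n → Bool
reach G zero    u v = u =ᶠ v
reach {n} G (suc k) u v = reach G k u v ∨ any (λ w → reach G k u w ∧ adj G w v) (allFin n)

numComponents : ∀ {n} → Graph n → ℕ
numComponents {n} G =
  length (filterᵇ (λ v → not (any (λ u → (toℕ u <ᵇ toℕ v) ∧ reach G n u v) (allFin n))) (allFin n))

-- Planar: some rotation system has Euler genus 0 on every component,
-- i.e.  V - E + F = 2 * (#components)  (F counting one face per isolated vertex).
Planar : ∀ {n} → Graph n → Set
Planar {n} G = Σ (Fin n → Fin n → Fin n) λ rot →
  IsRotationSystem G rot ×
  (n + numFaces G rot + numIsolated G ≡ 2 * numComponents G + numEdges G)

Family : Set₁
Family = ∀ {k} → Graph k → Set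

Free : ∀ {n} → Family → Graph n → Set
Free {n} 𝓕 G = ∀ {k} (H : Graph k) → 𝓕 H → ¬ Contains H G

IsExP : ℕ → Family → ℕ → Set
IsExP n 𝓕 m =
  (Σ (Graph n) λ G → Planar G × Free 𝓕 G × numEdges G ≡ m) ×
  (∀ (G : Graph n) → Planar G → Free 𝓕 G → numEdges G ≤ m)

-- Θ₄ : C4 on 0-1-2-3-0 plus the chord 0-2  (K4 minus the edge 1-3)

θadj : Fin 4 → Fin 4 → Bool
θadj zero zero = false
θadj zero (suc zero) = true
θadj zero (suc (suc zero)) = true
θadj zero (suc (suc (suc zero))) = true
θadj (suc zero) zero = true
θadj (suc zero) (suc zero) = false
θadj (suc zero) (suc (suc zero)) = true
θadj (suc zero) (suc (suc (suc zero))) = false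
θadj (suc (suc zero)) zero = true
θadj (suc (suc zero)) (suc zero) = true
θadj (suc (suc zero)) (suc (suc zero)) = false
θadj (suc (suc zero)) (suc (suc (suc zero))) = true
θadj (suc (suc (suc zero))) zero = true
θadj (suc (suc (suc zero))) (suc zero) = false
θadj (suc (suc (suc zero))) (suc (suc zero)) = true
θadj (suc (suc (suc zero))) (suc (suc (suc zero))) = false

θsym : ∀ u v → θadj u v ≡ θadj v u
θsym zero zero = refl
θsym zero (suc zero) = refl
θsym zero (suc (suc zero)) = refl
θsym zero (suc (suc (suc zero))) = refl
θsym (suc zero) zero = refl
θsym (suc zero) (suc zero) = refl
θsym (suc zero) (suc (suc zero)) = refl
θsym (suc zero) (suc (suc (suc zero))) = refl
θsym (suc (suc zero)) zero = refl
θsym (suc (suc zero)) (suc zero) = refl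
θsym (suc (suc zero)) (suc (suc zero)) = refl
θsym (suc (suc zero)) (suc (suc (suc zero))) = refl
θsym (suc (suc (suc zero))) zero = refl
θsym (suc (suc (suc zero))) (suc zero) = refl
θsym (suc (suc (suc zero))) (suc (suc zero)) = refl
θsym (suc (suc (suc zero))) (suc (suc (suc zero))) = refl

θirr : ∀ u → θadj u u ≡ false
θirr zero = refl
θirr (suc zero) = refl
θirr (suc (suc zero)) = refl
θirr (suc (suc (suc zero))) = refl

theta4 : Graph 4
theta4 = record { adj = θadj ; sym = θsym ; irrefl = θirr }

-- The family Θ₄ = { theta4 } (up to isomorphism, which Contains ignores)
Θ₄ : Family
Θ₄ {k} H = Σ (k ≡ 4) λ { refl → H ≡ theta4 }

plusAdj : ∀ {k} → Graph k → Fin k → Fin (suc k) → Fin (suc k) → Bool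
plusAdj H v zero    zero    = false
plusAdj H v zero    (suc j) = j =ᶠ v
plusAdj H v (suc i) zero    = i =ᶠ v
plusAdj H v (suc i) (suc j) = adj H i j

plusSym : ∀ {k} (H : Graph k) v u w → plusAdj H v u w ≡ plusAdj H v w u
plusSym H v zero    zero    = refl
plusSym H v zero    (suc j) = refl
plusSym H v (suc i) zero    = refl
plusSym H v (suc i) (suc j) = sym H i j

plusIrr : ∀ {k} (H : Graph k) v u → plusAdj H v u u ≡ false
plusIrr H v zero    = refl
plusIrr H v (suc i) = irrefl H i

plus : ∀ {k} → Graph k → Fin k → Graph (suc k)
plus H v = record { adj = plusAdj H v ; sym = plusSym H v ; irrefl = plusIrr H v }

Θ₄⁺ : Family
Θ₄⁺ {k} H' = Σ ℕ λ j → Σ (k ≡ suc j) λ { refl →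
  Σ (Graph j) λ H → Θ₄ H × Σ (Fin j) λ v → degree H v ≡ 2 × H' ≡ plus H v }

{-# OPTIONS --safe #-}
module Submission where

-- A Theta on a, b, c, d with spine ac in a Θ₄⁺-free graph G has no edge from b or d to the outside. If bd is an edge, the
-- same applies to a and c, so abcd is a component K₄ (6 edges); otherwise b and d have degree 2 (4 edges).
-- Conversely, take a Θ₄-free plane graph on at least 6 vertices. If some face has an angle u, v, w with u and w
-- distinct and nonadjacent, two new vertices joined to u and w can be put into that face, gaining 4 edges. If
-- there is no such angle, all degrees are at most 2 and the bipartite graph K₂,ₙ₋₂ with 2n - 4 edges does at
-- least as well. So by induction on n removed vertices can be added back without creating a Theta; the cases
-- n = 6, 7 use the prism, to which one such vertex can be added.
-- The only input on planarity is that it survives the deletion of an edge. There the face permutation is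
-- multiplied by a transposition, so the number of faces changes by one, and it drops only if the edge lies on two
-- faces, in which case its ends stay connected. This gives Euler's inequality for every rotation system, and with
-- it that genus 0 is inherited.

open import Defs
open import Data.Bool using (Bool; true; false; if_then_else_; _∧_; _∨_; not)
import Data.Bool as Bool
open import Data.Bool.ListAction using (all; any)
open import Data.Bool.Properties using (∧-comm; ∨-comm; ∧-zeroʳ)
open import Data.Empty using (⊥; ⊥-elim)
open import Data.Fin as Fin using (Fin; zero; suc; toℕ; combine; punchIn; punchOut)
open import Data.Fin.Patterns using (0F; 1F; 2F; 3F; 4F; 5F)
import Data.Fin.Properties as Finₚ
open import Data.List using (List; []; _∷_; length; allFin; upTo; map; concatMap; filterᵇ; cartesianProduct; _++_)
open import Data.List.Membership.Propositional using (_∈_; lose)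
open import Data.List.Membership.Propositional.Properties using (∈-allFin; ∈-upTo⁺; ∈-cartesianProduct⁺; ∈-map⁺; ∈-map⁻)
open import Data.List.Properties using (length-++; length-map; length-tabulate)
open import Data.List.Relation.Unary.All as All using (All; []; _∷_)
import Data.List.Relation.Unary.All.Properties as Allₚ
open import Data.List.Relation.Unary.AllPairs using (AllPairs; []; _∷_)
import Data.List.Relation.Unary.AllPairs.Properties as AllPairsₚ
open import Data.List.Relation.Unary.Any as Any using (Any; here; there; _─_)
import Data.List.Relation.Unary.Any.Properties as Anyₚ
open import Data.List.Relation.Unary.Unique.Propositional using (Unique)
open import Data.List.Relation.Unary.Unique.Propositional.Properties using (allFin⁺; cartesianProduct⁺)
open import Data.Nat as ℕ using (ℕ; zero; suc; _+_; _*_; _∸_; _≤_; _<_; _≤ᵇ_; _<ᵇ_; z≤n; s≤s)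
open import Data.Nat.DivMod using (_/_; _%_; m≡m%n+[m/n]*n; m%n<n)
open import Data.Nat.Induction using (<-wellFounded)
import Data.Nat.Properties as ℕₚ
open import Data.Nat.Solver using (module +-*-Solver)
open import Data.Product using (Σ; ∃; ∃-syntax; _×_; _,_; proj₁; proj₂)
open import Data.Sum using (_⊎_; inj₁; inj₂; [_,_]′)
open import Data.Unit using (⊤; tt)
open import Data.Vec using (Vec; []; _∷_; lookup; tabulate)
open import Data.Vec.Properties using (lookup∘tabulate)
import Data.Vec.Relation.Unary.All as VAll
import Data.Vec.Relation.Unary.AllPairs as VAllPairs
open import Data.Vec.Relation.Unary.Unique.Propositional.Properties using (lookup-injective)
open import Function using (_∘_)
open import Induction.WellFounded using (Acc; acc)
open import Relation.Binary.Construct.Closure.ReflexiveTransitive as Star using (Star; ε; _◅_; _◅◅_; reverse)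
open import Relation.Binary.Definitions using (DecidableEquality; tri<; tri≈; tri>)
open import Relation.Binary.PropositionalEquality as ≡ using (_≡_; _≢_; refl; cong; cong₂; subst)
open import Relation.Nullary using (¬_; Dec; yes; no; does)
open import Relation.Nullary.Decidable using (map′; _×-dec_; _→-dec_; ¬?; dec-true; dec-false; toWitness; toWitnessFalse)

-- Counting equivalence classes by systems of representatives

-- The darts before and after a deletion form different sets, so both face permutations are extended
-- to all ordered pairs, and the non-darts are counted as extra orbits.
--
-- The induction balances because two vertices of degree two carry at most 4 edges and two attached
-- vertices return exactly 4, while a component K₄ carries 6 and four attached vertices return 8. It
-- cannot start below six vertices: on five, three triangles over a common edge have 7 edges and
-- K₂,₃ only 6. On six vertices the remainder after deleting b and d has four vertices, and a K₄
-- there would allow 10 edges against the 9 of the prism, so that remainder has to be excluded.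
--
-- For n at least 6 only equality is claimed, without a formula. The common maximum is therefore
-- found by a bounded search.

record Trans {X : Set} (P : X → Set) (R : X → X → Set) (k : ℕ) : Set where
  field
    reps  : List X
    size  : length reps ≡ k
    valid : All P reps
    apart : AllPairs (λ x y → ¬ R x y) reps
    cover : ∀ x → P x → Any (R x) reps
open Trans public

Everything : {X : Set} → X → Set
Everything _ = ⊤

module _ {Y : Set} where

  length-─ : {P : Y → Set} (ys : List Y) (p : Any P ys) → suc (length (ys ─ p)) ≡ length ys
  length-─ (_ ∷ ys) (here _)  = refl
  length-─ (_ ∷ ys) (there p) = cong suc (length-─ ys p)

  All-─ : {P Q : Y → Set} {ys : List Y} (p : Any P ys) → All Q ys → All Q (ys ─ p)
  All-─ (here _)  (_ ∷ qs) = qs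
  All-─ (there p) (q ∷ qs) = q ∷ All-─ p qs

  hit-or-keep : {P Q : Y → Set} {ys : List Y} (p : Any P ys) → Any Q ys →
                (∃[ y ] (P y × Q y)) ⊎ Any Q (ys ─ p)
  hit-or-keep (here x)  (here y)  = inj₁ (_ , x , y)
  hit-or-keep (here x)  (there q) = inj₂ q
  hit-or-keep (there p) (here y)  = inj₂ (here y)
  hit-or-keep (there p) (there q) with hit-or-keep p q
  ... | inj₁ h = inj₁ h
  ... | inj₂ k = inj₂ (there k)

-- Two apart entries cannot share a target, so the target found for the first entry can be struck
-- from `ys` and the remaining entries keep theirs.
apart-≤ : {X Y : Set} {R : X → X → Set} {S : X → Y → Set} →
          (∀ {x x′ y} → S x y → S x′ y → R x x′) →
          ∀ xs ys → AllPairs (λ x y → ¬ R x y) xs → All (λ x → Any (S x) ys) xs →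
          length xs ≤ length ys
apart-≤ com [] ys _ _ = z≤n
apart-≤ {S = S} com (x ∷ xs) ys (x# ∷ ap) (p ∷ ps) =
  subst (suc (length xs) ≤_) (length-─ ys p)
    (s≤s (apart-≤ {S = S} com xs (ys ─ p) ap (keep xs x# ps)))
  where
  keep : ∀ zs → All (λ y → ¬ _) zs → All (λ z → Any (S z) ys) zs → All (λ z → Any (S z) (ys ─ p)) zs
  keep [] _ _ = []
  keep (z ∷ zs) (n ∷ ns) (q ∷ qs) with hit-or-keep p q
  ... | inj₁ (_ , s , s′) = ⊥-elim (n (com s s′))
  ... | inj₂ k = k ∷ keep zs ns qs

module _ {X : Set} {P : X → Set} {R : X → X → Set}
         (R-com : ∀ {x x′ y} → R x y → R x′ y → R x x′) where

  Trans-≤ : ∀ {k} → Trans P R k → (ys : List X) → (∀ x → P x → Any (R x) ys) → k ≤ length ys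
  Trans-≤ t ys cov = subst (_≤ length ys) (size t)
    (apart-≤ {S = R} R-com (reps t) ys (apart t) (All.map (cov _) (valid t)))

  Trans-unique : ∀ {k l} → Trans P R k → Trans P R l → k ≡ l
  Trans-unique s t = ℕₚ.≤-antisym (half s t) (half t s)
    where
    half : ∀ {k l} → Trans P R k → Trans P R l → k ≤ l
    half s t = subst (_ ≤_) (size t) (Trans-≤ s (reps t) (cover t))

AllPairs-map-valid : {X : Set} {P : X → Set} {R S : X → X → Set} →
  (∀ {x y} → P x → P y → R x y → S x y) →
  ∀ {xs} → All P xs → AllPairs R xs → AllPairs S xs
AllPairs-map-valid f [] [] = []
AllPairs-map-valid {R = R} {S} f (p ∷ ps) (r ∷ rs) = go ps r ∷ AllPairs-map-valid f ps rs
  where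
  go : ∀ {zs} → All _ zs → All (R _) zs → All (S _) zs
  go [] [] = []
  go (q ∷ qs) (s ∷ ss) = f p q s ∷ go qs ss

Trans-cong : {X : Set} {P P′ : X → Set} {R R′ : X → X → Set} →
  (∀ x → P x → P′ x) → (∀ x → P′ x → P x) →
  (∀ x y → P x → P y → R x y → R′ x y) → (∀ x y → P x → P y → R′ x y → R x y) →
  ∀ {k} → Trans P R k → Trans P′ R′ k
Trans-cong {P = P} {R = R} {R′} f g h i t = record
  { reps = reps t ; size = size t ; valid = All.map (f _) (valid t)
  ; apart = AllPairs-map-valid (λ p q n r → n (i _ _ p q r)) (valid t) (apart t)
  ; cover = λ x p → go (g x p) (valid t) (cover t x (g x p)) }
  where
  go : ∀ {x zs} → P x → All P zs → Any (R x) zs → Any (R′ x) zs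
  go p (q ∷ _)  (here r)  = here (h _ _ p q r)
  go p (_ ∷ qs) (there r) = there (go p qs r)

-- R is R′ with the classes of u and v identified.
module _ {X : Set} {R′ R : X → X → Set} {u v : X}
  (sym′ : ∀ {x y} → R′ x y → R′ y x) (trans′ : ∀ {x y z} → R′ x y → R′ y z → R′ x z)
  (Rtrans : ∀ {x y z} → R x y → R y z → R x z)
  (R′⊆R : ∀ {x y} → R′ x y → R x y) (uRv : R u v)
  (R⊆ : ∀ {x y} → R x y → R′ x y ⊎ (R′ x u × R′ v y) ⊎ (R′ x v × R′ u y)) where

  private
    apart-─ : ∀ {zs} → AllPairs (λ x y → ¬ R′ x y) zs → (q : Any (R′ u) zs) →
              AllPairs (λ x y → ¬ R′ x y) (zs ─ q) × All (λ x → ¬ R′ u x) (zs ─ q)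
    apart-─ (n ∷ ap) (here r) = ap , All.map (λ m s → m (trans′ (sym′ r) s)) n
    apart-─ (n ∷ ap) (there q) with apart-─ ap q
    ... | ap′ , us = (All-─ q n ∷ ap′) , (clash n q ∷ us)
      where
      clash : ∀ {t zs} → All (λ y → ¬ R′ t y) zs → Any (R′ u) zs → ¬ R′ u t
      clash (n ∷ _)  (here r)  s = n (trans′ (sym′ s) r)
      clash (_ ∷ ns) (there q) s = clash ns q s

  -- The representative of the class of `u` is dropped; members of that class are then covered by
  -- the representative of the class of `v`.
  Trans-merge : ¬ R′ u v → ∀ {k} → Trans Everything R′ k → ∃[ l ] (k ≡ suc l × Trans Everything R l)
  Trans-merge ¬uv t = length rest , ≡.sym (≡.trans (length-─ (reps t) q) (size t)) , record
    { reps = rest ; size = refl ; valid = All.universal (λ _ → tt) rest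
    ; apart = AllPairs-map-valid up (proj₂ ap) (proj₁ ap)
    ; cover = λ x _ → cov x }
    where
    q = cover t u tt
    rest = reps t ─ q
    ap = apart-─ (apart t) q
    up : ∀ {x y} → ¬ R′ u x → ¬ R′ u y → ¬ R′ x y → ¬ R x y
    up nx ny nxy r with R⊆ r
    ... | inj₁ s = nxy s
    ... | inj₂ (inj₁ (s , _)) = nx (sym′ s)
    ... | inj₂ (inj₂ (_ , s)) = ny s
    cov : ∀ x → Any (R x) rest
    cov x with hit-or-keep q (cover t x tt)
    ... | inj₂ k = Any.map R′⊆R k
    ... | inj₁ (_ , us , xs) with hit-or-keep q (cover t v tt)
    ...   | inj₁ (_ , us′ , vs′) = ⊥-elim (¬uv (trans′ us′ (sym′ vs′)))
    ...   | inj₂ k = Any.map (λ vy → Rtrans (R′⊆R (trans′ xs (sym′ us))) (Rtrans uRv (R′⊆R vy))) k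

module _ {X : Set} {R : X → X → Set} (R? : ∀ x y → Dec (R x y)) (R-refl : ∀ {x} → R x x) where

  private
    sieve : (xs : List X) → Σ (List X) λ T → AllPairs (λ x y → ¬ R x y) T × (∀ x → x ∈ xs → Any (R x) T)
    sieve [] = [] , [] , λ _ ()
    sieve (x ∷ xs) with sieve xs
    ... | T , ap , cov with Any.any? (R? x) T
    ...   | yes p = T , ap , λ { _ (here refl) → p ; y (there m) → cov y m }
    ...   | no ¬p = x ∷ T , (neg T ¬p ∷ ap) , λ { _ (here refl) → here R-refl ; y (there m) → there (cov y m) }
      where
      neg : ∀ zs → ¬ Any (R x) zs → All (λ z → ¬ R x z) zs
      neg [] _ = []
      neg (z ∷ zs) n = (n ∘ here) ∷ neg zs (n ∘ there)

  Trans-exists : (xs : List X) → (∀ x → x ∈ xs) → ∃ (Trans Everything R)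
  Trans-exists xs full with sieve xs
  ... | T , ap , cov = length T , record
    { reps = T ; size = refl ; valid = All.universal (λ _ → tt) T ; apart = ap ; cover = λ x _ → cov x (full x) }

-- Orbits of a permutation composed with a transposition

iter-+ : ∀ {A : Set} (f : A → A) m n x → iter (m + n) f x ≡ iter m f (iter n f x)
iter-+ f zero    n x = refl
iter-+ f (suc m) n x = cong f (iter-+ f m n x)

iter-comm : ∀ {A : Set} (f : A → A) k x → iter k f (f x) ≡ f (iter k f x)
iter-comm f zero    x = refl
iter-comm f (suc k) x = cong f (iter-comm f k x)

iter-cong : ∀ {A : Set} {f g : A → A} → (∀ x → f x ≡ g x) → ∀ k x → iter k f x ≡ iter k g x
iter-cong e zero    x = refl
iter-cong {g = g} e (suc k) x = ≡.trans (e _) (cong g (iter-cong e k x))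

module Orbits {X : Set} {N : ℕ} (code : X → Fin N) (code-inj : ∀ {x y} → code x ≡ code y → x ≡ y) where

  _≟X_ : DecidableEquality X
  x ≟X y = map′ code-inj (cong code) (code x Finₚ.≟ code y)

  -- Only forward iterates occur. Symmetry comes from finiteness: an injective map on a finite set
  -- returns to its starting point.
  _⊢_~_ : (X → X) → X → X → Set
  φ ⊢ x ~ y = ∃[ k ] iter k φ x ≡ y

  ~-refl : ∀ {φ x} → φ ⊢ x ~ x
  ~-refl = 0 , refl

  ~-trans : ∀ {φ x y z} → φ ⊢ x ~ y → φ ⊢ y ~ z → φ ⊢ x ~ z
  ~-trans {φ} (k , refl) (l , refl) = l + k , iter-+ φ l k _

  ~-step : ∀ {φ} x → φ ⊢ x ~ φ x
  ~-step x = 1 , refl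

  ~-cong : ∀ {φ ψ} → (∀ x → φ x ≡ ψ x) → ∀ {x y} → φ ⊢ x ~ y → ψ ⊢ x ~ y
  ~-cong e (k , p) = k , ≡.trans (≡.sym (iter-cong e k _)) p

  swp : X → X → X → X
  swp d e x with x ≟X d | x ≟X e
  ... | yes _ | _     = e
  ... | no _  | yes _ = d
  ... | no _  | no _  = x

  swpˡ : ∀ d e → swp d e d ≡ e
  swpˡ d e with d ≟X d | d ≟X e
  ... | yes _ | _ = refl
  ... | no n  | _ = ⊥-elim (n refl)

  swpʳ : ∀ d e → swp d e e ≡ d
  swpʳ d e with e ≟X d | e ≟X e
  ... | yes p | _ = p
  ... | no _  | yes _ = refl
  ... | no _  | no n = ⊥-elim (n refl)

  swp-other : ∀ d e {x} → x ≢ d → x ≢ e → swp d e x ≡ x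
  swp-other d e {x} n m with x ≟X d | x ≟X e
  ... | yes p | _     = ⊥-elim (n p)
  ... | no _  | yes p = ⊥-elim (m p)
  ... | no _  | no _  = refl

  data SwpView (d e x : X) : Set where
    isˡ  : x ≡ d → swp d e x ≡ e → SwpView d e x
    isʳ  : x ≡ e → swp d e x ≡ d → SwpView d e x
    else : x ≢ d → x ≢ e → swp d e x ≡ x → SwpView d e x

  swpView : ∀ d e x → SwpView d e x
  swpView d e x with x ≟X d | x ≟X e
  ... | yes refl | _ = isˡ refl (swpˡ d e)
  ... | no _  | yes refl = isʳ refl (swpʳ d e)
  ... | no n  | no m  = else n m (swp-other d e n m)

  swp-invol : ∀ d e x → swp d e (swp d e x) ≡ x
  swp-invol d e x with swpView d e x
  ... | isˡ refl q = ≡.trans (cong (swp d e) q) (swpʳ d e)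
  ... | isʳ refl q = ≡.trans (cong (swp d e) q) (swpˡ d e)
  ... | else n m q = ≡.trans (cong (swp d e) q) q

  Inj : (X → X) → Set
  Inj φ = ∀ {x y} → φ x ≡ φ y → x ≡ y

  swp-inj : ∀ {φ} → Inj φ → ∀ d e → Inj (φ ∘ swp d e)
  swp-inj inj d e {x} {y} p =
    ≡.trans (≡.sym (swp-invol d e x)) (≡.trans (cong (swp d e) (inj p)) (swp-invol d e y))

  module _ {φ : X → X} (inj : Inj φ) where

    iter-inj : ∀ k {x y} → iter k φ x ≡ iter k φ y → x ≡ y
    iter-inj zero    p = p
    iter-inj (suc k) p = iter-inj k (inj p)

    -- Two of the first `N + 1` iterates have the same code, and injectivity cancels the smaller
    -- number of steps.
    period : ∀ x → ∃[ p ] (suc p ≤ N × iter (suc p) φ x ≡ x)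
    period x with Finₚ.pigeonhole (ℕₚ.n<1+n N) (λ i → code (iter (toℕ i) φ x))
    ... | i , j , i<j , eq = toℕ j ∸ suc (toℕ i) , small , iter-inj (toℕ i) claim
      where
      shape : suc (toℕ j ∸ suc (toℕ i)) ≡ toℕ j ∸ toℕ i
      shape = ≡.sym (ℕₚ.+-∸-assoc 1 i<j)
      small : suc (toℕ j ∸ suc (toℕ i)) ≤ N
      small = subst (_≤ N) (≡.sym shape) (ℕₚ.≤-trans (ℕₚ.m∸n≤m (toℕ j) (toℕ i)) (ℕ.s≤s⁻¹ (Finₚ.toℕ<n j)))
      claim : iter (toℕ i) φ (iter (suc (toℕ j ∸ suc (toℕ i))) φ x) ≡ iter (toℕ i) φ x
      claim = ≡.trans (≡.sym (iter-+ φ (toℕ i) _ x))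
              (≡.trans (cong (λ t → iter t φ x) (≡.trans (cong (toℕ i +_) shape) (ℕₚ.m+[n∸m]≡n (ℕₚ.<⇒≤ i<j))))
                 (≡.sym (code-inj eq)))

    iter-period : ∀ {x p} → iter p φ x ≡ x → ∀ q → iter (q * p) φ x ≡ x
    iter-period e zero = refl
    iter-period {x} {p} e (suc q) = ≡.trans (iter-+ φ p (q * p) x) (≡.trans (cong (iter p φ) (iter-period e q)) e)

    ~-bounded : ∀ {x y} → φ ⊢ x ~ y → ∃[ k ] (k < N × iter k φ x ≡ y)
    ~-bounded {x} (k , refl) with period x
    ... | p , p<N , e = k % suc p , ℕₚ.<-≤-trans (m%n<n k (suc p)) p<N ,
      ≡.sym (≡.trans (cong (λ t → iter t φ x) (m≡m%n+[m/n]*n k (suc p)))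
        (≡.trans (iter-+ φ (k % suc p) (k / suc p * suc p) x) (cong (iter (k % suc p) φ) (iter-period e (k / suc p)))))

    ~-sym : ∀ {x y} → φ ⊢ x ~ y → φ ⊢ y ~ x
    ~-sym {x} (k , refl) with period x
    -- The `k` steps already made are completed to `k` full periods.
    ... | p , _ , e = k * suc p ∸ k ,
      ≡.trans (≡.sym (iter-+ φ (k * suc p ∸ k) k x))
        (≡.trans (cong (λ t → iter t φ x) (ℕₚ.m∸n+n≡m (ℕₚ.m≤m*n k (suc p)))) (iter-period e k))

    ~-com : ∀ {x x′ y} → φ ⊢ x ~ y → φ ⊢ x′ ~ y → φ ⊢ x ~ x′
    ~-com p q = ~-trans p (~-sym q)

    ~-dec : ∀ x y → Dec (φ ⊢ x ~ y)
    ~-dec x y with Finₚ.any? (λ (i : Fin N) → iter (toℕ i) φ x ≟X y)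
    ... | yes (i , e) = yes (toℕ i , e)
    ... | no n = no λ r → let (k , k<N , e) = ~-bounded r in
      n (Fin.fromℕ< k<N , ≡.trans (cong (λ t → iter t φ x) (Finₚ.toℕ-fromℕ< k<N)) e)

    preimage : ∀ y → ∃[ x ] φ x ≡ y
    preimage y with period y
    ... | p , _ , e = iter p φ y , e

  module Swap {φ : X → X} (inj : Inj φ) {d e : X} (d≢e : d ≢ e) where

    ψ : X → X
    ψ = φ ∘ swp d e

    ψ-inj : Inj ψ
    ψ-inj = swp-inj inj d e

    ψ-other : ∀ {x} → x ≢ d → x ≢ e → ψ x ≡ φ x
    ψ-other n m = cong φ (swp-other d e n m)

    -- Until the orbit first meets `d` or `e` the maps `φ` and `ψ` agree, so whichever point is met
    -- first is also reached by `ψ`.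
    towards : ∀ k x → iter k φ x ≡ d → ψ ⊢ x ~ d ⊎ ψ ⊢ x ~ e
    towards k x p with swpView d e x
    ... | isˡ refl _ = inj₁ ~-refl
    ... | isʳ refl _ = inj₂ ~-refl
    towards zero x p    | else n _ _ = ⊥-elim (n p)
    towards (suc k) x p | else n m q with towards k (φ x) (≡.trans (iter-comm φ k x) p)
    ... | inj₁ r = inj₁ (~-trans (1 , cong φ q) r)
    ... | inj₂ r = inj₂ (~-trans (1 , cong φ q) r)

    -- `ψ d` is `φ e`, and from there the `φ`-orbit of `e`, which misses `d`, leads back to `e`
    -- under `ψ` as well.
    apart⇒joined : ¬ φ ⊢ d ~ e → ψ ⊢ d ~ e
    apart⇒joined ¬de with ~-sym inj (~-step {φ} e)
    ... | k , p = ~-trans (1 , cong φ (swpˡ d e)) (run k (φ e) p (λ r → ¬de (~-sym inj (~-trans (~-step e) r))))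
      where
      run : ∀ k x → iter k φ x ≡ e → ¬ φ ⊢ x ~ d → ψ ⊢ x ~ e
      run k x p n with x ≟X e
      ... | yes refl = ~-refl
      run zero    x p n | no x≢e = ⊥-elim (x≢e p)
      run (suc k) x p n | no x≢e = ~-trans (1 , ψ-other (λ { refl → n ~-refl }) x≢e)
        (run k (φ x) (≡.trans (iter-comm φ k x) p) (λ r → n (~-trans (~-step x) r)))

    module Split (de : φ ⊢ d ~ e) where

      private
        -- x meets p along φ before it meets q.
        data Before (p q : X) : X → Set where
          now   : Before p q p
          later : ∀ {x} → x ≢ p → x ≢ q → Before p q (φ x) → Before p q x

        before-≢ : ∀ {p q x} → p ≢ q → Before p q x → x ≢ q
        before-≢ n now           = n
        before-≢ n (later _ m _) = m

        meets : ∀ k x → iter k φ x ≡ d → Before d e x ⊎ Before e d x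
        meets k x p with x ≟X d | x ≟X e
        ... | yes refl | _ = inj₁ now
        ... | no _ | yes refl = inj₂ now
        meets zero x p | no n | no m = ⊥-elim (n p)
        meets (suc k) x p | no n | no m with meets k (φ x) (≡.trans (iter-comm φ k x) p)
        ... | inj₁ b = inj₁ (later n m b)
        ... | inj₂ b = inj₂ (later m n b)

        -- Otherwise the φ-orbit of e would return to e without meeting d.
        φe-meets-d : Before d e (φ e)
        φe-meets-d with ~-trans (~-sym inj (~-step {φ} e)) (~-sym inj de)
        ... | k , p with meets k (φ e) p
        ...   | inj₁ b = b
        ...   | inj₂ b = ⊥-elim (before-≢ (d≢e ∘ ≡.sym) (trapped b (proj₁ ed) e now) (proj₂ ed))
          where
          ed = ~-sym inj de
          trapped : Before e d (φ e) → ∀ k x → Before e d x → Before e d (iter k φ x)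
          trapped b zero    x c = c
          trapped b (suc k) x c with trapped b k x c
          ... | now = b
          ... | later _ _ c′ = c′

        ψ-invariant : ∀ {x} → Before d e x → Before d e (ψ x)
        ψ-invariant now = subst (Before d e) (≡.sym (cong φ (swpˡ d e))) φe-meets-d
        ψ-invariant (later n m b) = subst (Before d e) (≡.sym (ψ-other n m)) b

        ψ-invariant* : ∀ k {x} → Before d e x → Before d e (iter k ψ x)
        ψ-invariant* zero b = b
        ψ-invariant* (suc k) b = ψ-invariant (ψ-invariant* k b)

      -- Under `ψ` the orbit of `d` stays among the points that meet `d` before `e` along `φ`, and
      -- `e` is not one of them.
      separated : ¬ ψ ⊢ d ~ e
      separated (k , p) = before-≢ d≢e (ψ-invariant* k now) p

      swp-~ : ∀ x → φ ⊢ x ~ swp d e x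
      swp-~ x with swpView d e x
      ... | isˡ refl q = subst (φ ⊢ d ~_) (≡.sym q) de
      ... | isʳ refl q = subst (φ ⊢ e ~_) (≡.sym q) (~-sym inj de)
      ... | else _ _ q = 0 , ≡.sym q

      coarser : ∀ {x y} → ψ ⊢ x ~ y → φ ⊢ x ~ y
      coarser (k , refl) = go k _
        where
        go : ∀ k x → φ ⊢ x ~ iter k ψ x
        go zero x = ~-refl
        go (suc k) x = ~-trans (go k x) (~-trans (swp-~ _) (~-step _))

      -- A `φ`-orbit that misses `d` also misses `e` and is left alone by `ψ`. In the remaining
      -- orbit `towards` ties every point to `d` or to `e`.
      finer : ∀ {x y} → φ ⊢ x ~ y → ψ ⊢ x ~ y ⊎ (ψ ⊢ x ~ d × ψ ⊢ e ~ y) ⊎ (ψ ⊢ x ~ e × ψ ⊢ d ~ y)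
      finer {x} {y} xy with ~-dec inj x d
      ... | no ¬xd = inj₁ (run (proj₁ xy) x (proj₂ xy) ¬xd)
        where
        run : ∀ k x → iter k φ x ≡ y → ¬ φ ⊢ x ~ d → ψ ⊢ x ~ y
        run zero    x refl n = ~-refl
        run (suc k) x p n = ~-trans
          (1 , ψ-other (λ { refl → n ~-refl }) (λ { refl → n (~-sym inj de) }))
          (run k (φ x) (≡.trans (iter-comm φ k x) p) (λ r → n (~-trans (~-step x) r)))
      ... | yes xd with ~-trans (~-sym inj xy) xd
      ...   | yd with towards (proj₁ xd) x (proj₂ xd)
                      | towards (proj₁ yd) y (proj₂ yd)
      ...     | inj₁ a | inj₁ b = inj₁ (~-com ψ-inj a b)
      ...     | inj₁ a | inj₂ b = inj₂ (inj₁ (a , ~-sym ψ-inj b))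
      ...     | inj₂ a | inj₁ b = inj₂ (inj₂ (a , ~-sym ψ-inj b))
      ...     | inj₂ a | inj₂ b = inj₁ (~-com ψ-inj a b)

  Orbs : (X → X) → ℕ → Set
  Orbs φ = Trans Everything (φ ⊢_~_)

  Orbs-unique : ∀ {φ} → Inj φ → ∀ {k l} → Orbs φ k → Orbs φ l → k ≡ l
  Orbs-unique inj = Trans-unique (~-com inj)

  Orbs-cong : ∀ {φ ψ} → (∀ x → φ x ≡ ψ x) → ∀ {k} → Orbs φ k → Orbs ψ k
  Orbs-cong e = Trans-cong (λ _ _ → tt) (λ _ _ → tt) (λ _ _ _ _ → ~-cong e)
    (λ _ _ _ _ → ~-cong (≡.sym ∘ e))

  module Count (xs : List X) (full : ∀ x → x ∈ xs) where

    orbs : ∀ {φ} → Inj φ → ∃ (Orbs φ)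
    orbs {φ} inj = Trans-exists (~-dec inj) ~-refl xs full

    swap-same : ∀ {φ} (inj : Inj φ) {d e} → d ≢ e → φ ⊢ d ~ e → ∀ {k} → Orbs φ k → Orbs (φ ∘ swp d e) (suc k)
    swap-same {φ} inj {d} {e} d≢e de t = subst (Orbs _) (≡.trans (proj₁ (proj₂ m)) (cong suc (Orbs-unique inj (proj₂ (proj₂ m)) t))) (proj₂ new)
      where
      open Swap inj d≢e
      open Split de
      new = orbs ψ-inj
      m = Trans-merge (~-sym ψ-inj) ~-trans ~-trans coarser de finer separated (proj₂ new)

    -- The transposition is an involution and `ψ` has `d` and `e` in one orbit, so this is
    -- `swap-same` read backwards.
    swap-diff : ∀ {φ} (inj : Inj φ) {d e} → d ≢ e → ¬ φ ⊢ d ~ e → ∀ {k l} → Orbs φ k → Orbs (φ ∘ swp d e) l → k ≡ suc l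
    swap-diff {φ} inj {d} {e} d≢e ¬de t s =
      Orbs-unique inj t (Orbs-cong (λ x → cong φ (swp-invol d e x)) (swap-same ψ-inj d≢e (apart⇒joined ¬de) s))
      where open Swap inj d≢e

    detach : (X → X) → X → X → X
    detach φ d x with x ≟X d | φ x ≟X d
    ... | yes _ | _ = d
    ... | no _ | yes _ = φ d
    ... | no _ | no _ = φ x

    detach-at : ∀ φ d → detach φ d d ≡ d
    detach-at φ d with d ≟X d | φ d ≟X d
    ... | yes _ | _ = refl
    ... | no n | _ = ⊥-elim (n refl)

    detach-hit : ∀ φ d {x} → x ≢ d → φ x ≡ d → detach φ d x ≡ φ d
    detach-hit φ d {x} n e with x ≟X d | φ x ≟X d
    ... | yes p | _ = ⊥-elim (n p)
    ... | no _ | yes _ = refl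
    ... | no _ | no m = ⊥-elim (m e)

    detach-miss : ∀ φ d {x} → x ≢ d → φ x ≢ d → detach φ d x ≡ φ x
    detach-miss φ d {x} n e with x ≟X d | φ x ≟X d
    ... | yes p | _ = ⊥-elim (n p)
    ... | no _ | yes q = ⊥-elim (e q)
    ... | no _ | no m = refl

    private
      -- Cutting `d` out of its cycle is composition with the transposition of `d` and its
      -- predecessor `p`, so injectivity and the orbit count of `detach` follow from those of swaps.
      detach-swp : ∀ {φ} → Inj φ → ∀ {d p} → φ p ≡ d → ∀ x → φ (swp d p x) ≡ detach φ d x
      detach-swp {φ} inj {d} {p} e x with swpView d p x
      ... | isˡ refl q = ≡.trans (cong φ q) (≡.trans e (≡.sym (detach-at φ d)))
      ... | else n m q = ≡.trans (cong φ q) (≡.sym (detach-miss φ d n λ r → m (inj (≡.trans r (≡.sym e)))))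
      ... | isʳ refl q = ≡.trans (cong φ q) (go (x ≟X d))
        where
        go : Dec (x ≡ d) → φ d ≡ detach φ d x
        go (yes refl) = ≡.trans e (≡.sym (detach-at φ d))
        go (no n)     = ≡.sym (detach-hit φ d n e)

    detach-inj : ∀ {φ} → Inj φ → ∀ d → Inj (detach φ d)
    detach-inj {φ} inj d {x} {y} q with preimage inj d
    ... | p , e = swp-inj inj d p (≡.trans (detach-swp inj e x) (≡.trans q (≡.sym (detach-swp inj e y))))

    detach-fixed : ∀ {φ} → Inj φ → ∀ {d} → φ d ≡ d → ∀ {k} → Orbs φ k → Orbs (detach φ d) k
    detach-fixed {φ} inj {d} e = Orbs-cong same
      where
      same : ∀ x → φ x ≡ detach φ d x
      same x with x ≟X d | φ x ≟X d
      ... | yes refl | _ = e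
      ... | no n | yes q = ⊥-elim (n (inj (≡.trans q (≡.sym e))))
      ... | no _ | no _ = refl

    detach-moved : ∀ {φ} → Inj φ → ∀ {d} → φ d ≢ d → ∀ {k} → Orbs φ k → Orbs (detach φ d) (suc k)
    detach-moved {φ} inj {d} n t with preimage inj d
    ... | p , e = Orbs-cong (detach-swp inj e)
      (swap-same inj (λ { refl → n e }) (~-sym inj (1 , e)) t)

-- The counts of Defs as numbers of classes

true≢false : true ≢ false
true≢false ()

not-true : ∀ {b} → b ≢ true → b ≡ false
not-true {false} _ = refl
not-true {true} n = ⊥-elim (n refl)

∧-true : ∀ {a b} → a ∧ b ≡ true → a ≡ true × b ≡ true
∧-true {true} e = refl , e

∨-true : ∀ {a b} → a ∨ b ≡ true → a ≡ true ⊎ b ≡ true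
∨-true {true} e = inj₁ refl
∨-true {false} e = inj₂ e

∨-introʳ : ∀ a {b} → b ≡ true → a ∨ b ≡ true
∨-introʳ true _ = refl
∨-introʳ false e = e

fromT : ∀ {b} → Bool.T b → b ≡ true
fromT {true} _ = refl

toT : ∀ {b} → b ≡ true → Bool.T b
toT refl = tt

module _ {A : Set} (p : A → Bool) where

  any-intro : ∀ {xs x} → x ∈ xs → p x ≡ true → any p xs ≡ true
  any-intro {y ∷ _} (here refl) e rewrite e = refl
  any-intro {y ∷ _} (there m) e = ∨-introʳ (p y) (any-intro m e)

  any-elim : ∀ xs → any p xs ≡ true → ∃[ x ] p x ≡ true
  any-elim (x ∷ xs) e with ∨-true {p x} e
  ... | inj₁ q = x , q
  ... | inj₂ q = any-elim xs q

  all-elim : ∀ {xs x} → all p xs ≡ true → x ∈ xs → p x ≡ true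
  all-elim {y ∷ _} e (here refl) = proj₁ (∧-true {p y} e)
  all-elim {y ∷ _} e (there m) = all-elim (proj₂ (∧-true {p y} e)) m

  all-counter : ∀ xs → all p xs ≡ false → ∃[ x ] p x ≡ false
  all-counter (x ∷ xs) e with p x in q
  ... | true  = all-counter xs e
  ... | false = x , q

  filterᵇ-true : ∀ xs → All (λ x → p x ≡ true) (filterᵇ p xs)
  filterᵇ-true [] = []
  filterᵇ-true (x ∷ xs) with p x in q
  ... | true  = q ∷ filterᵇ-true xs
  ... | false = filterᵇ-true xs

  filterᵇ-All : ∀ {Q : A → Set} {xs} → All Q xs → All Q (filterᵇ p xs)
  filterᵇ-All [] = []
  filterᵇ-All {xs = x ∷ _} (q ∷ qs) with p x
  ... | true  = q ∷ filterᵇ-All qs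
  ... | false = filterᵇ-All qs

  filterᵇ-AllPairs : ∀ {Q : A → A → Set} {xs} → AllPairs Q xs → AllPairs Q (filterᵇ p xs)
  filterᵇ-AllPairs [] = []
  filterᵇ-AllPairs {xs = x ∷ _} (q ∷ qs) with p x
  ... | true  = filterᵇ-All q ∷ filterᵇ-AllPairs qs
  ... | false = filterᵇ-AllPairs qs

  filterᵇ-∈ : ∀ {xs x} → x ∈ xs → p x ≡ true → x ∈ filterᵇ p xs
  filterᵇ-∈ {y ∷ _} (here refl) e rewrite e = here refl
  filterᵇ-∈ {y ∷ _} (there m) e with p y
  ... | true  = there (filterᵇ-∈ m e)
  ... | false = filterᵇ-∈ m e

-- Each count in Euler's formula is the length of a filtered list without repetitions, whose test
-- accepts one canonical member of every class.
Trans-filterᵇ : {A : Set} (p : A → Bool) (xs : List A) → Unique xs → {P : A → Set} {R : A → A → Set} →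
  All (λ x → p x ≡ true → P x) xs →
  (∀ x y → P x → P y → p x ≡ true → p y ≡ true → R x y → x ≡ y) →
  (∀ x → P x → ∃[ y ] (y ∈ xs × p y ≡ true × R x y)) →
  Trans P R (length (filterᵇ p xs))
Trans-filterᵇ {A} p xs uniq {P} {R} val inj cov = record
  { reps = filterᵇ p xs ; size = refl
  ; valid = All.map proj₂ good
  ; apart = AllPairs-map-valid (λ q q′ n r → n (inj _ _ (proj₂ q) (proj₂ q′) (proj₁ q) (proj₁ q′) r)) good (filterᵇ-AllPairs p uniq)
  ; cover = λ x q → let (y , m , e , r) = cov x q in lose (filterᵇ-∈ p m e) r }
  where
  good : All (λ x → p x ≡ true × P x) (filterᵇ p xs)
  good = All.zipWith (λ (q , f) → q , f q) (filterᵇ-true p xs , filterᵇ-All p val)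

allPairs≡ : ∀ n → allPairs n ≡ cartesianProduct (allFin n) (allFin n)
allPairs≡ n = go (allFin n)
  where
  go : ∀ xs → concatMap (λ i → map (λ j → (i , j)) (allFin n)) xs ≡ cartesianProduct xs (allFin n)
  go [] = refl
  go (x ∷ xs) = cong (map (x ,_) (allFin n) ++_) (go xs)

allPairs-unique : ∀ n → Unique (allPairs n)
allPairs-unique n = subst Unique (≡.sym (allPairs≡ n)) (cartesianProduct⁺ (allFin⁺ n) (allFin⁺ n))

allPairs-full : ∀ {n} (d : Fin n × Fin n) → d ∈ allPairs n
allPairs-full {n} (u , v) = subst ((u , v) ∈_) (≡.sym (allPairs≡ n)) (∈-cartesianProduct⁺ (∈-allFin u) (∈-allFin v))

rev : ∀ {n} → Fin n × Fin n → Fin n × Fin n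
rev (u , v) = v , u

SameEdge : ∀ {n} → Fin n × Fin n → Fin n × Fin n → Set
SameEdge d e = d ≡ e ⊎ d ≡ rev e

SameEdge-com : ∀ {n} {x x′ y : Fin n × Fin n} → SameEdge x y → SameEdge x′ y → SameEdge x x′
SameEdge-com (inj₁ refl) (inj₁ refl) = inj₁ refl
SameEdge-com (inj₁ refl) (inj₂ refl) = inj₂ refl
SameEdge-com (inj₂ refl) (inj₁ refl) = inj₂ refl
SameEdge-com (inj₂ refl) (inj₂ refl) = inj₁ refl

module _ {n} (G : Graph n) where

  Adj : Fin n → Fin n → Set
  Adj u v = adj G u v ≡ true

  Adj-sym : ∀ {u v} → Adj u v → Adj v u
  Adj-sym {u} {v} a = ≡.trans (sym G v u) a

  Adj-≢ : ∀ {u v} → Adj u v → u ≢ v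
  Adj-≢ {u} a refl = true≢false (≡.trans (≡.sym a) (irrefl G u))

  IsDart : Fin n × Fin n → Set
  IsDart (u , v) = Adj u v

  Isolated : Fin n → Set
  Isolated v = ∀ w → adj G v w ≡ false

  Conn : Fin n → Fin n → Set
  Conn = Star Adj

  Conn-sym : ∀ {u v} → Conn u v → Conn v u
  Conn-sym = reverse Adj-sym

  Conn-com : ∀ {x x′ y} → Conn x y → Conn x′ y → Conn x x′
  Conn-com p q = p ◅◅ Conn-sym q

  Trans-numEdges : Trans IsDart SameEdge (numEdges G)
  Trans-numEdges = Trans-filterᵇ _ (allPairs n) (allPairs-unique n)
    (All.universal (λ { (u , v) e → proj₂ (∧-true {toℕ u <ᵇ toℕ v} e) }) _)
    (λ { x y _ _ p q (inj₁ e) → e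
       ; (u , v) _ _ _ p q (inj₂ refl) → ⊥-elim (ℕₚ.<-asym (lt u v p) (lt v u q)) })
    cov
    where
    lt : ∀ (u v : Fin n) → (toℕ u <ᵇ toℕ v) ∧ adj G u v ≡ true → toℕ u < toℕ v
    lt u v e = ℕₚ.<ᵇ⇒< _ _ (toT (proj₁ (∧-true {toℕ u <ᵇ toℕ v} e)))
    cov : ∀ d → IsDart d → _
    cov (u , v) a with ℕₚ.<-cmp (toℕ u) (toℕ v)
    ... | tri< u<v _ _ = (u , v) , allPairs-full _ , cong₂ _∧_ (fromT (ℕₚ.<⇒<ᵇ u<v)) a , inj₁ refl
    ... | tri≈ _ u≡v _ = ⊥-elim (Adj-≢ a (Finₚ.toℕ-injective u≡v))
    ... | tri> _ _ v<u = (v , u) , allPairs-full _ , cong₂ _∧_ (fromT (ℕₚ.<⇒<ᵇ v<u)) (Adj-sym a) , inj₂ refl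

  Trans-numIsolated : Trans Isolated _≡_ (numIsolated G)
  Trans-numIsolated = Trans-filterᵇ _ (allFin n) (allFin⁺ n)
    (All.universal (λ v e w → not-true (λ a → true≢false (≡.trans (≡.sym e) (cong not (any-intro (adj G v) (∈-allFin w) a))))) _)
    (λ _ _ _ _ _ _ e → e)
    (λ v iso → v , ∈-allFin v , cong not (not-true λ e → let (w , a) = any-elim (adj G v) (allFin n) e in true≢false (≡.trans (≡.sym a) (iso w))) , refl)

  reach-sound : ∀ k {u v} → reach G k u v ≡ true → Conn u v
  reach-sound zero {u} {v} e with Finₚ.toℕ-injective {i = u} {v} (ℕₚ.≡ᵇ⇒≡ _ _ (toT e))
  ... | refl = ε
  reach-sound (suc k) {u} {v} e with ∨-true {reach G k u v} e
  ... | inj₁ r = reach-sound k r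
  ... | inj₂ r with any-elim (λ w → reach G k u w ∧ adj G w v) (allFin n) r
  ...   | w , q with ∧-true {reach G k u w} q
  ...     | s , a = reach-sound k s ◅◅ (a ◅ ε)

  reach-snoc : ∀ k {u w v} → reach G k u w ≡ true → Adj w v → reach G (suc k) u v ≡ true
  reach-snoc k {u} {w} {v} r a = ∨-introʳ (reach G k u v) (any-intro _ (∈-allFin w) (cong₂ _∧_ r a))

  reach-refl : ∀ u → reach G 0 u u ≡ true
  reach-refl u = fromT (ℕₚ.≡⇒≡ᵇ (toℕ u) _ refl)

  reach-suc : ∀ k {u v} → reach G k u v ≡ true → reach G (suc k) u v ≡ true
  reach-suc k e rewrite e = refl

  reach-mono : ∀ {k l u v} → k ≤ l → reach G k u v ≡ true → reach G l u v ≡ true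
  reach-mono {k} {l} {u} {v} k≤l r = subst (λ t → reach G t u v ≡ true) (ℕₚ.m∸n+n≡m k≤l) (up (l ∸ k))
    where
    up : ∀ j → reach G (j + k) u v ≡ true
    up zero = r
    up (suc j) = reach-suc (j + k) (up j)

  reach-cons : ∀ k {u w v} → Adj u w → reach G k w v ≡ true → reach G (suc k) u v ≡ true
  reach-cons zero {u} {w} {v} a e with Finₚ.toℕ-injective {i = w} {v} (ℕₚ.≡ᵇ⇒≡ _ _ (toT e))
  ... | refl = reach-snoc 0 {u} {u} {w} (reach-refl u) a
  reach-cons (suc k) {u} {w} {v} a e with ∨-true {reach G k w v} e
  ... | inj₁ r = reach-suc (suc k) (reach-cons k a r)
  ... | inj₂ r with any-elim (λ x → reach G k w x ∧ adj G x v) (allFin n) r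
  ...   | x , q with ∧-true {reach G k w x} q
  ...     | s , b = reach-snoc (suc k) (reach-cons k a s) b

  private
    data Path : Fin n → Fin n → List (Fin n) → Set where
      []  : ∀ {v} → Path v v []
      _∷_ : ∀ {u w v xs} → Adj u w → Path w v xs → Path u v (u ∷ xs)

    suffix : ∀ {u w v xs} → u ∈ xs → Path w v xs → Unique xs → ∃[ ys ] (Path u v ys × Unique ys)
    suffix (here refl) p@(_ ∷ _) uq = _ , p , uq
    suffix (there m) (_ ∷ p) (_ ∷ uq) = suffix m p uq

    simple : ∀ {u v} → Conn u v → ∃[ ys ] (Path u v ys × Unique ys)
    simple ε = [] , [] , []
    simple {u} (a ◅ c) with simple c
    ... | ys , p , uq with Any.any? (u Finₚ.≟_) ys
    ...   | yes m = suffix m p uq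
    ...   | no ¬m = u ∷ ys , a ∷ p , (fresh ys ¬m ∷ uq)
      where
      fresh : ∀ zs → ¬ u ∈ zs → All (u ≢_) zs
      fresh [] _ = []
      fresh (z ∷ zs) m = (λ e → m (here e)) ∷ fresh zs (m ∘ there)

    Path-reach : ∀ {u v xs} → Path u v xs → reach G (length xs) u v ≡ true
    Path-reach ([] {v}) = reach-refl v
    Path-reach (_∷_ {u} {w} {v} {xs} a p) = reach-cons (length xs) {u} {w} {v} a (Path-reach p)

  -- A walk is shortened to a path without repeated vertices, and such a path has at most `n` steps.
  reach-complete : ∀ {u v} → Conn u v → reach G n u v ≡ true
  reach-complete c with simple c
  ... | ys , p , uq = reach-mono short (Path-reach p)
    where
    short : length ys ≤ n
    short = subst (length ys ≤_) (length-tabulate {n = n} _)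
      (apart-≤ {R = _≡_} {S = _≡_} (λ { refl refl → refl }) ys (allFin n) uq (All.universal ∈-allFin ys))

  Conn-dec : ∀ u v → Dec (Conn u v)
  Conn-dec u v with reach G n u v in e
  ... | true  = yes (reach-sound n e)
  ... | false = no λ c → true≢false (≡.trans (≡.sym (reach-complete c)) e)

  Trans-numComponents : Trans Everything Conn (numComponents G)
  Trans-numComponents = Trans-filterᵇ _ (allFin n) (allFin⁺ n)
    (All.universal (λ _ _ → tt) _)
    (λ x y _ _ p q c → one x y p q c)
    (λ x _ → let (y , e , c) = least x (<-wellFounded _) in y , ∈-allFin y , e , c)
    where
    lower : Fin n → Fin n → Bool
    lower v u = (toℕ u <ᵇ toℕ v) ∧ reach G n u v
    isRep : Fin n → Bool
    isRep v = not (any (lower v) (allFin n))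
    minimal : ∀ x y → isRep y ≡ true → Conn x y → ¬ toℕ x < toℕ y
    minimal x y r c x<y = true≢false (≡.trans (≡.sym r)
      (cong not (any-intro (lower y) (∈-allFin x) (cong₂ _∧_ (fromT (ℕₚ.<⇒<ᵇ x<y)) (reach-complete c)))))
    one : ∀ x y → isRep x ≡ true → isRep y ≡ true → Conn x y → x ≡ y
    one x y p q c with ℕₚ.<-cmp (toℕ x) (toℕ y)
    ... | tri< l _ _ = ⊥-elim (minimal x y q c l)
    ... | tri≈ _ e _ = Finₚ.toℕ-injective e
    ... | tri> _ _ g = ⊥-elim (minimal y x p (Conn-sym c) g)
    least : ∀ x → Acc _<_ (toℕ x) → ∃[ y ] (isRep y ≡ true × Conn x y)
    least x (acc rs) with any (lower x) (allFin n) in e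
    ... | false = x , cong not e , ε
    ... | true with any-elim (lower x) (allFin n) e
    ...   | u , q with ∧-true {toℕ u <ᵇ toℕ x} q
    ...     | l , r with least u (rs (ℕₚ.<ᵇ⇒< _ _ (toT l)))
    ...       | y , f , c = y , f , Conn-sym (reach-sound n r) ◅◅ c

pairCode : ∀ {n} → Fin n × Fin n → Fin (n * n)
pairCode (u , v) = combine u v

pairCode-inj : ∀ {n} {d e : Fin n × Fin n} → pairCode d ≡ pairCode e → d ≡ e
pairCode-inj {d = u , v} {x , y} p with Finₚ.combine-injective u v x y p
... | refl , refl = refl

module PairOrbits {n : ℕ} where
  open Orbits (pairCode {n}) pairCode-inj public
  open Count (allPairs n) allPairs-full public

dartCode≡ : ∀ {n} (d : Fin n × Fin n) → dartCode d ≡ toℕ (pairCode d)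
dartCode≡ {n} (u , v) = ≡.trans (cong (_+ toℕ v) (ℕₚ.*-comm (toℕ u) n)) (≡.sym (Finₚ.toℕ-combine u v))

-- The face permutation, extended to all ordered pairs by fixing the non-darts.
module _ {n} (G : Graph n) (rot : Fin n → Fin n → Fin n) where

  faceNext : Fin n × Fin n → Fin n × Fin n
  faceNext (u , v) = if adj G u v then (v , rot v u) else (u , v)

  faceNext-dart : ∀ {u v} → Adj G u v → faceNext (u , v) ≡ (v , rot v u)
  faceNext-dart a rewrite a = refl

  faceNext-nondart : ∀ {u v} → adj G u v ≡ false → faceNext (u , v) ≡ (u , v)
  faceNext-nondart a rewrite a = refl

  module _ (R : IsRotationSystem G rot) where

    rot-Adj : ∀ {u v} → Adj G u v → Adj G u (rot u v)
    rot-Adj = proj₁ R _ _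

    rot-inj : ∀ {u v w} → Adj G u v → Adj G u w → rot u v ≡ rot u w → v ≡ w
    rot-inj = proj₁ (proj₂ R) _ _ _

    rot-cycle : ∀ {u v w} → Adj G u v → Adj G u w → ∃[ k ] iter k (rot u) v ≡ w
    rot-cycle = proj₂ (proj₂ R) _ _ _

    faceStep-dart : ∀ d → IsDart G d → IsDart G (faceStep rot d)
    faceStep-dart (u , v) a = rot-Adj (Adj-sym G a)

    faceNext-inj : ∀ {d e} → faceNext d ≡ faceNext e → d ≡ e
    faceNext-inj {u , v} {x , y} p with adj G u v in a | adj G x y in b
    ... | false | false = p
    ... | true  | false with p
    ...   | refl = ⊥-elim (true≢false (≡.trans (≡.sym (faceStep-dart (u , v) a)) b))
    faceNext-inj {u , v} {x , y} p | false | true with p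
    ...   | refl = ⊥-elim (true≢false (≡.trans (≡.sym (faceStep-dart (x , y) b)) a))
    faceNext-inj {u , v} {x , y} p | true  | true with cong proj₁ p | cong proj₂ p
    ...   | refl | q = cong (_, v) (rot-inj (Adj-sym G a) (Adj-sym G b) q)

    open PairOrbits {n}

    iter-faceStep : ∀ k d → IsDart G d → iter k (faceStep rot) d ≡ iter k faceNext d × IsDart G (iter k (faceStep rot) d)
    iter-faceStep zero d a = refl , a
    iter-faceStep (suc k) d a with iter-faceStep k d a
    ... | e , b = ≡.trans (≡.sym (faceNext-dart b)) (cong faceNext e) , faceStep-dart _ b

    Trans-numFaces : Trans (IsDart G) (faceNext ⊢_~_) (numFaces G rot)
    Trans-numFaces = Trans-filterᵇ (isFaceRep rot) (darts G)
      (filterᵇ-AllPairs dart? (allPairs-unique n))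
      (All.map (λ a _ → a) (filterᵇ-true dart? (allPairs n)))
      (λ d e a b p q de → one d e a b p q de)
      (λ d a → let (e , b , p , de) = least d a (<-wellFounded _) in
        e , filterᵇ-∈ dart? (allPairs-full e) b , p , de)
      where
      dart? : Fin n × Fin n → Bool
      dart? p = adj G (proj₁ p) (proj₂ p)
      below : Fin n × Fin n → ℕ → Bool
      below d k = dartCode d ≤ᵇ dartCode (iter k (faceStep rot) d)
      minimal : ∀ d e → IsDart G d → isFaceRep rot d ≡ true → faceNext ⊢ d ~ e → dartCode d ≤ dartCode e
      -- The codes of ordered pairs lie in `Fin (n * n)`, so the iterates inspected by `isFaceRep`
      -- exhaust the orbit.
      minimal d e a p de with ~-bounded faceNext-inj de
      ... | k , k< , refl = subst (λ t → dartCode d ≤ dartCode t) (proj₁ (iter-faceStep k d a))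
        (ℕₚ.≤ᵇ⇒≤ _ _ (toT (all-elim (below d) p (∈-upTo⁺ k<))))
      one : ∀ d e → IsDart G d → IsDart G e → isFaceRep rot d ≡ true → isFaceRep rot e ≡ true →
            faceNext ⊢ d ~ e → d ≡ e
      one d e a b p q de = pairCode-inj (Finₚ.toℕ-injective (≡.trans (≡.sym (dartCode≡ d))
        (≡.trans (ℕₚ.≤-antisym (minimal d e a p de) (minimal e d b q (~-sym faceNext-inj de))) (dartCode≡ e))))
      least : ∀ d → IsDart G d → Acc _<_ (dartCode d) →
              ∃[ e ] (IsDart G e × isFaceRep rot e ≡ true × faceNext ⊢ d ~ e)
      least d a (acc rs) with isFaceRep rot d in r
      ... | true = d , a , r , ~-refl
      ... | false with all-counter (below d) (upTo (n * n)) r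
      ...   | k , q with iter-faceStep k d a
      ...     | ek , b with least (iter k (faceStep rot) d) b
                  (rs (ℕₚ.≰⇒> λ le → true≢false (≡.trans (≡.sym (fromT (ℕₚ.≤⇒≤ᵇ le))) q)))
      ...       | e , c , p , ke = e , c , p , ~-trans (k , ≡.sym ek) ke

-- Deletion of an edge and Euler's inequality

Trans-cons : {X : Set} {P P′ : X → Set} {R : X → X → Set} (x : X) →
  (∀ y → P y → P′ y) → P′ x → (∀ y → P y → ¬ R x y) → (∀ y → P′ y → P y ⊎ R y x) →
  ∀ {k} → Trans P R k → Trans P′ R (suc k)
Trans-cons x up px sep split t = record
  { reps = x ∷ reps t ; size = cong suc (size t)
  ; valid = px ∷ All.map (up _) (valid t)
  ; apart = All.map (sep _) (valid t) ∷ apart t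
  ; cover = λ y p → [ (λ q → there (cover t y q)) , here ]′ (split y p) }

dec-adj : ∀ {n} (G : Graph n) x y → Adj G x y ⊎ adj G x y ≡ false
dec-adj G x y with adj G x y
... | true  = inj₁ refl
... | false = inj₂ refl

Adj-absurd : ∀ {n} (G : Graph n) {x y} → Adj G x y → ¬ adj G x y ≡ false
Adj-absurd G a b = true≢false (≡.trans (≡.sym a) b)

NonDart : ∀ {n} → Graph n → Fin n × Fin n → Set
NonDart G d = adj G (proj₁ d) (proj₂ d) ≡ false

Trans-nondarts : ∀ {n} (G : Graph n) → ∃ (Trans (NonDart G) _≡_)
Trans-nondarts {n} G = _ , Trans-filterᵇ (λ d → not (adj G (proj₁ d) (proj₂ d))) (allPairs n) (allPairs-unique n)
  (All.universal (λ d e → not-true (λ a → true≢false (≡.trans (≡.sym e) (cong not a)))) _)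
  (λ _ _ _ _ _ _ e → e)
  (λ d e → d , allPairs-full d , cong not e , refl)

≡-com : {X : Set} {x x′ y : X} → x ≡ y → x′ ≡ y → x ≡ x′
≡-com refl refl = refl

module _ {n} (G : Graph n) {rot : Fin n → Fin n → Fin n} (R : IsRotationSystem G rot) where
  open PairOrbits {n}

  -- Every non-dart is a fixed point and contributes an orbit of its own; the other orbits are the
  -- faces.
  Orbs-faceNext : ∀ {k} → Trans (NonDart G) _≡_ k → Orbs (faceNext G rot) (numFaces G rot + k)
  Orbs-faceNext t = record
    { reps = reps f ++ reps t
    ; size = ≡.trans (length-++ (reps f)) (cong₂ _+_ (size f) (size t))
    ; valid = All.universal (λ _ → tt) _
    ; apart = AllPairsₚ.++⁺ (apart f)
        (AllPairs-map-valid (λ {x} p _ x≢y r → x≢y (fixed-~ (faceNext-nondart G rot p) r)) (valid t) (apart t))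
        (All.map (λ {d} a → All.map (λ {e} b r → Adj-absurd G a (subst (NonDart G)
          (fixed-~ (faceNext-nondart G rot b) (~-sym (faceNext-inj G rot R) r)) b)) (valid t)) (valid f))
    ; cover = λ d _ → cov d }
    where
    f = Trans-numFaces G rot R
    fixed-~ : ∀ {φ x y} → φ x ≡ x → φ ⊢ x ~ y → x ≡ y
    fixed-~ {φ} {x} e (k , p) = ≡.trans (≡.sym (go k)) p
      where
      go : ∀ k → iter k φ x ≡ x
      go zero = refl
      go (suc k) = ≡.trans (cong φ (go k)) e
    cov : ∀ d → Any (faceNext G rot ⊢ d ~_) (reps f ++ reps t)
    cov d with dec-adj G (proj₁ d) (proj₂ d)
    ... | inj₁ a = Anyₚ.++⁺ˡ (cover f d a)
    ... | inj₂ b = Anyₚ.++⁺ʳ (reps f) (Any.map (λ e → 0 , e) (cover t d b))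

record Deletion {n} (G G′ : Graph n) (u v : Fin n) : Set where
  field
    present : Adj G u v
    absent  : adj G′ u v ≡ false
    weaken  : ∀ {x y} → Adj G′ x y → Adj G x y
    other   : ∀ {x y} → Adj G x y → Adj G′ x y ⊎ ((x , y) ≡ (u , v) ⊎ (x , y) ≡ (v , u))

Deletion-same : ∀ {n} {G G′ : Graph n} {u v} → Deletion G G′ u v →
  ∀ x y → (x , y) ≢ (u , v) → (x , y) ≢ (v , u) → adj G′ x y ≡ adj G x y
Deletion-same {G = G} {G′} D x y n m with dec-adj G x y
... | inj₂ b = ≡.trans (not-true λ c → Adj-absurd G (Deletion.weaken D c) b) (≡.sym b)
... | inj₁ c with Deletion.other D c
...   | inj₁ c′ = ≡.trans c′ (≡.sym c)
...   | inj₂ (inj₁ p) = ⊥-elim (n p)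
...   | inj₂ (inj₂ p) = ⊥-elim (m p)

-- Skipping once is enough as long as G′ lacks at most one neighbour of x.
skipRot : ∀ {n} → Graph n → (Fin n → Fin n → Fin n) → Fin n → Fin n → Fin n
skipRot G′ rot x y = if adj G′ x (rot x y) then rot x y else rot x (rot x y)

module Delete {n} {G G′ : Graph n} {u v : Fin n} (D : Deletion G G′ u v) where
  open Deletion D
  open PairOrbits {n}

  d e : Fin n × Fin n
  d = u , v
  e = v , u

  u≢v : u ≢ v
  u≢v = Adj-≢ G present

  absent′ : adj G′ v u ≡ false
  absent′ = ≡.trans (sym G′ v u) absent

  private
    d≢e : d ≢ e
    d≢e = u≢v ∘ cong proj₁

    lost : ∀ {x y} → Adj G x y → adj G′ x y ≡ false → (x , y) ≡ d ⊎ (x , y) ≡ e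
    lost a b with other a
    ... | inj₁ a′ = ⊥-elim (Adj-absurd G′ a′ b)
    ... | inj₂ r = r

    lost-unique : ∀ {x y z} → Adj G x y → adj G′ x y ≡ false → Adj G x z → adj G′ x z ≡ false → y ≡ z
    lost-unique a b a′ b′ with lost a b | lost a′ b′
    ... | inj₁ refl | inj₁ refl = refl
    ... | inj₁ refl | inj₂ p = ⊥-elim (u≢v (cong proj₁ p))
    ... | inj₂ refl | inj₁ p = ⊥-elim (u≢v (≡.sym (cong proj₁ p)))
    ... | inj₂ refl | inj₂ refl = refl

  edges : numEdges G ≡ suc (numEdges G′)
  edges = Trans-unique SameEdge-com (Trans-numEdges G)
    (Trans-cons d (λ _ → weaken) present sep split (Trans-numEdges G′))
    where
    sep : ∀ y → IsDart G′ y → ¬ SameEdge d y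
    sep y a (inj₁ refl) = Adj-absurd G′ a absent
    sep y a (inj₂ refl) = Adj-absurd G′ a absent′
    split : ∀ y → IsDart G y → IsDart G′ y ⊎ SameEdge y d
    split y a with other a
    ... | inj₁ a′ = inj₁ a′
    ... | inj₂ r = inj₂ r

  nondarts : ∀ {k} → Trans (NonDart G) _≡_ k → Trans (NonDart G′) _≡_ (2 + k)
  nondarts t = Trans-cons {P = λ y → NonDart G y ⊎ y ≡ d} e
    (λ { (x , y) (inj₁ b) → down b ; _ (inj₂ refl) → absent })
    absent′
    (λ { y (inj₁ b) refl → Adj-absurd G (Adj-sym G present) b ; _ (inj₂ p) q → d≢e (≡.trans (≡.sym p) (≡.sym q)) })
    split
    (Trans-cons {P = NonDart G} d (λ _ → inj₁) (inj₂ refl) (λ { y b refl → Adj-absurd G present b })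
      (λ _ p → p) t)
    where
    down : ∀ {x y} → adj G x y ≡ false → adj G′ x y ≡ false
    down b = not-true λ a → Adj-absurd G (weaken a) b
    split : ∀ y → NonDart G′ y → (NonDart G y ⊎ y ≡ d) ⊎ y ≡ e
    split (x , y) b with dec-adj G x y
    ... | inj₂ c = inj₁ (inj₁ c)
    ... | inj₁ a with lost a b
    ...   | inj₁ p = inj₁ (inj₂ p)
    ...   | inj₂ p = inj₂ p

  Conn-weaken : ∀ {x y} → Conn G′ x y → Conn G x y
  Conn-weaken = Star.map weaken

  Conn-split : ∀ {x y} → Conn G x y →
    Conn G′ x y ⊎ (Conn G′ x u × Conn G′ v y) ⊎ (Conn G′ x v × Conn G′ u y)
  Conn-split ε = inj₁ ε
  Conn-split (a ◅ c) with other a | Conn-split c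
  ... | inj₁ b | inj₁ r = inj₁ (b ◅ r)
  ... | inj₁ b | inj₂ (inj₁ (r , s)) = inj₂ (inj₁ (b ◅ r , s))
  ... | inj₁ b | inj₂ (inj₂ (r , s)) = inj₂ (inj₂ (b ◅ r , s))
  ... | inj₂ (inj₁ refl) | inj₁ r = inj₂ (inj₁ (ε , r))
  ... | inj₂ (inj₁ refl) | inj₂ (inj₁ (r , s)) = inj₂ (inj₁ (ε , s))
  ... | inj₂ (inj₁ refl) | inj₂ (inj₂ (r , s)) = inj₁ s
  ... | inj₂ (inj₂ refl) | inj₁ r = inj₂ (inj₂ (ε , r))
  ... | inj₂ (inj₂ refl) | inj₂ (inj₁ (r , s)) = inj₁ s
  ... | inj₂ (inj₂ refl) | inj₂ (inj₂ (r , s)) = inj₂ (inj₂ (ε , s))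

  components-same : Conn G′ u v → numComponents G′ ≡ numComponents G
  components-same c = Trans-unique (Conn-com G)
    (Trans-cong (λ _ _ → tt) (λ _ _ → tt) (λ _ _ _ _ → Conn-weaken) (λ _ _ _ _ → back ∘ Conn-split) (Trans-numComponents G′))
    (Trans-numComponents G)
    where
    back : ∀ {x y} → Conn G′ x y ⊎ (Conn G′ x u × Conn G′ v y) ⊎ (Conn G′ x v × Conn G′ u y) → Conn G′ x y
    back (inj₁ r) = r
    back (inj₂ (inj₁ (r , s))) = r ◅◅ c ◅◅ s
    back (inj₂ (inj₂ (r , s))) = r ◅◅ Conn-sym G′ c ◅◅ s

  components-suc : ¬ Conn G′ u v → numComponents G′ ≡ suc (numComponents G)
  components-suc ¬c with Trans-merge (Conn-sym G′) _◅◅_ _◅◅_ Conn-weaken (present ◅ ε) Conn-split ¬c (Trans-numComponents G′)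
  ... | l , p , t = ≡.trans p (cong suc (Trans-unique (Conn-com G) t (Trans-numComponents G)))

  components-≤ : numComponents G′ ≤ suc (numComponents G)
  components-≤ with Conn-dec G′ u v
  ... | yes c = ℕₚ.≤-trans (ℕₚ.≤-reflexive (components-same c)) (ℕₚ.n≤1+n _)
  ... | no ¬c = ℕₚ.≤-reflexive (components-suc ¬c)

  module Rot {rot rot′ : Fin n → Fin n → Fin n} (R : IsRotationSystem G rot)
             (agree : ∀ {x y} → Adj G′ x y → rot′ x y ≡ skipRot G′ rot x y) where

    private
      data View (x y : Fin n) : Set where
        stays : Adj G′ x (rot x y) → rot′ x y ≡ rot x y → View x y
        skips : adj G′ x (rot x y) ≡ false → Adj G′ x (rot x (rot x y)) → rot′ x y ≡ rot x (rot x y) → View x y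

      view : ∀ {x y} → Adj G′ x y → View x y
      view {x} {y} a with adj G′ x (rot x y) in q | agree a
      ... | true  | p = stays q p
      ... | false | p = skips q next p
        where
        b : Adj G x (rot x y)
        b = rot-Adj G rot R (weaken a)
        next : Adj G′ x (rot x (rot x y))
        next with dec-adj G′ x (rot x (rot x y))
        ... | inj₁ c = c
        -- Were this neighbour lost too, it would coincide with `rot x y`; then `rot x y` would be
        -- `y`, which is still a neighbour in `G′`.
        ... | inj₂ c = ⊥-elim (Adj-absurd G′ a (subst (λ t → adj G′ x t ≡ false)
                (rot-inj G rot R b (weaken a) (lost-unique (rot-Adj G rot R b) c b q)) q))

      view-Adj : ∀ {x y} → View x y → Adj G′ x (rot′ x y)
      view-Adj (stays a p)   = subst (Adj G′ _) (≡.sym p) a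
      view-Adj (skips _ a p) = subst (Adj G′ _) (≡.sym p) a

      next-inj : ∀ {x y z} → Adj G′ x y → Adj G′ x z → View x y → View x z → rot′ x y ≡ rot′ x z → y ≡ z
      next-inj a b (stays _ p) (stays _ q) r = rot-inj G rot R (weaken a) (weaken b) (≡.trans (≡.sym p) (≡.trans r q))
      next-inj a b (stays _ p) (skips o _ q) r
        with rot-inj G rot R (weaken a) (rot-Adj G rot R (weaken b)) (≡.trans (≡.sym p) (≡.trans r q))
      ... | refl = ⊥-elim (Adj-absurd G′ a o)
      next-inj a b (skips o _ p) (stays _ q) r
        with rot-inj G rot R (rot-Adj G rot R (weaken a)) (weaken b) (≡.trans (≡.sym p) (≡.trans r q))
      ... | refl = ⊥-elim (Adj-absurd G′ b o)
      next-inj a b (skips _ _ p) (skips _ _ q) r = rot-inj G rot R (weaken a) (weaken b)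
        (rot-inj G rot R (rot-Adj G rot R (weaken a)) (rot-Adj G rot R (weaken b)) (≡.trans (≡.sym p) (≡.trans r q)))

      -- A skip covers two steps of `rot x` at once. It cannot jump over the target, because the
      -- skipped vertex is no neighbour in `G′` and the target is one.
      reaches : ∀ k {x y z} → Adj G′ x y → Adj G′ x z → iter k (rot x) y ≡ z → ∃[ l ] iter l (rot′ x) y ≡ z
      advance : ∀ k {x y z} → Adj G′ x y → Adj G′ x z → View x y → iter (suc k) (rot x) y ≡ z → ∃[ l ] iter l (rot′ x) y ≡ z
      reaches zero    a b p = 0 , p
      reaches (suc k) a b p = advance k a b (view a) p
      prepend : ∀ {x y w z} → rot′ x y ≡ w → ∃[ l ] iter l (rot′ x) w ≡ z → ∃[ l ] iter l (rot′ x) y ≡ z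
      prepend {x} {y} refl (l , r) = suc l , ≡.trans (≡.sym (iter-comm (rot′ x) l y)) r
      advance k a b (stays c q) p = prepend q (reaches k c b (≡.trans (iter-comm _ k _) p))
      advance zero a b (skips o _ _) refl = ⊥-elim (Adj-absurd G′ b o)
      advance (suc k) {x} {y} a b (skips o c q) p = prepend q (reaches k c b
        (≡.trans (iter-comm (rot x) k (rot x y)) (≡.trans (cong (rot x) (iter-comm (rot x) k y)) p)))

    isRot : IsRotationSystem G′ rot′
    isRot = (λ x y a → view-Adj (view a)) , (λ x y z a b → next-inj a b (view a) (view b)) ,
      λ x y z a b → let (k , p) = rot-cycle G rot R (weaken a) (weaken b) in reaches k a b p

    φ φ′ ψ ψ₁ : Fin n × Fin n → Fin n × Fin n
    φ  = faceNext G rot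
    φ′ = faceNext G′ rot′
    ψ  = φ ∘ swp d e
    ψ₁ = detach ψ d

    φ-inj : Inj φ
    φ-inj = faceNext-inj G rot R

    private
      ψ-inj : Inj ψ
      ψ-inj = swp-inj φ-inj d e

      ψd : ψ d ≡ (u , rot u v)
      ψd = ≡.trans (cong φ (swpˡ d e)) (faceNext-dart G rot (Adj-sym G present))

      ψe : ψ e ≡ (v , rot v u)
      ψe = ≡.trans (cong φ (swpʳ d e)) (faceNext-dart G rot present)

      ψ₁e : ψ₁ e ≡ (v , rot v u)
      ψ₁e = ≡.trans (detach-miss ψ d (d≢e ∘ ≡.sym) (λ p → u≢v (≡.sym (cong proj₁ (≡.trans (≡.sym ψe) p))))) ψe

      -- Deleting uv multiplies the face permutation by the transposition of d and e and then fixes d and e.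
      φ′≡ : ∀ p → detach ψ₁ e p ≡ φ′ p
      φ′≡ p = at-view p (swpView d e p)
        where
        at-view : ∀ p → SwpView d e p → detach ψ₁ e p ≡ φ′ p
        at-view _ (isʳ refl _) = ≡.trans (detach-at ψ₁ e) (≡.sym (faceNext-nondart G′ rot′ absent′))
        at-view _ (isˡ refl _) = ≡.trans (detach-miss ψ₁ e d≢e (λ r → d≢e (≡.trans (≡.sym at) r)))
                             (≡.trans at (≡.sym (faceNext-nondart G′ rot′ absent)))
          where
          at = detach-at ψ d
        at-view p@(x , y) (else p≢d p≢e q) = at-dart (dec-adj G′ x y)
          where
          at-dart : Adj G′ x y ⊎ adj G′ x y ≡ false → detach ψ₁ e p ≡ φ′ p
          at-dart (inj₂ b) = ≡.trans (detach-miss ψ₁ e p≢e (λ r → p≢e (≡.trans (≡.sym ψ₁p) r))) (≡.trans ψ₁p (≡.sym (faceNext-nondart G′ rot′ b)))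
            where
            ψp : ψ p ≡ p
            ψp with dec-adj G x y
            ... | inj₁ a = ⊥-elim ([ p≢d , p≢e ]′ (lost a b))
            ... | inj₂ c = ≡.trans (cong φ q) (faceNext-nondart G rot c)
            ψ₁p : ψ₁ p ≡ p
            ψ₁p = ≡.trans (detach-miss ψ d p≢d (λ r → p≢d (≡.trans (≡.sym ψp) r))) ψp
          at-dart (inj₁ a) = go (view (Adj-sym G′ a))
            where
            ψp : ψ p ≡ (y , rot y x)
            ψp = ≡.trans (cong φ q) (faceNext-dart G rot (weaken a))
            φ′p : ∀ {w} → rot′ y x ≡ w → (y , w) ≡ φ′ p
            φ′p refl = ≡.sym (faceNext-dart G′ rot′ a)
            go : View y x → detach ψ₁ e p ≡ φ′ p
            go (stays c r) = ≡.trans (detach-miss ψ₁ e p≢e λ s → ≢e (≡.trans (≡.sym ψ₁p) s)) (≡.trans ψ₁p (φ′p r))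
              where
              ≢d : (y , rot y x) ≢ d
              ≢d refl = Adj-absurd G′ c absent
              ≢e : (y , rot y x) ≢ e
              ≢e refl = Adj-absurd G′ c absent′
              ψ₁p : ψ₁ p ≡ (y , rot y x)
              ψ₁p = ≡.trans (detach-miss ψ d p≢d λ s → ≢d (≡.trans (≡.sym ψp) s)) ψp
            go (skips o c r) = [ at-d , at-e ]′ (lost (rot-Adj G rot R (weaken (Adj-sym G′ a))) o)
              where
                at-d : (y , rot y x) ≡ d → detach ψ₁ e p ≡ φ′ p
                at-d s = ≡.trans (detach-miss ψ₁ e p≢e λ t → u≢v (cong proj₁ (≡.trans (≡.sym ψ₁p) t)))
                                 (≡.trans ψ₁p (≡.trans (cong₂ (λ i j → (i , rot i j)) (≡.sym (cong proj₁ s)) (≡.sym (cong proj₂ s))) (φ′p r)))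
                  where
                  ψ₁p : ψ₁ p ≡ (u , rot u v)
                  ψ₁p = ≡.trans (detach-hit ψ d p≢d (≡.trans ψp s)) ψd
                at-e : (y , rot y x) ≡ e → detach ψ₁ e p ≡ φ′ p
                at-e s = ≡.trans (detach-hit ψ₁ e p≢e ψ₁p)
                                 (≡.trans ψ₁e (≡.trans (cong₂ (λ i j → (i , rot i j)) (≡.sym (cong proj₁ s)) (≡.sym (cong proj₂ s))) (φ′p r)))
                  where
                  ψ₁p : ψ₁ p ≡ e
                  ψ₁p = ≡.trans (detach-miss ψ d p≢d (λ t → d≢e (≡.trans (≡.sym t) (≡.trans ψp s)))) (≡.trans ψp s)

      isolated-when : ∀ {x y} → Adj G x y → adj G′ x y ≡ false → rot x y ≡ y → Isolated G′ x
      isolated-when {x} {y} a o p w = not-true λ b → let (k , q) = rot-cycle G rot R a (weaken b) in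
        Adj-absurd G′ b (subst (λ t → adj G′ x t ≡ false) (≡.trans (≡.sym (fix k)) q) o)
        where
        fix : ∀ k → iter k (rot x) y ≡ y
        fix zero = refl
        fix (suc k) = ≡.trans (cong (rot x) (fix k)) p

      -- Losing xy either isolates x or detaches the dart xy from a longer orbit;
      -- either way the number of orbits plus isolated vertices grows by one.
      record End (x y : Fin n) : Set₁ where
        field
          orb iso : ℕ
          total   : orb + iso ≡ 1
          -- Both fields allow an arbitrary map or predicate, because the end `v` is treated after
          -- the end `u` has already changed the counts.
          orbits  : ∀ {φ₀} → Inj φ₀ → φ₀ (x , y) ≡ (x , rot x y) → ∀ {k} → Orbs φ₀ k → Orbs (detach φ₀ (x , y)) (orb + k)
          isolate : ∀ {P : Fin n → Set} → ¬ P x → ∀ {k} → Trans P _≡_ k → Trans (λ z → P z ⊎ (z ≡ x × Isolated G′ x)) _≡_ (iso + k)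

      end : ∀ {x y} → Adj G x y → adj G′ x y ≡ false → End x y
      end {x} {y} a o with rot x y Finₚ.≟ y
      ... | yes p = record { orb = 0 ; iso = 1 ; total = refl
        ; orbits = λ inj q → detach-fixed inj (≡.trans q (cong (x ,_) p))
        ; isolate = λ ¬Px → Trans-cons x (λ _ → inj₁) (inj₂ (refl , isolated-when a o p)) (λ { _ Py refl → ¬Px Py })
            (λ { _ (inj₁ Py) → inj₁ Py ; _ (inj₂ (z , _)) → inj₂ z }) }
      ... | no ¬p = record { orb = 1 ; iso = 0 ; total = refl
        ; orbits = λ inj q → detach-moved inj (λ r → ¬p (cong proj₂ (≡.trans (≡.sym q) r)))
        ; isolate = λ ¬Px → Trans-cong (λ _ → inj₁) (λ { _ (inj₁ Py) → Py ; _ (inj₂ (_ , i)) → ⊥-elim (alive i) })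
            (λ _ _ _ _ r → r) (λ _ _ _ _ r → r) }
        where
        alive : ¬ Isolated G′ x
        alive i = ¬p (lost-unique (rot-Adj G rot R a) (i _) a o)

      eu = end present absent
      ev = end (Adj-sym G present) absent′
      open End

      isolated-count : numIsolated G′ ≡ iso ev + (iso eu + numIsolated G)
      isolated-count = Trans-unique ≡-com (Trans-numIsolated G′)
        (Trans-cong (λ { _ (inj₁ (inj₁ i)) w → not-true (λ a → Adj-absurd G (weaken a) (i w))
                       ; _ (inj₁ (inj₂ (refl , i))) → i ; _ (inj₂ (refl , i)) → i })
          split (λ _ _ _ _ r → r) (λ _ _ _ _ r → r)
          (isolate ev (λ { (inj₁ i) → Adj-absurd G (Adj-sym G present) (i u) ; (inj₂ (p , _)) → u≢v (≡.sym p) })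
            (isolate eu (λ i → Adj-absurd G present (i v)) (Trans-numIsolated G))))
        where
        split : ∀ z → Isolated G′ z → (Isolated G z ⊎ (z ≡ u × Isolated G′ u)) ⊎ (z ≡ v × Isolated G′ v)
        split z i with z Finₚ.≟ u | z Finₚ.≟ v
        ... | yes refl | _ = inj₁ (inj₂ (refl , i))
        ... | no _ | yes refl = inj₂ (refl , i)
        ... | no z≢u | no z≢v = inj₁ (inj₁ λ w → not-true λ a →
          [ z≢u ∘ cong proj₁ , z≢v ∘ cong proj₁ ]′ (lost a (i w)))

      ψ-orbits : ∀ {k} → Orbs ψ k → Orbs φ′ (orb ev + (orb eu + k))
      ψ-orbits t = Orbs-cong φ′≡ (orbits ev {φ₀ = ψ₁} (detach-inj ψ-inj d) ψ₁e (orbits eu {φ₀ = ψ} ψ-inj ψd t))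

      nd = Trans-nondarts G
      φ-orbits = Orbs-faceNext G R (proj₂ nd)
      φ′-orbits = Orbs-faceNext G′ isRot (nondarts (proj₂ nd))

      -- The two new non-darts are paid for by the two ends of the edge, one unit each, in orbits or
      -- in isolated vertices. This is the 2 that cancels.
      balance : ∀ {k} → Orbs ψ k → numFaces G′ rot′ + numIsolated G′ + proj₁ nd ≡ k + numIsolated G
      balance {k} t = ℕₚ.+-cancelʳ-≡ 2 _ _ (begin
        f′ + i′ + m + 2                                          ≡⟨ regroup f′ i′ m ⟩
        (f′ + (2 + m)) + i′                                      ≡⟨ cong₂ _+_ (Orbs-unique (faceNext-inj G′ rot′ isRot) φ′-orbits (ψ-orbits t)) isolated-count ⟩
        (orb ev + (orb eu + k)) + (iso ev + (iso eu + i))        ≡⟨ regroup′ (orb ev) (orb eu) k (iso ev) (iso eu) i ⟩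
        (k + i) + ((orb ev + iso ev) + (orb eu + iso eu))        ≡⟨ cong₂ (λ a b → k + i + (a + b)) (total ev) (total eu) ⟩
        k + i + 2 ∎)
        where
        open ≡.≡-Reasoning
        f′ = numFaces G′ rot′
        i′ = numIsolated G′
        i = numIsolated G
        m = proj₁ nd
        open +-*-Solver
        regroup : ∀ a b c → a + b + c + 2 ≡ (a + (2 + c)) + b
        regroup = solve 3 (λ a b c → a :+ b :+ c :+ con 2 := (a :+ (con 2 :+ c)) :+ b) refl
        regroup′ : ∀ p q k r s i → (p + (q + k)) + (r + (s + i)) ≡ (k + i) + ((p + r) + (q + s))
        regroup′ = solve 6 (λ p q k r s i → (p :+ (q :+ k)) :+ (r :+ (s :+ i)) := (k :+ i) :+ ((p :+ r) :+ (q :+ s))) refl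

      shuffle : ∀ a b c → a + b + c ≡ a + c + b
      shuffle = solve 3 (λ a b c → a :+ b :+ c := a :+ c :+ b) refl
        where open +-*-Solver

    faces-same : φ ⊢ d ~ e → numFaces G′ rot′ + numIsolated G′ ≡ suc (numFaces G rot + numIsolated G)
    faces-same de = ℕₚ.+-cancelʳ-≡ (proj₁ nd) _ _ (≡.trans (balance (swap-same φ-inj d≢e de φ-orbits))
      (cong suc (shuffle (numFaces G rot) (proj₁ nd) (numIsolated G))))

    faces-diff : ¬ φ ⊢ d ~ e → suc (numFaces G′ rot′ + numIsolated G′) ≡ numFaces G rot + numIsolated G
    faces-diff ¬de = ℕₚ.+-cancelʳ-≡ (proj₁ nd) _ _ (≡.trans (cong suc (balance t))
      (≡.trans (cong (_+ numIsolated G) (≡.sym (swap-diff φ-inj d≢e ¬de φ-orbits t)))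
        (shuffle (numFaces G rot) (proj₁ nd) (numIsolated G))))
      where
      t = proj₂ (orbs ψ-inj)

    -- The face of d, traversed from the head of d, is a walk avoiding the edge uv.
    apart⇒Conn : ¬ φ ⊢ d ~ e → Conn G′ u v
    apart⇒Conn ¬de = Conn-sym G′ (walk (proj₁ back) (φ d) φd (proj₂ back)
        (λ r → ¬de (~-trans (~-step d) r)))
      where
      back = ~-sym φ-inj (~-step {φ} d)
      φd : ∃[ w ] (φ d ≡ (v , w) × Adj G v w)
      φd = rot v u , faceNext-dart G rot present , rot-Adj G rot R (Adj-sym G present)
      walk : ∀ k p {a} → ∃[ b ] (p ≡ (a , b) × Adj G a b) → iter k φ p ≡ d → ¬ φ ⊢ p ~ e → Conn G′ a u
      walk zero    _ (b , refl , _) refl _ = ε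
      walk (suc k) _ {a} (b , refl , ab) r n with other ab
      ... | inj₂ (inj₁ refl) = ε
      ... | inj₂ (inj₂ refl) = ⊥-elim (n ~-refl)
      ... | inj₁ ab′ = ab′ ◅ walk k _ (rot b a , faceNext-dart G rot ab , rot-Adj G rot R (Adj-sym G ab))
              (≡.trans (iter-comm φ k _) r) (λ s → n (~-trans (~-step _) s))

    d~e? : Dec (φ ⊢ d ~ e)
    d~e? = ~-dec φ-inj d e

hits : ∀ {n} → Fin n → Fin n → Fin n → Fin n → Bool
hits u v x y = (does (x Finₚ.≟ u) ∧ does (y Finₚ.≟ v)) ∨ (does (x Finₚ.≟ v) ∧ does (y Finₚ.≟ u))

hits-sym : ∀ {n} (u v x y : Fin n) → hits u v x y ≡ hits u v y x
hits-sym u v x y = ≡.trans (∨-comm (does (x Finₚ.≟ u) ∧ does (y Finₚ.≟ v)) _)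
  (cong₂ _∨_ (∧-comm (does (x Finₚ.≟ v)) _) (∧-comm (does (x Finₚ.≟ u)) _))

delEdge : ∀ {n} → Graph n → Fin n → Fin n → Graph n
delEdge G u v = record
  { adj    = λ x y → adj G x y ∧ not (hits u v x y)
  ; sym    = λ x y → cong₂ (λ a b → a ∧ not b) (sym G x y) (hits-sym u v x y)
  ; irrefl = λ x → cong (_∧ _) (irrefl G x) }

delEdge-Deletion : ∀ {n} (G : Graph n) {u v} → Adj G u v → Deletion G (delEdge G u v) u v
delEdge-Deletion G {u} {v} a = record
  { present = a
  ; absent = ≡.trans (cong (λ b → adj G u v ∧ not b) hit) (∧-zeroʳ _)
  ; weaken = λ e → proj₁ (∧-true e)
  ; other = other′ }
  where
  hit : hits u v u v ≡ true
  hit rewrite dec-true (u Finₚ.≟ u) refl | dec-true (v Finₚ.≟ v) refl = refl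
  other′ : ∀ {x y} → Adj G x y → Adj (delEdge G u v) x y ⊎ ((x , y) ≡ (u , v) ⊎ (x , y) ≡ (v , u))
  other′ {x} {y} b with x Finₚ.≟ u | y Finₚ.≟ v | x Finₚ.≟ v | y Finₚ.≟ u
  ... | yes refl | yes refl | _ | _ = inj₂ (inj₁ refl)
  ... | yes _ | no _ | yes refl | yes refl = inj₂ (inj₂ refl)
  ... | yes _ | no _ | yes _ | no _ = inj₁ (cong (_∧ true) b)
  ... | yes _ | no _ | no _ | _ = inj₁ (cong (_∧ true) b)
  ... | no _ | _ | yes refl | yes refl = inj₂ (inj₂ refl)
  ... | no _ | _ | yes _ | no _ = inj₁ (cong (_∧ true) b)
  ... | no _ | _ | no _ | _ = inj₁ (cong (_∧ true) b)

-- The defect `2C + E - (n + F + I)`, twice the total genus, does not grow under deletion. If a face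
-- is gained, at most one component is gained and the defect stays or falls by 2; if a face is lost,
-- it stays. Hence a nonnegative defect passes from `G′` to `G`, and in `euler-≥-step` a nonpositive
-- one from `G` to `G′`.
euler-≤-step : ∀ n {F I C E F′ I′ C′ E′} → E ≡ suc E′ →
  (F′ + I′ ≡ suc (F + I) × C′ ≤ suc C) ⊎ (suc (F′ + I′) ≡ F + I × C′ ≡ C) →
  n + F′ + I′ ≤ 2 * C′ + E′ → n + F + I ≤ 2 * C + E
euler-≤-step n {F} {I} {C} {F′ = F′} {I′} {C′} {E′} refl (inj₁ (p , q)) le = ℕ.s≤s⁻¹ (begin
  suc (n + F + I)      ≡⟨ solve 3 (λ a b c → con 1 :+ (a :+ b :+ c) := a :+ (con 1 :+ (b :+ c))) refl n F I ⟩
  n + suc (F + I)      ≡⟨ cong (n +_) p ⟨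
  n + (F′ + I′)        ≡⟨ ℕₚ.+-assoc n F′ I′ ⟨
  n + F′ + I′          ≤⟨ le ⟩
  2 * C′ + E′          ≤⟨ ℕₚ.+-monoˡ-≤ E′ (ℕₚ.*-monoʳ-≤ 2 q) ⟩
  2 * suc C + E′       ≡⟨ solve 2 (λ c f → con 2 :* (con 1 :+ c) :+ f := con 1 :+ (con 2 :* c :+ (con 1 :+ f))) refl C E′ ⟩
  suc (2 * C + suc E′) ∎)
  where
  open ℕₚ.≤-Reasoning
  open +-*-Solver
euler-≤-step n {F} {I} {C} {F′ = F′} {I′} {C′} {E′} refl (inj₂ (p , refl)) le = begin
  n + F + I            ≡⟨ ℕₚ.+-assoc n F I ⟩
  n + (F + I)          ≡⟨ cong (n +_) p ⟨
  n + suc (F′ + I′)    ≡⟨ solve 3 (λ a b c → a :+ (con 1 :+ (b :+ c)) := con 1 :+ (a :+ b :+ c)) refl n F′ I′ ⟩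
  suc (n + F′ + I′)    ≤⟨ s≤s le ⟩
  suc (2 * C + E′)     ≡⟨ ℕₚ.+-suc (2 * C) E′ ⟨
  2 * C + suc E′       ∎
  where
  open ℕₚ.≤-Reasoning
  open +-*-Solver

euler-≥-step : ∀ n {F I C E F′ I′ C′ E′} → E ≡ suc E′ →
  (F′ + I′ ≡ suc (F + I) × C′ ≤ suc C) ⊎ (suc (F′ + I′) ≡ F + I × C′ ≡ C) →
  2 * C + E ≤ n + F + I → 2 * C′ + E′ ≤ n + F′ + I′
euler-≥-step n {F} {I} {C} {F′ = F′} {I′} {C′} {E′} refl (inj₁ (p , q)) le = begin
  2 * C′ + E′          ≤⟨ ℕₚ.+-monoˡ-≤ E′ (ℕₚ.*-monoʳ-≤ 2 q) ⟩
  2 * suc C + E′       ≡⟨ solve 2 (λ c f → con 2 :* (con 1 :+ c) :+ f := con 1 :+ (con 2 :* c :+ (con 1 :+ f))) refl C E′ ⟩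
  suc (2 * C + suc E′) ≤⟨ s≤s le ⟩
  suc (n + F + I)      ≡⟨ solve 3 (λ a b c → con 1 :+ (a :+ b :+ c) := a :+ (con 1 :+ (b :+ c))) refl n F I ⟩
  n + suc (F + I)      ≡⟨ cong (n +_) p ⟨
  n + (F′ + I′)        ≡⟨ ℕₚ.+-assoc n F′ I′ ⟨
  n + F′ + I′          ∎
  where
  open ℕₚ.≤-Reasoning
  open +-*-Solver
euler-≥-step n {F} {I} {C} {F′ = F′} {I′} {C′} {E′} refl (inj₂ (p , refl)) le = ℕ.s≤s⁻¹ (begin
  suc (2 * C + E′)     ≡⟨ ℕₚ.+-suc (2 * C) E′ ⟨
  2 * C + suc E′       ≤⟨ le ⟩
  n + F + I            ≡⟨ ℕₚ.+-assoc n F I ⟩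
  n + (F + I)          ≡⟨ cong (n +_) p ⟨
  n + suc (F′ + I′)    ≡⟨ solve 3 (λ a b c → a :+ (con 1 :+ (b :+ c)) := con 1 :+ (a :+ b :+ c)) refl n F′ I′ ⟩
  suc (n + F′ + I′)    ∎)
  where
  open ℕₚ.≤-Reasoning
  open +-*-Solver

module _ {n} {G G′ : Graph n} {u v} (D : Deletion G G′ u v) {rot rot′ : Fin n → Fin n → Fin n}
         (R : IsRotationSystem G rot) (agree : ∀ {x y} → Adj G′ x y → rot′ x y ≡ skipRot G′ rot x y) where
  open Delete D
  open Rot R agree

  euler-change :
    (numFaces G′ rot′ + numIsolated G′ ≡ suc (numFaces G rot + numIsolated G) × numComponents G′ ≤ suc (numComponents G))
    ⊎ (suc (numFaces G′ rot′ + numIsolated G′) ≡ numFaces G rot + numIsolated G × numComponents G′ ≡ numComponents G)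
  euler-change with d~e?
  ... | yes de = inj₁ (faces-same de , components-≤)
  ... | no ¬de = inj₂ (faces-diff ¬de , components-same (apart⇒Conn ¬de))

find-edge : ∀ {n} (G : Graph n) → (∃[ u ] ∃[ v ] Adj G u v) ⊎ (∀ u v → adj G u v ≡ false)
find-edge G with Finₚ.any? (λ u → Finₚ.any? (λ v → adj G u v Data.Bool.≟ true))
... | yes (u , v , a) = inj₁ (u , v , a)
... | no n = inj₂ λ u v → not-true λ a → n (u , v , a)

-- Deleting all edges one by one ends in the empty graph, where both sides are `2n`; on the way the
-- defect never grows.
euler-inequality : ∀ {n} (G : Graph n) {rot} → IsRotationSystem G rot →
  n + numFaces G rot + numIsolated G ≤ 2 * numComponents G + numEdges G
euler-inequality {n} G R = go (numEdges G) G R refl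
  where
  go : ∀ k (G : Graph n) {rot} → IsRotationSystem G rot → numEdges G ≡ k →
       n + numFaces G rot + numIsolated G ≤ 2 * numComponents G + numEdges G
  go k G {rot} R e with find-edge G
  go zero G {rot} R e | inj₁ (u , v , a) = ⊥-elim (ℕₚ.0≢1+n (≡.trans (≡.sym e) (Delete.edges (delEdge-Deletion G a))))
  go (suc k) G {rot} R e | inj₁ (u , v , a) =
    euler-≤-step n (Delete.edges D) (euler-change D R (λ _ → refl))
      (go k (delEdge G u v) (Delete.Rot.isRot D R (λ _ → refl)) (ℕₚ.suc-injective (≡.trans (≡.sym (Delete.edges D)) e)))
    where
    D = delEdge-Deletion G a
  go k G {rot} R e | inj₂ empty = begin
    n + numFaces G rot + numIsolated G ≡⟨ cong (λ t → n + t + numIsolated G) noFaces ⟩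
    n + 0 + numIsolated G              ≤⟨ ℕₚ.+-mono-≤ (ℕₚ.≤-reflexive (ℕₚ.+-identityʳ n)) (ℕₚ.≤-reflexive all-isolated) ⟩
    n + n                              ≡⟨ cong₂ _+_ n≡ (≡.trans n≡ (≡.sym (ℕₚ.+-identityʳ _))) ⟩
    2 * numComponents G                ≤⟨ ℕₚ.m≤m+n _ _ ⟩
    2 * numComponents G + numEdges G   ∎
    where
    open ℕₚ.≤-Reasoning
    noFaces : numFaces G rot ≡ 0
    noFaces = Trans-unique (PairOrbits.~-com (faceNext-inj G rot R)) (Trans-numFaces G rot R) (record
      { reps = [] ; size = refl ; valid = [] ; apart = [] ; cover = λ d a → ⊥-elim (Adj-absurd G a (empty _ _)) })
    every : {P : Fin n → Set} {S : Fin n → Fin n → Set} → (∀ x → P x) → (∀ {x y} → S x y → x ≡ y) → (∀ {x} → S x x) → Trans P S n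
    every p s r = record { reps = allFin n ; size = length-tabulate {n = n} _ ; valid = All.universal p _
      ; apart = AllPairs-map-valid {P = Everything} (λ _ _ ne q → ne (s q)) (All.universal (λ _ → tt) _) (allFin⁺ n)
      ; cover = λ x _ → Any.map (λ { refl → r }) (∈-allFin x) }
    all-isolated : numIsolated G ≡ n
    all-isolated = Trans-unique ≡-com (Trans-numIsolated G) (every empty (λ q → q) refl)
    trivial : ∀ {x y} → Conn G x y → x ≡ y
    trivial ε = refl
    trivial (a ◅ _) = ⊥-elim (Adj-absurd G a (empty _ _))
    n≡ : n ≡ numComponents G
    n≡ = Trans-unique (Conn-com G) (every (λ _ → tt) trivial ε) (Trans-numComponents G)

-- The defect of `G′` is at most that of `G`, which is zero, and Euler's inequality keeps it from
-- being negative.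
Planar-Deletion : ∀ {n} {G G′ : Graph n} {u v} → Deletion G G′ u v → Planar G → Planar G′
Planar-Deletion {n} {G} {G′} D (rot , R , e) = skipRot G′ rot , R′ ,
  ℕₚ.≤-antisym (euler-inequality G′ R′)
    (euler-≥-step n (Delete.edges D) (euler-change D R (λ _ → refl)) (ℕₚ.≤-reflexive (≡.sym e)))
  where
  R′ = Delete.Rot.isRot D R (λ _ → refl)

-- Isolated vertices and deletion of a vertex

-- The classes on `Y` are the images of those on `X` together with new ones represented by `J`.
-- Edges and faces use an empty `J`; vertices, isolated vertices and components use the added
-- isolated vertices.
Trans-map : {X Y : Set} {P : X → Set} {R : X → X → Set} {P′ : Y → Set} {R′ : Y → Y → Set}
  (f : X → Y) (J : List Y) →
  (∀ x → P x → P′ (f x)) → (∀ x y → R′ (f x) (f y) → R x y) → (∀ x y → R x y → R′ (f x) (f y)) →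
  All P′ J → AllPairs (λ x y → ¬ R′ x y) J → (∀ x → All (λ j → ¬ R′ (f x) j) J) →
  (∀ y → P′ y → (∃[ x ] (y ≡ f x × P x)) ⊎ Any (R′ y) J) →
  ∀ {k} → Trans P R k → Trans P′ R′ (k + length J)
Trans-map f J up refl⁻ pres vJ aJ sep cov t = record
  { reps = map f (reps t) ++ J
  ; size = ≡.trans (length-++ (map f (reps t))) (cong (_+ length J) (≡.trans (length-map f (reps t)) (size t)))
  ; valid = Allₚ.++⁺ (Allₚ.map⁺ (All.map (up _) (valid t))) vJ
  ; apart = AllPairsₚ.++⁺ (AllPairsₚ.map⁺ (AllPairs-map-valid {P = Everything} (λ _ _ n r → n (refl⁻ _ _ r)) (All.universal (λ _ → tt) _) (apart t)))
      aJ (Allₚ.map⁺ (All.universal sep _))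
  ; cover = λ y p → go (cov y p) }
  where
  go : ∀ {y} → (∃[ x ] (y ≡ f x × _)) ⊎ Any _ J → Any _ (map f (reps t) ++ J)
  go (inj₁ (x , refl , p)) = Anyₚ.++⁺ˡ (Anyₚ.map⁺ (Any.map (pres _ _) (cover t x p)))
  go (inj₂ a) = Anyₚ.++⁺ʳ (map f (reps t)) a

Trans-Fin : ∀ n → Trans {Fin n} Everything _≡_ n
Trans-Fin n = record { reps = allFin n ; size = length-tabulate {n = n} _ ; valid = All.universal (λ _ → tt) _
  ; apart = allFin⁺ n ; cover = λ x _ → ∈-allFin x }

-- `H` is a copy of `G` with isolated vertices `J` added. An empty `J` also covers graphs whose
-- adjacencies agree only pointwise.
record Embedding {m n} (G : Graph m) (H : Graph n) (f : Fin m → Fin n) (J : List (Fin n)) : Set where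
  field
    f-inj  : ∀ {x y} → f x ≡ f y → x ≡ y
    f-adj  : ∀ x y → adj H (f x) (f y) ≡ adj G x y
    J-iso  : All (Isolated H) J
    J-uniq : Unique J
    J-out  : ∀ x → All (f x ≢_) J
    J-cov  : ∀ y → (∃[ x ] (y ≡ f x)) ⊎ y ∈ J

module Embed {m n} {G : Graph m} {H : Graph n} {f : Fin m → Fin n} {J : List (Fin n)} (𝓔 : Embedding G H f J) where
  open Embedding 𝓔

  image : ∀ {x y} → Adj H x y → ∃[ a ] ∃[ b ] (x ≡ f a × y ≡ f b × Adj G a b)
  image {x} {y} a with J-cov x | J-cov y
  ... | inj₂ j | _ = ⊥-elim (Adj-absurd H a (All.lookup J-iso j y))
  ... | inj₁ _ | inj₂ j = ⊥-elim (Adj-absurd H (Adj-sym H a) (All.lookup J-iso j x))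
  ... | inj₁ (a′ , refl) | inj₁ (b′ , refl) = a′ , b′ , refl , refl , ≡.trans (≡.sym (f-adj a′ b′)) a

  up : ∀ {x y} → Adj G x y → Adj H (f x) (f y)
  up a = ≡.trans (f-adj _ _) a

  f² : Fin m × Fin m → Fin n × Fin n
  f² (x , y) = f x , f y

  f²-inj : ∀ {d e} → f² d ≡ f² e → d ≡ e
  f²-inj p = cong₂ _,_ (f-inj (cong proj₁ p)) (f-inj (cong proj₂ p))

  edges : numEdges H ≡ numEdges G
  edges = ≡.trans (Trans-unique SameEdge-com (Trans-numEdges H)
    (Trans-map f² [] (λ _ → up) (λ { _ _ (inj₁ p) → inj₁ (f²-inj p) ; _ _ (inj₂ p) → inj₂ (f²-inj p) })
      (λ { _ _ (inj₁ refl) → inj₁ refl ; _ _ (inj₂ refl) → inj₂ refl }) [] [] (λ _ → [])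
      (λ y a → let (p , q , r , s , b) = image a in inj₁ ((p , q) , cong₂ _,_ r s , b)) (Trans-numEdges G)))
    (ℕₚ.+-identityʳ _)

  vertices : n ≡ m + length J
  vertices = Trans-unique ≡-com (Trans-Fin n)
    (Trans-map f J (λ _ _ → tt) (λ _ _ → f-inj) (λ _ _ → cong f) (All.universal (λ _ → tt) J) J-uniq J-out
      (λ y _ → [ (λ (x , p) → inj₁ (x , p , tt)) , inj₂ ]′ (J-cov y)) (Trans-Fin m))

  isolated : numIsolated H ≡ numIsolated G + length J
  isolated = Trans-unique ≡-com (Trans-numIsolated H)
    (Trans-map f J iso (λ _ _ → f-inj) (λ _ _ → cong f) J-iso J-uniq J-out
      (λ y i → [ (λ { (x , refl) → inj₁ (x , refl , λ w → ≡.trans (≡.sym (f-adj x w)) (i (f w))) }) , inj₂ ]′ (J-cov y))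
      (Trans-numIsolated G))
    where
    iso : ∀ x → Isolated G x → Isolated H (f x)
    iso x i w with J-cov w
    ... | inj₁ (w′ , refl) = ≡.trans (f-adj x w′) (i w′)
    ... | inj₂ j = ≡.trans (sym H (f x) w) (All.lookup J-iso j (f x))

  components : numComponents H ≡ numComponents G + length J
  components = Trans-unique (Conn-com H) (Trans-numComponents H)
    (Trans-map f J (λ _ _ → tt) (λ x y c → let (y′ , p , c′) = down c refl in subst (Conn G x) (≡.sym (f-inj p)) c′)
      (λ _ _ → Star.gmap f up) (All.universal (λ _ → tt) J)
      (AllPairs-map-valid {P = Isolated H} (λ i _ n c → n (stuck i c)) J-iso J-uniq)
      (λ x → All.tabulate (λ m c → let (y , p , _) = down c refl in All.lookup (J-out y) m (≡.sym p)))
      (λ y _ → [ (λ (x , p) → inj₁ (x , p , tt)) , (λ j → inj₂ (Any.map (λ { refl → ε }) j)) ]′ (J-cov y))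
      (Trans-numComponents G))
    where
    down : ∀ {x y x′} → Conn H x′ y → x′ ≡ f x → ∃[ y′ ] (y ≡ f y′ × Conn G x y′)
    down {x} ε p = x , p , ε
    down (a ◅ c) refl with image a
    ... | a′ , b′ , p , refl , e with f-inj p
    ...   | refl with down c refl
    ...     | y′ , q , c′ = y′ , q , e ◅ c′
    stuck : ∀ {x y} → Isolated H x → Conn H x y → x ≡ y
    stuck i ε = refl
    stuck i (a ◅ _) = ⊥-elim (Adj-absurd H a (i _))

  module Rotations {rotG : Fin m → Fin m → Fin m} {rotH : Fin n → Fin n → Fin n}
    (agree : ∀ {x y} → Adj G x y → f (rotG x y) ≡ rotH (f x) (f y)) where

    iter-agree : (∀ u v → Adj G u v → Adj G u (rotG u v)) →
      ∀ k {x y} → Adj G x y → f (iter k (rotG x) y) ≡ iter k (rotH (f x)) (f y) × Adj G x (iter k (rotG x) y)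
    iter-agree cl zero a = refl , a
    iter-agree cl (suc k) a with iter-agree cl k a
    ... | p , b = ≡.trans (agree b) (cong (rotH (f _)) p) , cl _ _ b

    push : IsRotationSystem G rotG → IsRotationSystem H rotH
    push R = closed , inject , cyclic
      where
      closed : ∀ u v → Adj H u v → Adj H u (rotH u v)
      closed u v a with image a
      ... | x , y , refl , refl , b = subst (Adj H (f x)) (agree b) (up (rot-Adj G rotG R b))
      inject : ∀ u v w → Adj H u v → Adj H u w → rotH u v ≡ rotH u w → v ≡ w
      inject u v w a b p with image a | image b
      ... | x , y , refl , refl , a′ | x′ , z , q , refl , b′ with f-inj q
      ...   | refl = cong f (rot-inj G rotG R a′ b′ (f-inj (≡.trans (agree a′) (≡.trans p (≡.sym (agree b′))))))
      cyclic : ∀ u v w → Adj H u v → Adj H u w → ∃[ k ] iter k (rotH u) v ≡ w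
      cyclic u v w a b with image a | image b
      ... | x , y , refl , refl , a′ | x′ , z , q , refl , b′ with f-inj q
      ...   | refl with rot-cycle G rotG R a′ b′
      ...     | k , r = k , ≡.trans (≡.sym (proj₁ (iter-agree (λ _ _ → rot-Adj G rotG R) k a′))) (cong f r)

    pull : IsRotationSystem H rotH → IsRotationSystem G rotG
    pull R = (λ _ _ → closed) ,
      (λ u v w a b p → f-inj (rot-inj H rotH R (up a) (up b) (≡.trans (≡.sym (agree a)) (≡.trans (cong f p) (agree b))))) ,
      λ u v w a b → let (k , p) = rot-cycle H rotH R (up a) (up b) in
        k , f-inj (≡.trans (proj₁ (iter-agree (λ _ _ → closed) k a)) p)
      where
      closed : ∀ {u v} → Adj G u v → Adj G u (rotG u v)
      closed a = ≡.trans (≡.sym (f-adj _ _)) (subst (Adj H _) (≡.sym (agree a)) (rot-Adj H rotH R (up a)))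

    faces : IsRotationSystem G rotG → numFaces H rotH ≡ numFaces G rotG
    faces R = ≡.trans (Trans-unique (PairOrbits.~-com (faceNext-inj H rotH (push R))) (Trans-numFaces H rotH (push R))
      (Trans-map f² [] (λ _ → up)
        (λ d e (k , p) → k , f²-inj (≡.trans (comm* k d) p))
        (λ d e (k , p) → k , ≡.trans (≡.sym (comm* k d)) (cong f² p)) [] [] (λ _ → [])
        (λ y a → let (p , q , r , s , b) = image a in inj₁ ((p , q) , cong₂ _,_ r s , b)) (Trans-numFaces G rotG R)))
      (ℕₚ.+-identityʳ _)
      where
      comm : ∀ d → f² (faceNext G rotG d) ≡ faceNext H rotH (f² d)
      comm (x , y) with dec-adj G x y
      ... | inj₁ a = ≡.trans (cong f² (faceNext-dart G rotG a))
                       (≡.trans (cong (f y ,_) (agree (Adj-sym G a))) (≡.sym (faceNext-dart H rotH (up a))))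
      ... | inj₂ b = ≡.trans (cong f² (faceNext-nondart G rotG b)) (≡.sym (faceNext-nondart H rotH (≡.trans (f-adj x y) b)))
      comm* : ∀ k d → f² (iter k (faceNext G rotG) d) ≡ iter k (faceNext H rotH) (f² d)
      comm* zero d = refl
      comm* (suc k) d = ≡.trans (comm _) (cong (faceNext H rotH) (comm* k d))

    -- A vertex of `J` adds 2 on either side: on the left as a vertex and as an isolated vertex, on
    -- the right as a component, which is counted twice.
    genus-push : IsRotationSystem G rotG →
      m + numFaces G rotG + numIsolated G ≡ 2 * numComponents G + numEdges G →
      n + numFaces H rotH + numIsolated H ≡ 2 * numComponents H + numEdges H
    genus-push R e = begin
      n + numFaces H rotH + numIsolated H         ≡⟨ cong₂ _+_ (cong₂ _+_ vertices (faces R)) isolated ⟩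
      m + j + F + (I + j)                         ≡⟨ solve 4 (λ m j f i → m :+ j :+ f :+ (i :+ j) := (m :+ f :+ i) :+ con 2 :* j) refl m j F I ⟩
      m + F + I + 2 * j                           ≡⟨ cong (_+ 2 * j) e ⟩
      2 * C + E + 2 * j                           ≡⟨ solve 3 (λ c e j → con 2 :* c :+ e :+ con 2 :* j := con 2 :* (c :+ j) :+ e) refl C E j ⟩
      2 * (C + j) + E                             ≡⟨ cong₂ (λ a b → 2 * a + b) components edges ⟨
      2 * numComponents H + numEdges H            ∎
      where
      open ≡.≡-Reasoning
      open +-*-Solver
      j = length J
      F = numFaces G rotG
      I = numIsolated G
      C = numComponents G
      E = numEdges G

    genus-pull : IsRotationSystem G rotG →
      n + numFaces H rotH + numIsolated H ≡ 2 * numComponents H + numEdges H →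
      m + numFaces G rotG + numIsolated G ≡ 2 * numComponents G + numEdges G
    genus-pull R e = ℕₚ.+-cancelʳ-≡ (2 * j) _ _ (begin
      m + F + I + 2 * j                           ≡⟨ solve 4 (λ m j f i → m :+ j :+ f :+ (i :+ j) := (m :+ f :+ i) :+ con 2 :* j) refl m j F I ⟨
      m + j + F + (I + j)                         ≡⟨ cong₂ _+_ (cong₂ _+_ vertices (faces R)) isolated ⟨
      n + numFaces H rotH + numIsolated H         ≡⟨ e ⟩
      2 * numComponents H + numEdges H            ≡⟨ cong₂ (λ a b → 2 * a + b) components edges ⟩
      2 * (C + j) + E                             ≡⟨ solve 3 (λ c e j → con 2 :* c :+ e :+ con 2 :* j := con 2 :* (c :+ j) :+ e) refl C E j ⟨
      2 * C + E + 2 * j ∎)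
      where
      open ≡.≡-Reasoning
      open +-*-Solver
      j = length J
      F = numFaces G rotG
      I = numIsolated G
      C = numComponents G
      E = numEdges G

  Planar-push : Planar G → Planar H
  Planar-push (rot , R , e) = rotH , push R , genus-push R e
    where
    rotH : Fin n → Fin n → Fin n
    rotH x y with J-cov x | J-cov y
    ... | inj₁ (a , _) | inj₁ (b , _) = f (rot a b)
    -- These values are arbitrary, since no dart of `H` meets `J`.
    ... | inj₁ _ | inj₂ _ = x
    ... | inj₂ _ | _ = x
    agr : ∀ {x y} → Adj G x y → f (rot x y) ≡ rotH (f x) (f y)
    agr {x} {y} _ with J-cov (f x) | J-cov (f y)
    ... | inj₁ (a , p) | inj₁ (b , q) = cong₂ (λ s t → f (rot s t)) (f-inj p) (f-inj q)
    ... | inj₁ _ | inj₂ j = ⊥-elim (All.lookup (J-out y) j refl)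
    ... | inj₂ j | _ = ⊥-elim (All.lookup (J-out x) j refl)
    open Rotations {rot} {rotH} agr

  Planar-pull : Planar H → Planar G
  Planar-pull (rot , R , e) = rotG , pull R , genus-pull (pull R) e
    where
    rotG : Fin m → Fin m → Fin m
    rotG x y with J-cov (rot (f x) (f y))
    ... | inj₁ (a , _) = a
    ... | inj₂ _ = x
    agr : ∀ {x y} → Adj G x y → f (rotG x y) ≡ rot (f x) (f y)
    agr {x} {y} a with J-cov (rot (f x) (f y))
    ... | inj₁ (b , p) = ≡.sym p
    ... | inj₂ j = ⊥-elim (Adj-absurd H (Adj-sym H (rot-Adj H rot R (up a))) (All.lookup J-iso j (f x)))
    open Rotations {rotG} {rot} agr

_≈ᴳ_ : ∀ {n} → Graph n → Graph n → Set
G ≈ᴳ H = ∀ x y → adj H x y ≡ adj G x y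

≈ᴳ-Embedding : ∀ {n} {G H : Graph n} → G ≈ᴳ H → Embedding G H (λ x → x) []
≈ᴳ-Embedding e = record { f-inj = λ p → p ; f-adj = e ; J-iso = [] ; J-uniq = [] ; J-out = λ _ → [] ; J-cov = λ y → inj₁ (y , refl) }

induced : ∀ {m n} → Graph n → (f : Fin m → Fin n) → Graph m
induced G f = record { adj = λ x y → adj G (f x) (f y) ; sym = λ x y → sym G (f x) (f y) ; irrefl = λ x → irrefl G (f x) }

infixl 8 _∖_
_∖_ : ∀ {n} → Graph (suc n) → Fin (suc n) → Graph n
G ∖ v = induced G (punchIn v)

punchIn-cov : ∀ {n} (v y : Fin (suc n)) → (∃[ x ] (y ≡ punchIn v x)) ⊎ y ≡ v
punchIn-cov v y with v Finₚ.≟ y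
... | yes p = inj₂ (≡.sym p)
... | no n = inj₁ (punchOut n , ≡.sym (Finₚ.punchIn-punchOut n))

-- Strip all edges at v one after the other, then drop v.
Planar-∖ : ∀ {n} {G : Graph (suc n)} → Planar G → ∀ v → Planar (G ∖ v)
Planar-∖ {n} {G} P v = Embed.Planar-pull 𝓔 (planar stripped)
  where
  record Stripped (ws : List (Fin (suc n))) : Set where
    field
      H      : Graph (suc n)
      planar : Planar H
      same   : ∀ {x y} → x ≢ v → y ≢ v → adj H x y ≡ adj G x y
      gone   : ∀ {w} → w ∈ ws → adj H v w ≡ false
  open Stripped
  strip : ∀ ws → Stripped ws
  strip [] = record { H = G ; planar = P ; same = λ _ _ → refl ; gone = λ () }
  strip (w ∷ ws) with strip ws
  ... | S with dec-adj (H S) v w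
  ...   | inj₂ b = record { H = H S ; planar = planar S ; same = same S ; gone = λ { (here refl) → b ; (there m) → gone S m } }
  ...   | inj₁ a = record
    { H = delEdge (H S) v w ; planar = Planar-Deletion D (planar S)
    ; same = λ {x} {y} n m → ≡.trans (Deletion-same D x y (n ∘ cong proj₁) (m ∘ cong proj₂)) (same S n m)
    ; gone = λ { (here refl) → Deletion.absent D ; (there m) → not-true λ b → Adj-absurd (H S) (Deletion.weaken D b) (gone S m) } }
    where
    D = delEdge-Deletion (H S) a
  stripped = strip (allFin (suc n))
  𝓔 : Embedding (G ∖ v) (H stripped) (punchIn v) (v ∷ [])
  𝓔 = record
    { f-inj = Finₚ.punchIn-injective v _ _
    ; f-adj = λ x y → same stripped (Finₚ.punchInᵢ≢i v x) (Finₚ.punchInᵢ≢i v y)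
    ; J-iso = (λ w → gone stripped (∈-allFin w)) ∷ []
    ; J-uniq = [] ∷ []
    ; J-out = λ x → Finₚ.punchInᵢ≢i v x ∷ []
    ; J-cov = λ y → [ inj₁ , (λ p → inj₂ (here p)) ]′ (punchIn-cov v y) }

-- Insertion of a vertex of degree two

skipRot-stay : ∀ {n} (G′ : Graph n) rot {x y} → Adj G′ x (rot x y) → skipRot G′ rot x y ≡ rot x y
skipRot-stay G′ rot a rewrite a = refl

skipRot-skip : ∀ {n} (G′ : Graph n) rot {x y} → adj G′ x (rot x y) ≡ false → skipRot G′ rot x y ≡ rot x (rot x y)
skipRot-skip G′ rot a rewrite a = refl

-- A plane graph with a marked angle u, v, w of one of its faces.
record Angle (n : ℕ) : Set where
  field
    G     : Graph n
    rot   : Fin n → Fin n → Fin n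
    isRot : IsRotationSystem G rot
    genus : n + numFaces G rot + numIsolated G ≡ 2 * numComponents G + numEdges G
    u v w : Fin n
    uv    : Adj G u v
    vw    : Adj G v w
    turn  : rot v u ≡ w
    u≢w   : u ≢ w

  planar : Planar G
  planar = rot , isRot , genus

-- The new vertex zero is put into the face of the angle and joined to u and w.
module Attach {n} (A : Angle n) where
  open Angle A

  isEnd : Fin n → Bool
  isEnd z = does (z Finₚ.≟ u) ∨ does (z Finₚ.≟ w)

  end-u : isEnd u ≡ true
  end-u rewrite dec-true (u Finₚ.≟ u) refl = refl

  end-w : isEnd w ≡ true
  end-w = ∨-introʳ (does (w Finₚ.≟ u)) (dec-true (w Finₚ.≟ w) refl)

  end-cases : ∀ z → isEnd z ≡ true → z ≡ u ⊎ z ≡ w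
  end-cases z e with z Finₚ.≟ u | z Finₚ.≟ w
  ... | yes p | _ = inj₁ p
  ... | no _ | yes q = inj₂ q

  adjH : Fin (suc n) → Fin (suc n) → Bool
  adjH zero    zero    = false
  adjH zero    (suc j) = isEnd j
  adjH (suc i) zero    = isEnd i
  adjH (suc i) (suc j) = adj G i j

  H : Graph (suc n)
  H = record
    { adj = adjH
    ; sym = λ { zero zero → refl ; zero (suc j) → refl ; (suc i) zero → refl ; (suc i) (suc j) → sym G i j }
    ; irrefl = λ { zero → refl ; (suc i) → irrefl G i } }

  -- Around an end `z` the new vertex is inserted directly before `target z`. The face runs from `u`
  -- over `v` to `w` and leaves `w` towards `rot w v`, so its corners are the one before `v` at `u`
  -- and the one between `v` and `rot w v` at `w`.
  target : Fin n → Fin n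
  target z = if does (z Finₚ.≟ u) then v else rot w v

  target-u : target u ≡ v
  target-u rewrite dec-true (u Finₚ.≟ u) refl = refl

  target-w : target w ≡ rot w v
  target-w rewrite dec-false (w Finₚ.≟ u) (u≢w ∘ ≡.sym) = refl

  target-Adj : ∀ z → isEnd z ≡ true → Adj G z (target z)
  target-Adj z e with end-cases z e
  ... | inj₁ refl = subst (Adj G u) (≡.sym target-u) uv
  ... | inj₂ refl = subst (Adj G w) (≡.sym target-w) (rot-Adj G rot isRot (Adj-sym G vw))

  rotH : Fin (suc n) → Fin (suc n) → Fin (suc n)
  rotH zero    zero    = zero
  rotH zero    (suc j) = if does (j Finₚ.≟ u) then suc w else suc u
  rotH (suc z) zero    = suc (target z)
  rotH (suc z) (suc y) = if isEnd z ∧ does (rot z y Finₚ.≟ target z) then zero else suc (rot z y)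

  rotH-u : rotH zero (suc u) ≡ suc w
  rotH-u rewrite dec-true (u Finₚ.≟ u) refl = refl

  rotH-w : rotH zero (suc w) ≡ suc u
  rotH-w rewrite dec-false (w Finₚ.≟ u) (u≢w ∘ ≡.sym) = refl

  data Step (z y : Fin n) : Set where
    hit  : isEnd z ≡ true → rot z y ≡ target z → rotH (suc z) (suc y) ≡ zero → Step z y
    miss : ¬ (isEnd z ≡ true × rot z y ≡ target z) → rotH (suc z) (suc y) ≡ suc (rot z y) → Step z y

  step : ∀ z y → Step z y
  step z y with isEnd z in p | rot z y Finₚ.≟ target z in q
  ... | true  | yes e = hit p e (cong₂ (λ a b → if a ∧ does b then zero else suc (rot z y)) p q)
  ... | true  | no ne = miss (ne ∘ proj₂) (cong₂ (λ a b → if a ∧ does b then zero else suc (rot z y)) p q)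
  ... | false | _ = miss (λ (t , _) → true≢false (≡.trans (≡.sym t) p)) (cong (λ a → if a ∧ does (rot z y Finₚ.≟ target z) then zero else suc (rot z y)) p)

  isRotH : IsRotationSystem H rotH
  isRotH = closed , inject , cyclic
    where
    closed : ∀ x y → Adj H x y → Adj H x (rotH x y)
    closed zero (suc j) a with end-cases j a
    ... | inj₁ refl = subst (Adj H zero) (≡.sym rotH-u) end-w
    ... | inj₂ refl = subst (Adj H zero) (≡.sym rotH-w) end-u
    closed (suc z) zero a = target-Adj z a
    closed (suc z) (suc y) a with step z y
    ... | hit e _ p = subst (Adj H (suc z)) (≡.sym p) e
    ... | miss _ p = subst (Adj H (suc z)) (≡.sym p) (rot-Adj G rot isRot a)
    sucEq : ∀ {i j : Fin n} → Fin.suc i ≡ suc j → i ≡ j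
    sucEq refl = refl
    inject : ∀ x y z → Adj H x y → Adj H x z → rotH x y ≡ rotH x z → y ≡ z
    inject zero (suc j) (suc k) a b p with end-cases j a | end-cases k b
    ... | inj₁ refl | inj₁ refl = refl
    ... | inj₁ refl | inj₂ refl = ⊥-elim (u≢w (≡.sym (sucEq (≡.trans (≡.sym rotH-u) (≡.trans p rotH-w)))))
    ... | inj₂ refl | inj₁ refl = ⊥-elim (u≢w (sucEq (≡.trans (≡.sym rotH-w) (≡.trans p rotH-u))))
    ... | inj₂ refl | inj₂ refl = refl
    inject (suc z) zero zero a b p = refl
    inject (suc z) zero (suc y) a b p with step z y
    ... | hit _ _ q with ≡.trans p q
    ...   | ()
    inject (suc z) zero (suc y) a b p | miss n q = ⊥-elim (n (a , ≡.sym (sucEq (≡.trans p q))))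
    inject (suc z) (suc y) zero a b p with step z y
    ... | hit _ _ q with ≡.trans (≡.sym q) p
    ...   | ()
    inject (suc z) (suc y) zero a b p | miss n q = ⊥-elim (n (b , sucEq (≡.trans (≡.sym q) p)))
    inject (suc z) (suc y) (suc y′) a b p with step z y | step z y′
    ... | hit _ e _ | hit _ e′ _ = cong suc (rot-inj G rot isRot a b (≡.trans e (≡.sym e′)))
    ... | hit _ _ q | miss _ q′ with ≡.trans (≡.sym q) (≡.trans p q′)
    ...   | ()
    inject (suc z) (suc y) (suc y′) a b p | miss _ q | hit _ _ q′ with ≡.trans (≡.sym q) (≡.trans p q′)
    ...   | ()
    inject (suc z) (suc y) (suc y′) a b p | miss _ q | miss _ q′ =
      cong suc (rot-inj G rot isRot a b (sucEq (≡.trans (≡.sym q) (≡.trans p q′))))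
    prepend : ∀ x y {y′ t} → rotH x y ≡ y′ → ∃[ k ] iter k (rotH x) y′ ≡ t → ∃[ k ] iter k (rotH x) y ≡ t
    prepend x y refl (k , p) = suc k , ≡.trans (≡.sym (iter-comm (rotH x) k y)) p
    follow : ∀ k z y → ∃[ l ] iter l (rotH (suc z)) (suc y) ≡ suc (iter k (rot z) y)
    follow zero z y = 0 , refl
    follow (suc k) z y with step z y | follow k z (rot z y)
    -- A hit replaces one step of `rot z` by two: first to `zero`, then on to `target z`.
    ... | hit _ e q | r = subst (λ t → ∃[ l ] iter l (rotH (suc z)) (suc y) ≡ suc t) (iter-comm (rot z) k y)
                            (prepend (suc z) (suc y) q (prepend (suc z) zero (cong suc (≡.sym e)) r))
    ... | miss _ q | r = subst (λ t → ∃[ l ] iter l (rotH (suc z)) (suc y) ≡ suc t) (iter-comm (rot z) k y) (prepend (suc z) (suc y) q r)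
    to-zero : ∀ k z y → isEnd z ≡ true → iter k (rot z) (rot z y) ≡ target z → ∃[ l ] iter l (rotH (suc z)) (suc y) ≡ zero
    to-zero k z y a p with step z y
    ... | hit _ _ q = 1 , q
    to-zero zero z y a p | miss n q = ⊥-elim (n (a , p))
    to-zero (suc k) z y a p | miss n q = prepend (suc z) (suc y) q (to-zero k z (rot z y) a (≡.trans (iter-comm (rot z) k _) p))
    cyclic : ∀ x y t → Adj H x y → Adj H x t → ∃[ k ] iter k (rotH x) y ≡ t
    cyclic zero (suc j) (suc k) a b with end-cases j a | end-cases k b
    ... | inj₁ refl | inj₁ refl = 0 , refl
    ... | inj₁ refl | inj₂ refl = 1 , rotH-u
    ... | inj₂ refl | inj₁ refl = 1 , rotH-w
    ... | inj₂ refl | inj₂ refl = 0 , refl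
    cyclic (suc z) zero zero a b = 0 , refl
    cyclic (suc z) zero (suc t) a b with rot-cycle G rot isRot (target-Adj z a) b
    ... | k , refl = prepend (suc z) zero refl (follow k z (target z))
    cyclic (suc z) (suc y) zero a b with rot-cycle G rot isRot (rot-Adj G rot isRot a) (target-Adj z b)
    ... | k , p = to-zero k z y b p
    cyclic (suc z) (suc y) (suc t) a b with rot-cycle G rot isRot a b
    ... | k , refl = follow k z y

  -- The genus of `H` is found backwards: deleting the two new edges leaves `G` with an isolated
  -- vertex, and both deletions have a known effect on faces and components.
  H₁ H₂ : Graph (suc n)
  H₁ = delEdge H zero (suc w)
  H₂ = delEdge H₁ zero (suc u)

  D₁ : Deletion H H₁ zero (suc w)
  D₁ = delEdge-Deletion H end-w

  xu₁ : Adj H₁ zero (suc u)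
  xu₁ = ≡.trans (Deletion-same D₁ zero (suc u) (λ p → u≢w (Finₚ.suc-injective (cong proj₂ p))) (λ ())) end-u

  D₂ : Deletion H₁ H₂ zero (suc u)
  D₂ = delEdge-Deletion H₁ xu₁

  keep₁ : ∀ x y → adj H₁ (suc x) (suc y) ≡ adj G x y
  keep₁ x y = Deletion-same D₁ (suc x) (suc y) (λ ()) (λ ())

  keep₂ : ∀ x y → adj H₂ (suc x) (suc y) ≡ adj G x y
  keep₂ x y = ≡.trans (Deletion-same D₂ (suc x) (suc y) (λ ()) (λ ())) (keep₁ x y)

  rot₁ rot₂ : Fin (suc n) → Fin (suc n) → Fin (suc n)
  rot₁ = skipRot H₁ rotH
  rot₂ = skipRot H₂ rot₁

  private
    module Del₁ = Delete D₁
    module Del₂ = Delete D₂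
    module Rot₁ = Del₁.Rot {rotH} {rot₁} isRotH (λ {x} {y} _ → refl {x = rot₁ x y})
    module Rot₂ = Del₂.Rot {rot₁} {rot₂} Rot₁.isRot (λ {x} {y} _ → refl {x = rot₂ x y})

    zero-isolated : Isolated H₂ zero
    zero-isolated zero = irrefl H₂ zero
    zero-isolated (suc j) = not-true λ a → bad a (end-cases j (Deletion.weaken D₁ {zero} {suc j} (Deletion.weaken D₂ {zero} {suc j} a)))
      where
      bad : Adj H₂ zero (suc j) → j ≡ u ⊎ j ≡ w → ⊥
      bad a (inj₁ refl) = Adj-absurd H₂ {zero} {suc u} a (Deletion.absent D₂)
      bad a (inj₂ refl) = Adj-absurd H₁ {zero} {suc w} (Deletion.weaken D₂ {zero} {suc w} a) (Deletion.absent D₁)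

    𝓔 : Embedding G H₂ suc (zero ∷ [])
    𝓔 = record { f-inj = Finₚ.suc-injective ; f-adj = keep₂ ; J-iso = zero-isolated ∷ [] ; J-uniq = [] ∷ []
      ; J-out = λ _ → (λ ()) ∷ [] ; J-cov = λ { zero → inj₂ (here refl) ; (suc x) → inj₁ (x , refl) } }

    -- Skipping takes `zero` out of the rotation again, around `w` at the first deletion and around
    -- `u` at the second.
    agree : ∀ {x y} → Adj G x y → suc (rot x y) ≡ rot₂ (suc x) (suc y)
    agree {x} {y} a with step x y
    ... | miss _ p = ≡.sym (≡.trans (skipRot-stay H₂ rot₁ {suc x} {suc y} (subst (Adj H₂ (suc x)) (≡.sym r₁) (≡.trans (keep₂ x _) b))) r₁)
      where
      b = rot-Adj G rot isRot a
      r₁ : rot₁ (suc x) (suc y) ≡ suc (rot x y)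
      r₁ = ≡.trans (skipRot-stay H₁ rotH {suc x} {suc y} (subst (Adj H₁ (suc x)) (≡.sym p) (≡.trans (keep₁ x _) b))) p
    ... | hit e q p with end-cases x e
    ...   | inj₂ refl = ≡.sym (≡.trans (skipRot-stay H₂ rot₁ {suc x} {suc y} (subst (Adj H₂ (suc x)) (≡.sym r₁) (≡.trans (keep₂ x _) (target-Adj x e)))) (≡.trans r₁ (cong suc (≡.sym q))))
      where
      r₁ : rot₁ (suc w) (suc y) ≡ suc (target w)
      r₁ = ≡.trans (skipRot-skip H₁ rotH {suc w} {suc y} (subst (λ t → adj H₁ (suc w) t ≡ false) (≡.sym p) Del₁.absent′))
             (cong (rotH (suc w)) p)
    ...   | inj₁ refl = ≡.sym (≡.trans (skipRot-skip H₂ rot₁ {suc x} {suc y} (subst (λ t → adj H₂ (suc u) t ≡ false) (≡.sym r₁) Del₂.absent′))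
              (≡.trans (cong (rot₁ (suc u)) r₁) (≡.trans r₀ (cong suc (≡.sym q)))))
      where
      r₁ : rot₁ (suc u) (suc y) ≡ zero
      r₁ = ≡.trans (skipRot-stay H₁ rotH {suc u} {suc y} (subst (Adj H₁ (suc u)) (≡.sym p) (Adj-sym H₁ {zero} {suc u} xu₁))) p
      r₀ : rot₁ (suc u) zero ≡ suc (target u)
      r₀ = skipRot-stay H₁ rotH {suc u} {zero} (≡.trans (keep₁ u _) (target-Adj u e))

    open Embed.Rotations 𝓔 {rot} {rot₂} agree

    -- In `H₁` the vertex `zero` has degree one, so the face that enters it turns straight back
    -- along the same edge.
    same₂ : Rot₂.φ PairOrbits.⊢ Del₂.d ~ Del₂.e
    same₂ = PairOrbits.~-sym Rot₂.φ-inj (1 , ≡.trans (faceNext-dart H₁ rot₁ {suc u} {zero} (Adj-sym H₁ {zero} {suc u} xu₁)) (cong (zero ,_) r))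
      where
      r : rot₁ zero (suc u) ≡ suc u
      r = ≡.trans (skipRot-skip H₁ rotH {zero} {suc u} (subst (λ t → adj H₁ zero t ≡ false) (≡.sym rotH-u) (Deletion.absent D₁)))
            (≡.trans (cong (rotH zero) rotH-u) rotH-w)

    separate₂ : ¬ Conn H₂ zero (suc u)
    separate₂ (_◅_ {j = j} a _) = Adj-absurd H₂ {zero} {j} a (zero-isolated j)

    -- The face of (w , zero) is the new quadrilateral w, zero, u, v.
    data Quad : Fin (suc n) × Fin (suc n) → Set where
      q₀ : Quad (suc w , zero)
      q₁ : Quad (zero , suc u)
      q₂ : Quad (suc u , suc v)
      q₃ : Quad (suc v , suc w)

    quad-next : ∀ {p} → Quad p → Quad (Rot₁.φ p)
    quad-next q₀ = subst Quad (≡.sym (≡.trans (faceNext-dart H rotH {suc w} {zero} end-w) (cong (zero ,_) rotH-w))) q₁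
    quad-next q₁ = subst Quad (≡.sym (≡.trans (faceNext-dart H rotH {zero} {suc u} end-u) (cong (λ t → suc u , suc t) target-u))) q₂
    quad-next q₂ = subst Quad (≡.sym (≡.trans (faceNext-dart H rotH {suc u} {suc v} uv) (cong (suc v ,_) r))) q₃
      where
      r : rotH (suc v) (suc u) ≡ suc w
      r with step v u
      ... | miss _ p = ≡.trans p (cong suc turn)
      ... | hit e _ _ with end-cases v e
      ...   | inj₁ p = ⊥-elim (Adj-≢ G uv (≡.sym p))
      ...   | inj₂ p = ⊥-elim (Adj-≢ G vw p)
    quad-next q₃ = subst Quad (≡.sym (≡.trans (faceNext-dart H rotH {suc v} {suc w} vw) (cong (suc w ,_) r))) q₀
      where
      r : rotH (suc w) (suc v) ≡ zero
      r with step w v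
      ... | hit _ _ p = p
      ... | miss n _ = ⊥-elim (n (end-w , ≡.sym target-w))

    quad-iter : ∀ k → Quad (iter k Rot₁.φ (suc w , zero))
    quad-iter zero = q₀
    quad-iter (suc k) = quad-next (quad-iter k)

    -- One dart of the edge lies on the quadrilateral. The only dart of the quadrilateral that
    -- leaves `zero` goes to `u`, so the reverse dart lies on another face.
    diff₁ : ¬ Rot₁.φ PairOrbits.⊢ Del₁.d ~ Del₁.e
    diff₁ r with PairOrbits.~-sym Rot₁.φ-inj r
    ... | k , p = out (subst Quad p (quad-iter k)) refl
      where
      out : ∀ {p} → Quad p → p ≢ (zero , suc w)
      out q₁ e = u≢w (Finₚ.suc-injective (cong proj₂ e))

  edgesH : numEdges H ≡ 2 + numEdges G
  edgesH = ≡.trans Del₁.edges (cong suc (≡.trans Del₂.edges (cong suc (Embed.edges 𝓔))))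

  genusH : suc n + numFaces H rotH + numIsolated H ≡ 2 * numComponents H + numEdges H
  genusH = begin
    suc n + F + I                    ≡⟨ ℕₚ.+-assoc (suc n) F I ⟩
    suc n + (F + I)                  ≡⟨ cong (suc n +_) (Rot₁.faces-diff diff₁) ⟨
    suc n + suc (F₁ + I₁)            ≡⟨ cong (suc n +_) (Rot₂.faces-same same₂) ⟨
    suc n + (F₂ + I₂)                ≡⟨ ℕₚ.+-assoc (suc n) F₂ I₂ ⟨
    suc n + F₂ + I₂                  ≡⟨ genus-push isRot genus ⟩
    2 * numComponents H₂ + E₂        ≡⟨ cong (λ c → 2 * c + E₂) (Del₂.components-suc separate₂) ⟩
    2 * suc C₁ + E₂                  ≡⟨ cong (λ c → 2 * suc c + E₂) (Del₁.components-same (Rot₁.apart⇒Conn diff₁)) ⟩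
    2 * suc C + E₂                   ≡⟨ solve 2 (λ c e → con 2 :* (con 1 :+ c) :+ e := con 2 :* c :+ (con 2 :+ e)) refl C E₂ ⟩
    2 * C + (2 + E₂)                 ≡⟨ cong (2 * C +_) (≡.trans Del₁.edges (cong suc Del₂.edges)) ⟨
    2 * C + numEdges H ∎
    where
    open ≡.≡-Reasoning
    open +-*-Solver
    F = numFaces H rotH
    I = numIsolated H
    C = numComponents H
    F₁ = numFaces H₁ rot₁
    I₁ = numIsolated H₁
    C₁ = numComponents H₁
    F₂ = numFaces H₂ rot₂
    I₂ = numIsolated H₂
    E₂ = numEdges H₂

  -- The angle moves to the new vertex but keeps its ends, so further vertices can be attached to
  -- the same pair.
  attached : Angle (suc n)
  attached = record { G = H ; rot = rotH ; isRot = isRotH ; genus = genusH ; u = suc u ; v = zero ; w = suc w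
    ; uv = end-u ; vw = end-w ; turn = rotH-u ; u≢w = u≢w ∘ Finₚ.suc-injective }

-- Theta graphs

-- Adjacent vertices are distinct, which leaves `b` and `d` as the only pair whose distinctness has
-- to be demanded.
record Theta {n} (G : Graph n) : Set where
  constructor mkTheta
  field
    {a b c d} : Fin n
    ab  : Adj G a b
    bc  : Adj G b c
    ac  : Adj G a c
    cd  : Adj G c d
    ad  : Adj G a d
    b≢d : b ≢ d

record Theta⁺ {n} (G : Graph n) : Set where
  field
    theta : Theta G
  open Theta theta public
  field
    {x} : Fin n
    bx  : Adj G b x
    x≢a : x ≢ a
    x≢c : x ≢ c
    x≢d : x ≢ d

Θ₄-Theta : ∀ {n} {G : Graph n} → Contains theta4 G → Theta G
Θ₄-Theta (f , inj , hom) = mkTheta (hom 0F 1F refl) (hom 1F 2F refl) (hom 0F 2F refl) (hom 2F 3F refl) (hom 0F 3F refl)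
  λ p → case-13 (inj p)
  where
  case-13 : 1F ≢ 3F
  case-13 ()

module _ {n} {G : Graph n} (T : Theta G) where
  open Theta T

  vertices : Vec (Fin n) 4
  vertices = a ∷ b ∷ c ∷ d ∷ []

  vertices-unique : VAllPairs.AllPairs _≢_ vertices
  vertices-unique =
    (Adj-≢ G ab VAll.∷ Adj-≢ G ac VAll.∷ Adj-≢ G ad VAll.∷ VAll.[]) VAllPairs.∷
    (Adj-≢ G bc VAll.∷ b≢d VAll.∷ VAll.[]) VAllPairs.∷
    (Adj-≢ G cd VAll.∷ VAll.[]) VAllPairs.∷ VAll.[] VAllPairs.∷ VAllPairs.[]

Theta-Θ₄ : ∀ {n} {G : Graph n} → Theta G → Contains theta4 G
Theta-Θ₄ {n} {G} T = lookup vs , (λ {i} {j} → lookup-injective (vertices-unique {G = G} T) i j) , hom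
  where
  open Theta T
  vs = vertices T
  hom : ∀ i j → θadj i j ≡ true → Adj G (lookup vs i) (lookup vs j)
  hom 0F 1F _ = ab
  hom 0F 2F _ = ac
  hom 0F 3F _ = ad
  hom 1F 0F _ = Adj-sym G ab
  hom 1F 2F _ = bc
  hom 1F 3F ()
  hom 2F 0F _ = Adj-sym G ac
  hom 2F 1F _ = Adj-sym G bc
  hom 2F 3F _ = cd
  hom 3F 0F _ = Adj-sym G ad
  hom 3F 2F _ = Adj-sym G cd
  hom 3F 3F ()

Theta-swap : ∀ {n} {G : Graph n} → Theta G → Theta G
Theta-swap {G = G} (mkTheta ab bc ac cd ad b≢d) = mkTheta ad (Adj-sym G cd) ac (Adj-sym G bc) ab (b≢d ∘ ≡.sym)

-- Only `1F` and `3F` have degree two in `theta4`; a pendant edge at `3F` is brought to `b` by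
-- `Theta-swap`.
Θ₄⁺-Theta⁺ : ∀ {n} {G : Graph n} v → degree theta4 v ≡ 2 → Contains (plus theta4 v) G → Theta⁺ G
Θ₄⁺-Theta⁺ {G = G} 1F _ (f , inj , hom) = record
  { theta = Θ₄-Theta {G = G} (f ∘ suc , (λ p → Finₚ.suc-injective (inj p)) , λ i j → hom (suc i) (suc j))
  -- In `plus` the new vertex is `0F` and the old indices move up by one, so `2F` is the former
  -- `1F`.
  ; bx = hom 2F 0F refl ; x≢a = λ p → Finₚ.0≢1+n (inj p) ; x≢c = λ p → Finₚ.0≢1+n (inj p) ; x≢d = λ p → Finₚ.0≢1+n (inj p) }
Θ₄⁺-Theta⁺ {G = G} 3F _ (f , inj , hom) = record
  { theta = Theta-swap (Θ₄-Theta {G = G} (f ∘ suc , (λ p → Finₚ.suc-injective (inj p)) , λ i j → hom (suc i) (suc j)))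
  ; bx = hom 4F 0F refl ; x≢a = λ p → Finₚ.0≢1+n (inj p) ; x≢c = λ p → Finₚ.0≢1+n (inj p) ; x≢d = λ p → Finₚ.0≢1+n (inj p) }

Theta⁺-Θ₄⁺ : ∀ {n} {G : Graph n} → Theta⁺ G → Contains (plus theta4 1F) G
Theta⁺-Θ₄⁺ {n} {G} T = lookup (x ∷ vs) , (λ {i} {j} → lookup-injective (new VAllPairs.∷ vertices-unique {G = G} theta) i j) , hom
  where
  open Theta⁺ T
  vs = vertices theta
  new : VAll.All (x ≢_) vs
  new = x≢a VAll.∷ (Adj-≢ G bx ∘ ≡.sym) VAll.∷ x≢c VAll.∷ x≢d VAll.∷ VAll.[]
  hom : ∀ i j → plusAdj theta4 1F i j ≡ true → Adj G (lookup (x ∷ vs) i) (lookup (x ∷ vs) j)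
  hom 0F 2F _ = Adj-sym G bx
  hom 2F 0F _ = bx
  hom (suc i) (suc j) e = proj₂ (proj₂ (Theta-Θ₄ {G = G} theta)) i j e

free⇒¬Theta : ∀ {n} {G : Graph n} → Free Θ₄ G → ¬ Theta G
free⇒¬Theta {G = G} F T = F theta4 (refl , refl) (Theta-Θ₄ {G = G} T)

¬Theta⇒free : ∀ {n} {G : Graph n} → ¬ Theta G → Free Θ₄ G
¬Theta⇒free {G = G} N _ (refl , refl) C = N (Θ₄-Theta {G = G} C)

free⇒¬Theta⁺ : ∀ {n} {G : Graph n} → Free Θ₄⁺ G → ¬ Theta⁺ G
free⇒¬Theta⁺ {G = G} F T = F (plus theta4 1F) (4 , refl , theta4 , (refl , refl) , 1F , refl , refl) (Theta⁺-Θ₄⁺ {G = G} T)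

¬Theta⁺⇒free : ∀ {n} {G : Graph n} → ¬ Theta⁺ G → Free Θ₄⁺ G
¬Theta⁺⇒free {G = G} N _ (_ , refl , _ , (refl , refl) , v , two , refl) C = N (Θ₄⁺-Theta⁺ {G = G} v two C)

module _ {n} (G : Graph n) where

  Adj? : ∀ u v → Dec (Adj G u v)
  Adj? u v = adj G u v Bool.≟ true

  Theta? : Dec (Theta G)
  Theta? = map′ (λ (a , b , c , d , ab , bc , ac , cd , ad , n) → mkTheta ab bc ac cd ad n)
    (λ (mkTheta ab bc ac cd ad n) → _ , _ , _ , _ , ab , bc , ac , cd , ad , n)
    (Finₚ.any? λ a → Finₚ.any? λ b → Finₚ.any? λ c → Finₚ.any? λ d →
      Adj? a b ×-dec Adj? b c ×-dec Adj? a c ×-dec Adj? c d ×-dec Adj? a d ×-dec ¬? (b Finₚ.≟ d))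

module _ {m n} {G : Graph n} {f : Fin m → Fin n} (f-inj : ∀ {x y} → f x ≡ f y → x ≡ y) where

  Theta-induced : Theta (induced G f) → Theta G
  Theta-induced (mkTheta ab bc ac cd ad n) = mkTheta ab bc ac cd ad (n ∘ f-inj)

  Theta⁺-induced : Theta⁺ (induced G f) → Theta⁺ G
  Theta⁺-induced T = record { theta = Theta-induced theta ; bx = bx ; x≢a = x≢a ∘ f-inj ; x≢c = x≢c ∘ f-inj ; x≢d = x≢d ∘ f-inj }
    where open Theta⁺ T

-- Edge counts after deletion of a vertex

Neighbours⊆ : ∀ {n} → Graph n → Fin n → List (Fin n) → Set
Neighbours⊆ G v ks = ∀ w → Adj G v w → w ∈ ks

numEdges-∖ : ∀ {n} (G : Graph (suc n)) v ks → Neighbours⊆ G v ks → numEdges G ≤ numEdges (G ∖ v) + length ks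
numEdges-∖ {n} G v ks nb = subst (numEdges G ≤_) size′ (Trans-≤ SameEdge-com (Trans-numEdges G) cs cov)
  where
  t = Trans-numEdges (G ∖ v)
  old : Fin n × Fin n → Fin (suc n) × Fin (suc n)
  old (x , y) = punchIn v x , punchIn v y
  cs : List (Fin (suc n) × Fin (suc n))
  cs = map old (reps t) ++ map (v ,_) ks
  size′ : length cs ≡ numEdges (G ∖ v) + length ks
  size′ = ≡.trans (length-++ (map old (reps t))) (cong₂ _+_ (≡.trans (length-map old (reps t)) (size t)) (length-map (v ,_) ks))
  new : ∀ {w d} → Adj G v w → SameEdge d (v , w) → Any (SameEdge d) cs
  new {w} {d} a s = Anyₚ.++⁺ʳ (map old (reps t)) (Any.map (λ { refl → s }) (∈-map⁺ (v ,_) (nb w a)))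
  cov : ∀ d → IsDart G d → Any (SameEdge d) cs
  cov (x , y) a with punchIn-cov v x | punchIn-cov v y
  ... | inj₂ refl | _ = new a (inj₁ refl)
  ... | inj₁ _ | inj₂ refl = new (Adj-sym G a) (inj₂ refl)
  ... | inj₁ (x′ , refl) | inj₁ (y′ , refl) = Anyₚ.++⁺ˡ (Anyₚ.map⁺ (Any.map
      (λ { (inj₁ refl) → inj₁ refl ; (inj₂ refl) → inj₂ refl }) (cover t (x′ , y′) a)))

binom₂ : ℕ → ℕ
binom₂ zero    = 0
binom₂ (suc n) = binom₂ n + n

numEdges-≤ : ∀ {n} (G : Graph n) → numEdges G ≤ binom₂ n
numEdges-≤ {zero} G = z≤n
numEdges-≤ {suc n} G = ℕₚ.≤-trans (numEdges-∖ G zero (map suc (allFin n)) nb)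
  (ℕₚ.+-mono-≤ (numEdges-≤ (G ∖ zero)) (ℕₚ.≤-reflexive (≡.trans (length-map Fin.suc (allFin n)) (length-tabulate {n = n} _))))
  where
  nb : Neighbours⊆ G zero (map suc (allFin n))
  nb zero a = ⊥-elim (Adj-≢ G a refl)
  nb (suc w) a = ∈-map⁺ suc (∈-allFin w)

-- Graphs on Fin n encoded by the part of the adjacency matrix above the diagonal.
Bits : ℕ → Set
Bits zero    = ⊤
Bits (suc n) = Vec Bool n × Bits n

bitAdj : ∀ {n} → Bits n → Fin n → Fin n → Bool
bitAdj (r , b) zero    zero    = false
bitAdj (r , b) zero    (suc j) = lookup r j
bitAdj (r , b) (suc i) zero    = lookup r i
bitAdj (r , b) (suc i) (suc j) = bitAdj b i j

bitSym : ∀ {n} (b : Bits n) i j → bitAdj b i j ≡ bitAdj b j i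
bitSym b zero    zero    = refl
bitSym b zero    (suc j) = refl
bitSym b (suc i) zero    = refl
bitSym (r , b) (suc i) (suc j) = bitSym b i j

bitIrrefl : ∀ {n} (b : Bits n) i → bitAdj b i i ≡ false
bitIrrefl b zero = refl
bitIrrefl (r , b) (suc i) = bitIrrefl b i

decode : ∀ {n} → Bits n → Graph n
decode b = record { adj = bitAdj b ; sym = bitSym b ; irrefl = bitIrrefl b }

encode : ∀ {n} → Graph n → Bits n
encode {zero}  G = tt
encode {suc n} G = tabulate (λ j → adj G zero (suc j)) , encode (induced G suc)

decode-encode : ∀ {n} (G : Graph n) → G ≈ᴳ decode (encode G)
decode-encode {suc n} G zero    zero    = ≡.sym (irrefl G zero)
decode-encode {suc n} G zero    (suc j) = lookup∘tabulate _ j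
decode-encode {suc n} G (suc i) zero    = ≡.trans (lookup∘tabulate _ i) (sym G zero (suc i))
decode-encode {suc n} G (suc i) (suc j) = decode-encode (induced G suc) i j

module _ {n} {G H : Graph n} (e : G ≈ᴳ H) where

  numEdges-≈ : numEdges H ≡ numEdges G
  numEdges-≈ = Embed.edges (≈ᴳ-Embedding {G = G} {H} e)

  Theta-≈ : Theta H → Theta G
  Theta-≈ (mkTheta {a} {b} {c} {d} ab bc ac cd ad n) = mkTheta (t ab) (t bc) (t ac) (t cd) (t ad) n
    where
    t : ∀ {x y} → Adj H x y → Adj G x y
    t {x} {y} p = ≡.trans (≡.sym (e x y)) p

-- Exhaustive check on five vertices

allVec : ∀ n → (Vec Bool n → Bool) → Bool
allVec zero    p = p []
allVec (suc n) p = allVec n (λ v → p (false ∷ v)) ∧ allVec n (λ v → p (true ∷ v))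

allVec-sound : ∀ n p → allVec n p ≡ true → ∀ v → p v ≡ true
allVec-sound zero    p e [] = e
allVec-sound (suc n) p e (false ∷ v) = allVec-sound n _ (proj₁ (∧-true e)) v
allVec-sound (suc n) p e (true ∷ v) = allVec-sound n _ (proj₂ (∧-true {allVec n (λ v → p (false ∷ v))} e)) v

allBits : ∀ n → (Bits n → Bool) → Bool
allBits zero    p = p tt
allBits (suc n) p = allVec n λ r → allBits n λ b → p (r , b)

allBits-sound : ∀ n p → allBits n p ≡ true → ∀ b → p b ≡ true
allBits-sound zero    p e tt = e
allBits-sound (suc n) p e (r , b) = allBits-sound n _ (allVec-sound n _ e r) b

-- A Boolean test made for evaluation: the spine comes first, and every adjacency is tested before
-- the next vertex is searched for.
hasTheta : ∀ {n} → Graph n → Bool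
hasTheta {n} G = any (λ a → any (λ c → adj G a c ∧ any (λ b → (adj G a b ∧ adj G b c) ∧
  any (λ d → ((adj G a d ∧ adj G c d) ∧ not (does (b Finₚ.≟ d)))) (allFin n)) (allFin n)) (allFin n)) (allFin n)

hasTheta-sound : ∀ {n} (G : Graph n) → hasTheta G ≡ true → Theta G
hasTheta-sound {n} G e with any-elim _ (allFin n) e
... | a , e₁ with any-elim _ (allFin n) e₁
...   | c , e₂ with ∧-true {adj G a c} e₂
...     | ac , e₃ with any-elim _ (allFin n) e₃
...       | b , e₄ with ∧-true {adj G a b ∧ adj G b c} e₄
...         | abc , e₅ with any-elim _ (allFin n) e₅ | ∧-true {adj G a b} abc
...           | d , e₆ | ab , bc with ∧-true {adj G a d ∧ adj G c d} e₆
...             | acd , e₇ with ∧-true {adj G a d} acd | b Finₚ.≟ d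
...               | ad , cd | no b≢d = mkTheta ab bc ac cd ad b≢d

-- There are `2^10` codes of graphs on five vertices, and the `refl` evaluates `check` on all of
-- them. The bound is attained by K₂,₃.
five-sparse : ∀ (G : Graph 5) → ¬ Theta G → numEdges G ≤ 6
five-sparse G N with ∨-true {numEdges (decode (encode G)) ≤ᵇ 6} (allBits-sound 5 check refl (encode G))
  where
  check : Bits 5 → Bool
  check b = (numEdges (decode b) ≤ᵇ 6) ∨ hasTheta (decode b)
... | inj₁ l = subst (_≤ 6) (numEdges-≈ {G = G} {decode (encode G)} (decode-encode G)) (ℕₚ.≤ᵇ⇒≤ _ _ (toT l))
... | inj₂ t = ⊥-elim (N (Theta-≈ {G = G} {decode (encode G)} (decode-encode G) (hasTheta-sound (decode (encode G)) t)))

-- Lower bounds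

DegreeAtMost2 : ∀ {n} → Graph n → Set
DegreeAtMost2 G = ∀ v p q r → Adj G v p → Adj G v q → Adj G v r → p ≡ q ⊎ p ≡ r ⊎ q ≡ r

two-neighbours : ∀ {n} (G : Graph n) → DegreeAtMost2 G → ∀ v → ∃[ ks ] (length ks ≤ 2 × Neighbours⊆ G v ks)
two-neighbours G deg v with Finₚ.any? (Adj? G v)
... | no none = [] , z≤n , λ w a → ⊥-elim (none (w , a))
... | yes (p , vp) with Finₚ.any? (λ q → Adj? G v q ×-dec ¬? (p Finₚ.≟ q))
...   | no none = p ∷ [] , s≤s z≤n , nb
  where
  nb : Neighbours⊆ G v (p ∷ [])
  nb w a with p Finₚ.≟ w
  ... | yes refl = here refl
  ... | no n = ⊥-elim (none (w , a , n))
...   | yes (q , vq , p≢q) = p ∷ q ∷ [] , s≤s (s≤s z≤n) , nb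
  where
  nb : Neighbours⊆ G v (p ∷ q ∷ [])
  nb w a with deg v p q w vp vq a
  ... | inj₁ e = ⊥-elim (p≢q e)
  ... | inj₂ (inj₁ refl) = here refl
  ... | inj₂ (inj₂ refl) = there (here refl)

-- For `n = 5 + k` the bound is `2n - 4`, chosen to match K₂,ₙ₋₂. Deleting a vertex lowers it by 2,
-- as much as the vertex can carry.
sparse : ∀ k (G : Graph (5 + k)) → ¬ Theta G → DegreeAtMost2 G → numEdges G ≤ 6 + 2 * k
sparse zero G N deg = five-sparse G N
sparse (suc k) G N deg with two-neighbours G deg zero
... | ks , short , nb = begin
  numEdges G                       ≤⟨ numEdges-∖ G zero ks nb ⟩
  numEdges (G ∖ zero) + length ks  ≤⟨ ℕₚ.+-mono-≤ (sparse k (G ∖ zero) (N ∘ Theta-induced {G = G} Finₚ.suc-injective) deg′) short ⟩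
  6 + 2 * k + 2                    ≡⟨ solve 1 (λ k → con 6 :+ con 2 :* k :+ con 2 := con 6 :+ con 2 :* (con 1 :+ k)) refl k ⟩
  6 + 2 * suc k                    ∎
  where
  open ℕₚ.≤-Reasoning
  open +-*-Solver
  deg′ : DegreeAtMost2 (G ∖ zero)
  deg′ v p q r a b c with deg (suc v) (suc p) (suc q) (suc r) a b c
  ... | inj₁ e = inj₁ (Finₚ.suc-injective e)
  ... | inj₂ (inj₁ e) = inj₂ (inj₁ (Finₚ.suc-injective e))
  ... | inj₂ (inj₂ e) = inj₂ (inj₂ (Finₚ.suc-injective e))

record Lower (n e : ℕ) : Set where
  field
    graph     : Graph n
    planar    : Planar graph
    thetaFree : ¬ Theta graph
    enough    : e ≤ numEdges graph

record OpenAngle (n e : ℕ) : Set where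
  field
    angle     : Angle n
  open Angle angle public
  field
    open-end  : adj G u w ≡ false
    thetaFree : ¬ Theta G
    enough    : e ≤ numEdges G

lower : ∀ {n e} → OpenAngle n e → Lower n e
lower O = record { graph = G ; planar = planar ; thetaFree = thetaFree ; enough = enough }
  where open OpenAngle O

weaken-lower : ∀ {n e e′} → e′ ≤ e → Lower n e → Lower n e′
weaken-lower le L = record { Lower L ; enough = ℕₚ.≤-trans le (Lower.enough L) }

grow : ∀ {n e} → OpenAngle n e → OpenAngle (suc n) (2 + e)
grow {n} {e} O = record
  { angle = attached ; open-end = open-end
  ; thetaFree = free
  ; enough = subst (2 + e ≤_) (≡.sym edgesH) (s≤s (s≤s enough)) }
  where
  open OpenAngle O
  open Attach angle
  closed : ∀ {i j} → isEnd i ≡ true → isEnd j ≡ true → ¬ Adj G i j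
  closed {i} {j} p q a with end-cases i p | end-cases j q
  ... | inj₁ refl | inj₁ refl = Adj-≢ G a refl
  ... | inj₁ refl | inj₂ refl = Adj-absurd G a open-end
  ... | inj₂ refl | inj₁ refl = Adj-absurd G (Adj-sym G a) open-end
  ... | inj₂ refl | inj₂ refl = Adj-≢ G a refl
  -- A new vertex in a triangle would make its neighbours u and w adjacent.
  no-triangle : ∀ x y → Adj H zero x → Adj H zero y → ¬ Adj H x y
  no-triangle (suc i) (suc j) p q a = closed p q a
  free : ¬ Theta H
  free (mkTheta {zero} {b} {c} {d} ab bc ac cd ad n) = no-triangle b c ab ac bc
  free (mkTheta {suc a} {zero} {c} {d} ab bc ac cd ad n) = no-triangle (suc a) c ab bc ac
  free (mkTheta {suc a} {suc b} {zero} {d} ab bc ac cd ad n) = no-triangle (suc a) (suc b) ac bc ab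
  free (mkTheta {suc a} {suc b} {suc c} {zero} ab bc ac cd ad n) = no-triangle (suc a) (suc c) ad cd ac
  free (mkTheta {suc a} {suc b} {suc c} {suc d} ab bc ac cd ad n) = thetaFree (mkTheta ab bc ac cd ad (n ∘ cong suc))

module _ {n} (G : Graph n) {rot : Fin n → Fin n → Fin n} (R : IsRotationSystem G rot) (N : ¬ Theta G) where

  -- If consecutive neighbours of every vertex coincide or are adjacent, three neighbours in a row span a Theta.
  few-neighbours : (∀ u v → Adj G u v → u ≡ rot v u ⊎ Adj G u (rot v u)) → DegreeAtMost2 G
  few-neighbours near v p q r vp vq vr = coincide (in-row vq) (in-row vr)
    where
    s : Fin n
    s = rot v p
    vs : Adj G v s
    vs = rot-Adj G rot R vp
    -- The cyclic order around `v` has length at most two.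
    back : rot v s ≡ p ⊎ p ≡ s
    back with near p v (Adj-sym G vp)
    ... | inj₁ e = inj₂ e
    ... | inj₂ ps with near s v (Adj-sym G vs)
    ...   | inj₁ e = inj₂ (rot-inj G rot R vp vs e)
    ...   | inj₂ st with rot v s Finₚ.≟ p
    ...     | yes e = inj₁ e
    ...     | no ne = ⊥-elim (N (mkTheta vp ps vs st (rot-Adj G rot R vs) (ne ∘ ≡.sym)))
    stay : ∀ k → iter k (rot v) p ≡ p ⊎ iter k (rot v) p ≡ s
    stay zero = inj₁ refl
    stay (suc k) with stay k | back
    ... | inj₁ e | _ = inj₂ (cong (rot v) e)
    ... | inj₂ e | inj₁ b = inj₁ (≡.trans (cong (rot v) e) b)
    ... | inj₂ e | inj₂ b = inj₂ (cong (rot v) (≡.trans e (≡.sym b)))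
    in-row : ∀ {x} → Adj G v x → x ≡ p ⊎ x ≡ s
    in-row a with rot-cycle G rot R vp a
    ... | k , refl = stay k
    coincide : q ≡ p ⊎ q ≡ s → r ≡ p ⊎ r ≡ s → p ≡ q ⊎ p ≡ r ⊎ q ≡ r
    coincide (inj₁ e) _ = inj₁ (≡.sym e)
    coincide (inj₂ _) (inj₁ e) = inj₂ (inj₁ (≡.sym e))
    coincide (inj₂ e) (inj₂ e′) = inj₂ (inj₂ (≡.trans e (≡.sym e′)))

lower-angle : ∀ {n e} → Lower n e → OpenAngle n e ⊎ Σ (Lower n e) λ L → DegreeAtMost2 (Lower.graph L)
lower-angle {n} {e} L with Lower.planar L
... | rot , R , g with Finₚ.any? (λ u → Finₚ.any? (λ v → Adj? (Lower.graph L) u v ×-dec ¬? (u Finₚ.≟ rot v u) ×-dec adj (Lower.graph L) u (rot v u) Bool.≟ false))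
... | yes (u , v , uv , u≢w , o) = inj₁ (record
  { angle = record { G = G ; rot = rot ; isRot = R ; genus = g ; u = u ; v = v ; w = rot v u
      ; uv = uv ; vw = rot-Adj G rot R (Adj-sym G uv) ; turn = refl ; u≢w = u≢w }
  ; open-end = o ; thetaFree = Lower.thetaFree L ; enough = Lower.enough L })
  where G = Lower.graph L
... | no none = inj₂ (L , few-neighbours G R (Lower.thetaFree L) near)
  where
  G = Lower.graph L
  near : ∀ u v → Adj G u v → u ≡ rot v u ⊎ Adj G u (rot v u)
  near u v a with u Finₚ.≟ rot v u | dec-adj G u (rot v u)
  ... | yes e | _ = inj₁ e
  ... | no _  | inj₁ b = inj₂ b
  ... | no ne | inj₂ b = ⊥-elim (none (u , v , a , ne , b))

-- Decidability of rotation systems and explicit plane graphs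

module _ {n} (G : Graph n) (rot : Fin n → Fin n → Fin n) where

  private
    Closed Inject Cyclic : Set
    Closed = ∀ u v → Adj G u v → Adj G u (rot u v)
    Inject = ∀ u v w → Adj G u v → Adj G u w → rot u v ≡ rot u w → v ≡ w
    Cyclic = ∀ u v w → Adj G u v → Adj G u w → ∃[ k ] iter (toℕ {n} k) (rot u) v ≡ w

    closed? : Dec Closed
    closed? = Finₚ.all? λ u → Finₚ.all? λ v → Adj? G u v →-dec Adj? G u (rot u v)

    inject? : Dec Inject
    inject? = Finₚ.all? λ u → Finₚ.all? λ v → Finₚ.all? λ w →
      Adj? G u v →-dec (Adj? G u w →-dec ((rot u v Finₚ.≟ rot u w) →-dec (v Finₚ.≟ w)))

    cyclic? : Dec Cyclic
    cyclic? = Finₚ.all? λ u → Finₚ.all? λ v → Finₚ.all? λ w →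
      Adj? G u v →-dec (Adj? G u w →-dec Finₚ.any? λ k → iter (toℕ k) (rot u) v Finₚ.≟ w)

    -- Extended by fixing the non-neighbours of `u`, the rotation becomes a permutation of the `n`
    -- vertices, so fewer than `n` steps suffice.
    bounded : IsRotationSystem G rot → Cyclic
    bounded R u v w a b =
      let (k , p) = rot-cycle G rot R a b
          (l , l<n , q) = Orbits.~-bounded (λ x → x) (λ e → e) {φ = ρ} ρ-inj (k , ≡.trans (proj₁ (iter-ρ k)) p)
      in Fin.fromℕ< l<n , ≡.trans (cong (λ t → iter t (rot u) v) (Finₚ.toℕ-fromℕ< l<n)) (≡.trans (≡.sym (proj₁ (iter-ρ l))) q)
      where
      ρ : Fin n → Fin n
      ρ x = if adj G u x then rot u x else x
      ρ-adj : ∀ {x} → Adj G u x → ρ x ≡ rot u x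
      ρ-adj e rewrite e = refl
      ρ-inj : ∀ {x y} → ρ x ≡ ρ y → x ≡ y
      ρ-inj {x} {y} p with adj G u x in e | adj G u y in f
      ... | true  | true  = rot-inj G rot R e f p
      ... | true  | false = ⊥-elim (Adj-absurd G (rot-Adj G rot R e) (subst (λ t → adj G u t ≡ false) (≡.sym p) f))
      ... | false | true  = ⊥-elim (Adj-absurd G (rot-Adj G rot R f) (subst (λ t → adj G u t ≡ false) p e))
      ... | false | false = p
      iter-ρ : ∀ k → iter k ρ v ≡ iter k (rot u) v × Adj G u (iter k (rot u) v)
      iter-ρ zero = refl , a
      iter-ρ (suc k) with iter-ρ k
      ... | e , c = ≡.trans (cong ρ e) (ρ-adj c) , rot-Adj G rot R c

  isRotationSystem? : Dec (IsRotationSystem G rot)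
  isRotationSystem? = map′ (λ (c , i , y) → c , i , λ u v w a b → let (k , p) = y u v w a b in toℕ k , p)
    (λ R → proj₁ R , proj₁ (proj₂ R) , bounded R) (closed? ×-dec inject? ×-dec cyclic?)

path₃ : OpenAngle 3 2
path₃ = record
  { angle = record { G = P ; rot = rot ; isRot = toWitness {a? = isRotationSystem? P rot} tt ; genus = refl
      ; u = 0F ; v = 1F ; w = 2F ; uv = refl ; vw = refl ; turn = refl ; u≢w = λ () }
  ; open-end = refl ; thetaFree = toWitnessFalse {a? = Theta? P} tt ; enough = ℕₚ.≤-refl }
  where
  P : Graph 3
  P = decode ((true ∷ false ∷ []) , (true ∷ []) , [] , tt)
  rot : Fin 3 → Fin 3 → Fin 3
  rot 1F 0F = 2F
  rot 1F 2F = 0F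
  rot _  v  = v

-- The triangles 012 and 345 joined by the edges 03, 14, 25.
prism : OpenAngle 6 9
prism = record
  { angle = record { G = P ; rot = rot ; isRot = toWitness {a? = isRotationSystem? P rot} tt ; genus = refl
      ; u = 0F ; v = 1F ; w = 4F ; uv = refl ; vw = refl ; turn = refl ; u≢w = λ () }
  ; open-end = refl ; thetaFree = toWitnessFalse {a? = Theta? P} tt ; enough = ℕₚ.≤-refl }
  where
  P : Graph 6
  P = decode ((true ∷ true ∷ true ∷ false ∷ false ∷ []) , (true ∷ false ∷ true ∷ false ∷ []) ,
    (false ∷ false ∷ true ∷ []) , (true ∷ true ∷ []) , (true ∷ []) , [] , tt)
  rot : Fin 6 → Fin 6 → Fin 6
  -- Row `u` lists the successors of the neighbours of `u`; at non-neighbours `0F` is a filler.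
  rot u v = lookup (lookup
    ( (0F ∷ 2F ∷ 3F ∷ 1F ∷ 0F ∷ 0F ∷ [])
    ∷ (4F ∷ 0F ∷ 0F ∷ 0F ∷ 2F ∷ 0F ∷ [])
    ∷ (1F ∷ 5F ∷ 0F ∷ 0F ∷ 0F ∷ 0F ∷ [])
    ∷ (5F ∷ 0F ∷ 0F ∷ 0F ∷ 0F ∷ 4F ∷ [])
    ∷ (0F ∷ 3F ∷ 0F ∷ 5F ∷ 0F ∷ 1F ∷ [])
    ∷ (0F ∷ 0F ∷ 4F ∷ 2F ∷ 3F ∷ 0F ∷ [])
    ∷ []) u) v

-- K₂ k is the complete bipartite graph with parts of size 2 and 1 + k.
K₂ : ∀ k → OpenAngle (3 + k) (2 * suc k)
K₂ zero = path₃
K₂ (suc k) = subst (OpenAngle (4 + k)) (≡.sym (ℕₚ.*-suc 2 (suc k))) (grow (K₂ k))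

add-two : ∀ k {e} → Lower (6 + k) e → Lower (8 + k) (4 + e)
add-two k {e} L with lower-angle L
... | inj₁ O = lower (grow (grow O))
... | inj₂ (L′ , deg) = weaken-lower few (lower (K₂ (5 + k)))
  where
  -- With `n = 6 + k`, a graph of maximum degree two has at most `2n - 4` edges, and K₂,ₙ on `n + 2`
  -- vertices has `2n`.
  few : 4 + e ≤ 2 * (6 + k)
  few = begin
    4 + e                      ≤⟨ ℕₚ.+-monoʳ-≤ 4 (Lower.enough L′) ⟩
    4 + numEdges (Lower.graph L′) ≤⟨ ℕₚ.+-monoʳ-≤ 4 (sparse (suc k) (Lower.graph L′) (Lower.thetaFree L′) deg) ⟩
    4 + (6 + 2 * suc k)        ≡⟨ solve 1 (λ k → con 4 :+ (con 6 :+ con 2 :* (con 1 :+ k)) := con 2 :* (con 6 :+ k)) refl k ⟩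
    2 * (6 + k)                ∎
    where
    open ℕₚ.≤-Reasoning
    open +-*-Solver

-- Upper bounds

pull-list : ∀ {n} (v : Fin (suc n)) xs → All (v ≢_) xs → ∃[ ys ] xs ≡ map (punchIn v) ys
pull-list v [] [] = [] , refl
pull-list v (x ∷ xs) (n ∷ ns) with pull-list v xs ns
... | ys , refl = punchOut n ∷ ys , cong (_∷ map (punchIn v) ys) (≡.sym (Finₚ.punchIn-punchOut n))

Unique-map⁻ : {A B : Set} (f : A → B) (xs : List A) → Unique (map f xs) → Unique xs
Unique-map⁻ f [] [] = []
Unique-map⁻ f (x ∷ xs) (n ∷ u) = go xs n ∷ Unique-map⁻ f xs u
  where
  go : ∀ ys → All (f x ≢_) (map f ys) → All (x ≢_) ys
  go [] [] = []
  go (y ∷ ys) (m ∷ ms) = (m ∘ cong f) ∷ go ys ms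

record Good {n} (G : Graph n) : Set where
  constructor good
  field
    planar     : Planar G
    theta⁺Free : ¬ Theta⁺ G

Good-∖ : ∀ {n} {G : Graph (suc n)} → Good G → ∀ v → Good (G ∖ v)
Good-∖ {G = G} (good P N) v = good (Planar-∖ {G = G} P v) (N ∘ Theta⁺-induced {G = G} (Finₚ.punchIn-injective v _ _))

-- The vertices go one at a time. When one is removed, its neighbours are among those of the list
-- still present, so at most `k` choose 2 edges are lost in total.
remove-closed : ∀ k {m} (G : Graph (k + m)) → Good G → ∀ vs → length vs ≡ k → Unique vs →
  (∀ v → v ∈ vs → Neighbours⊆ G v vs) → Σ (Graph m) λ G′ → Good G′ × numEdges G ≤ numEdges G′ + binom₂ k
remove-closed zero G gd _ _ _ _ = G , gd , ℕₚ.≤-reflexive (≡.sym (ℕₚ.+-identityʳ _))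
remove-closed (suc k) G gd (v ∷ vs) len (fresh ∷ uq) closed = step (pull-list v vs fresh)
  where
  nb : Neighbours⊆ G v vs
  nb w a with closed v (here refl) w a
  ... | here refl = ⊥-elim (Adj-≢ G a refl)
  ... | there m = m
  step : ∃[ ws ] vs ≡ map (punchIn v) ws → Σ (Graph _) λ G′ → Good G′ × numEdges G ≤ numEdges G′ + binom₂ (suc k)
  step (ws , refl) = G′ , proj₁ (proj₂ ih) , (begin
    numEdges G                     ≤⟨ numEdges-∖ G v vs nb ⟩
    numEdges (G ∖ v) + length vs   ≤⟨ ℕₚ.+-mono-≤ (proj₂ (proj₂ ih)) (ℕₚ.≤-reflexive (ℕₚ.suc-injective len)) ⟩
    numEdges G′ + binom₂ k + k     ≡⟨ ℕₚ.+-assoc (numEdges G′) (binom₂ k) k ⟩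
    numEdges G′ + binom₂ (suc k)   ∎)
    where
    open ℕₚ.≤-Reasoning
    closed′ : ∀ w → w ∈ ws → Neighbours⊆ (G ∖ v) w ws
    closed′ w m x a with closed (punchIn v w) (there (∈-map⁺ (punchIn v) m)) (punchIn v x) a
    ... | here e = ⊥-elim (Finₚ.punchInᵢ≢i v x e)
    ... | there r with ∈-map⁻ (punchIn v) r
    ...   | y , r′ , e = subst (_∈ ws) (≡.sym (Finₚ.punchIn-injective v x y e)) r′
    ih = remove-closed k (G ∖ v) (Good-∖ gd v) ws (≡.trans (≡.sym (length-map (punchIn v) ws)) (ℕₚ.suc-injective len))
           (Unique-map⁻ (punchIn v) ws uq) closed′
    G′ = proj₁ ih

-- Any further neighbour would supply the pendant edge of a Theta⁺. A Theta is viewed as a book with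
-- spine `ac` and pages `b` and `d`.
page-neighbours : ∀ {n} (G : Graph n) → ¬ Theta⁺ G → (T : Theta G) →
  Neighbours⊆ G (Theta.b T) (Theta.a T ∷ Theta.c T ∷ Theta.d T ∷ [])
page-neighbours G N T w bw with w Finₚ.≟ Theta.a T | w Finₚ.≟ Theta.c T | w Finₚ.≟ Theta.d T
... | yes e | _ | _ = here e
... | no _ | yes e | _ = there (here e)
... | no _ | no _ | yes e = there (there (here e))
... | no na | no nc | no nd = ⊥-elim (N (record { theta = T ; bx = bw ; x≢a = na ; x≢c = nc ; x≢d = nd }))

-- What remains of a Theta⁺-free graph containing a Theta abcd: if bd is an edge, then abcd is a component K₄;
-- otherwise b and d have degree two, and in G∖b∖d the edge ac lies in no K₄ since that would be a component.
data Reduction {m} (G : Graph (4 + m)) : Set where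
  book : (G₂ : Graph (2 + m)) → Good G₂ → numEdges G ≤ numEdges G₂ + 4 →
         (a c : Fin (2 + m)) → a ≢ c →
         (∀ e f → e ≢ f → Adj G₂ e f → Adj G₂ e a → Adj G₂ e c → Adj G₂ f a → ¬ Adj G₂ f c) → Reduction G
  K₄ : (G₄ : Graph m) → Good G₄ → numEdges G ≤ numEdges G₄ + 6 → Reduction G

K₄-closed : ∀ {n} (G : Graph n) → ¬ Theta⁺ G → (T : Theta G) → let open Theta T in Adj G b d →
  ∀ v → v ∈ (a ∷ b ∷ c ∷ d ∷ []) → Neighbours⊆ G v (a ∷ b ∷ c ∷ d ∷ [])
K₄-closed G N T bd = closed
  where
  open Theta T
  -- With `bd` present, this edge is a spine with pages `a` and `c`, so each of the four vertices is
  -- a page of some Theta.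
  T′ : Theta G
  T′ = mkTheta (Adj-sym G ab) ad bd (Adj-sym G cd) bc (Adj-≢ G ac)
  closed : ∀ v → v ∈ (a ∷ b ∷ c ∷ d ∷ []) → Neighbours⊆ G v (a ∷ b ∷ c ∷ d ∷ [])
  closed _ (here refl) w p with page-neighbours G N T′ w p
  ... | here e = there (here e)
  ... | there (here e) = there (there (there (here e)))
  ... | there (there (here e)) = there (there (here e))
  closed _ (there (here refl)) w p with page-neighbours G N T w p
  ... | here e = here e
  ... | there (here e) = there (there (here e))
  ... | there (there (here e)) = there (there (there (here e)))
  closed _ (there (there (here refl))) w p with page-neighbours G N (Theta-swap T′) w p
  ... | here e = there (here e)
  ... | there (here e) = there (there (there (here e)))
  ... | there (there (here e)) = here e
  closed _ (there (there (there (here refl)))) w p with page-neighbours G N (Theta-swap T) w p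
  ... | here e = here e
  ... | there (here e) = there (there (here e))
  ... | there (there (here e)) = there (here e)

-- The vertices are rewritten in the coordinates of `G ∖ b ∖ d′`, where the spine survives the
-- deletion of both pages.
split-page : ∀ {n} (G : Graph (2 + n)) (T : Theta G) → let open Theta T in
  ∃[ d′ ] ∃[ a′ ] ∃[ c′ ] (d ≡ punchIn b d′ × a ≡ punchIn b (punchIn d′ a′) × c ≡ punchIn b (punchIn d′ c′))
split-page G (mkTheta {a} {b} {c} {d} ab bc ac cd ad b≢d) with punchIn-cov b d | punchIn-cov b a | punchIn-cov b c
... | inj₂ refl | _ | _ = ⊥-elim (b≢d refl)
... | inj₁ _ | inj₂ refl | _ = ⊥-elim (Adj-≢ G ab refl)
... | inj₁ _ | inj₁ _ | inj₂ refl = ⊥-elim (Adj-≢ G bc refl)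
... | inj₁ (d′ , refl) | inj₁ (a′ , refl) | inj₁ (c′ , refl) with punchIn-cov d′ a′ | punchIn-cov d′ c′
...   | inj₂ refl | _ = ⊥-elim (Adj-≢ G ad refl)
...   | inj₁ _ | inj₂ refl = ⊥-elim (Adj-≢ G cd refl)
...   | inj₁ (a″ , refl) | inj₁ (c″ , refl) = d′ , a″ , c″ , refl , refl , refl

module _ {n} (G : Graph (2 + n)) (N : ¬ Theta⁺ G) {b d′ a c} (ab : Adj G (punchIn b (punchIn d′ a)) b)
  (bc : Adj G b (punchIn b (punchIn d′ c))) (ac : Adj G (punchIn b (punchIn d′ a)) (punchIn b (punchIn d′ c)))
  (cd : Adj G (punchIn b (punchIn d′ c)) (punchIn b d′)) (ad : Adj G (punchIn b (punchIn d′ a)) (punchIn b d′))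
  (b≢d : b ≢ punchIn b d′) (¬bd : ¬ Adj G b (punchIn b d′)) where

  private
    T : Theta G
    T = mkTheta ab bc ac cd ad b≢d

    nb-b : Neighbours⊆ G b (punchIn b (punchIn d′ a) ∷ punchIn b (punchIn d′ c) ∷ [])
    nb-b w p with page-neighbours G N T w p
    ... | here e = here e
    ... | there (here e) = there (here e)
    ... | there (there (here refl)) = ⊥-elim (¬bd p)

    nb-d : Neighbours⊆ (G ∖ b) d′ (punchIn d′ a ∷ punchIn d′ c ∷ [])
    nb-d w p with page-neighbours G N (Theta-swap T) (punchIn b w) p
    ... | here e = here (Finₚ.punchIn-injective b _ _ e)
    ... | there (here e) = there (here (Finₚ.punchIn-injective b _ _ e))
    ... | there (there (here e)) = ⊥-elim (Finₚ.punchInᵢ≢i b w e)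

  remove-pages : numEdges G ≤ numEdges (G ∖ b ∖ d′) + 4
  remove-pages = begin
    numEdges G                     ≤⟨ numEdges-∖ G b _ nb-b ⟩
    numEdges (G ∖ b) + 2           ≤⟨ ℕₚ.+-monoˡ-≤ 2 (numEdges-∖ (G ∖ b) d′ _ nb-d) ⟩
    numEdges (G ∖ b ∖ d′) + 2 + 2  ≡⟨ ℕₚ.+-assoc (numEdges (G ∖ b ∖ d′)) 2 2 ⟩
    numEdges (G ∖ b ∖ d′) + 4      ∎
    where open ℕₚ.≤-Reasoning

  -- Otherwise `ef` would be the spine of a Theta with pages `a` and `c`, and the deleted vertex `b`
  -- would hang on `a`.
  spine-not-in-K₄ : ∀ e f → e ≢ f → Adj (G ∖ b ∖ d′) e f → Adj (G ∖ b ∖ d′) e a → Adj (G ∖ b ∖ d′) e c →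
    Adj (G ∖ b ∖ d′) f a → ¬ Adj (G ∖ b ∖ d′) f c
  spine-not-in-K₄ e f e≢f ef ea ec fa fc = N (record
    { theta = mkTheta ea (Adj-sym G fa) ef fc ec (Adj-≢ G ac)
    ; bx = ab ; x≢a = Finₚ.punchInᵢ≢i b _ ∘ ≡.sym ; x≢c = Finₚ.punchInᵢ≢i b _ ∘ ≡.sym
    ; x≢d = Finₚ.punchInᵢ≢i b _ ∘ ≡.sym })

reduce : ∀ {m} (G : Graph (4 + m)) → Good G → Theta G → Reduction G
reduce {m} G gd T = decide (Adj? G b d)
  where
  open Theta T
  N = Good.theta⁺Free gd
  uniq : Unique (a ∷ b ∷ c ∷ d ∷ [])
  uniq = (Adj-≢ G ab ∷ Adj-≢ G ac ∷ Adj-≢ G ad ∷ []) ∷ (Adj-≢ G bc ∷ b≢d ∷ []) ∷ (Adj-≢ G cd ∷ []) ∷ [] ∷ []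
  pages : ∀ {a b c d} → Adj G a b → Adj G b c → Adj G a c → Adj G c d → Adj G a d → b ≢ d → ¬ Adj G b d →
    ∃[ d′ ] ∃[ a′ ] ∃[ c′ ] (d ≡ punchIn b d′ × a ≡ punchIn b (punchIn d′ a′) × c ≡ punchIn b (punchIn d′ c′)) → Reduction G
  pages {b = b} ab bc ac cd ad b≢d ¬bd (d′ , a′ , c′ , refl , refl , refl) =
    book (G ∖ b ∖ d′) (Good-∖ (Good-∖ gd b) d′) (remove-pages G N ab bc ac cd ad b≢d ¬bd) a′ c′
      (λ p → Adj-≢ G ac (cong (punchIn b ∘ punchIn d′) p)) (spine-not-in-K₄ G N ab bc ac cd ad b≢d ¬bd)
  decide : Dec (Adj G b d) → Reduction G
  decide (yes bd) = let (G₄ , good₄ , le) = remove-closed 4 G gd (a ∷ b ∷ c ∷ d ∷ []) refl uniq (K₄-closed G N T bd)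
                    in K₄ G₄ good₄ le
  decide (no ¬bd) = pages ab bc ac cd ad b≢d ¬bd (split-page G T)

-- If all pairs are adjacent, the two vertices other than `a` and `c` contradict the hypothesis.
-- Otherwise an end `x` of a missing edge has at most 2 neighbours, and the other three vertices
-- span at most 3 edges.
numEdges-four : (G : Graph 4) (a c : Fin 4) → a ≢ c →
  (∀ e f → e ≢ f → Adj G e f → Adj G e a → Adj G e c → Adj G f a → ¬ Adj G f c) → numEdges G ≤ 5
numEdges-four G a c a≢c clash = decide (Finₚ.any? λ x → Finₚ.any? λ y′ → adj G x (punchIn x y′) Bool.≟ false)
  where
  decide : Dec (∃[ x ] ∃[ y′ ] adj G x (punchIn x y′) ≡ false) → numEdges G ≤ 5
  decide (yes (x , y′ , o)) = ℕₚ.≤-trans (numEdges-∖ G x (map (punchIn x ∘ punchIn y′) (allFin 2)) nb) (ℕₚ.+-monoˡ-≤ 2 (numEdges-≤ (G ∖ x)))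
    where
    nb : Neighbours⊆ G x (map (punchIn x ∘ punchIn y′) (allFin 2))
    nb w p with punchIn-cov x w
    ... | inj₂ refl = ⊥-elim (Adj-≢ G p refl)
    ... | inj₁ (w′ , refl) with punchIn-cov y′ w′
    ...   | inj₂ refl = ⊥-elim (Adj-absurd G p o)
    ...   | inj₁ (z , refl) = ∈-map⁺ (punchIn x ∘ punchIn y′) (∈-allFin z)
  decide (no none) = ⊥-elim ([ place , a≢c ∘ ≡.sym ]′ (punchIn-cov a c))
    where
    full : ∀ {x y} → x ≢ y → Adj G x y
    full {x} {y} n with dec-adj G x y | punchIn-cov x y
    ... | inj₁ p | _ = p
    ... | inj₂ o | inj₁ (y′ , refl) = ⊥-elim (none (x , y′ , o))
    ... | inj₂ o | inj₂ refl = ⊥-elim (n refl)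
    place : ¬ (∃[ c′ ] c ≡ punchIn a c′)
    place (c′ , refl) = clash (ι 0F) (ι 1F) 0≢1 (full 0≢1) (full (away-a 0F)) (full (away-c 0F)) (full (away-a 1F)) (full (away-c 1F))
      where
      ι : Fin 2 → Fin 4
      ι = punchIn a ∘ punchIn c′
      0≢1 : ι 0F ≢ ι 1F
      0≢1 e = Finₚ.0≢1+n (Finₚ.punchIn-injective c′ 0F 1F (Finₚ.punchIn-injective a _ _ e))
      away-a : ∀ z → ι z ≢ a
      away-a z = Finₚ.punchInᵢ≢i a _
      away-c : ∀ z → ι z ≢ punchIn a c′
      away-c z e = Finₚ.punchInᵢ≢i c′ z (Finₚ.punchIn-injective a _ _ e)

-- Without pages three vertices are left, which gives 3 + 4; without a K₄ one vertex is left, which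
-- gives 0 + 6.
numEdges-five : (G : Graph 5) → Good G → numEdges G ≤ 7
numEdges-five G gd = decide (Theta? G)
  where
  bound : Reduction G → numEdges G ≤ 7
  bound (book G₂ _ le _ _ _ _) = ℕₚ.≤-trans le (ℕₚ.+-monoˡ-≤ 4 (numEdges-≤ G₂))
  bound (K₄ G₄ _ le) = ℕₚ.≤-trans le (ℕₚ.≤-trans (ℕₚ.+-monoˡ-≤ 6 (numEdges-≤ G₄)) (ℕₚ.n≤1+n 6))
  decide : Dec (Theta G) → numEdges G ≤ 7
  decide (no N)  = ℕₚ.≤-trans (five-sparse G N) (ℕₚ.n≤1+n 6)
  decide (yes T) = bound (reduce G gd T)

-- The bound 2n - 4 of K₂,ₙ₋₂ for n = 6 + k.
lower-bipartite : ∀ k → Lower (6 + k) (8 + 2 * k)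
lower-bipartite k = weaken-lower (ℕₚ.≤-reflexive (≡.sym (ℕₚ.*-distribˡ-+ 2 4 k))) (lower (K₂ (3 + k)))

theta-free-as-large : ∀ k (G : Graph (6 + k)) → Good G → Dec (Theta G) → Lower (6 + k) (numEdges G)
-- The recursive clauses apply when the remainder still has six vertices. The clauses for smaller
-- remainders compare explicit numbers.
after-reduction : ∀ k {G : Graph (6 + k)} → Reduction G → Lower (6 + k) (numEdges G)

theta-free-as-large k G gd (no N) = record { graph = G ; planar = Good.planar gd ; thetaFree = N ; enough = ℕₚ.≤-refl }
theta-free-as-large k G gd (yes T) = after-reduction k (reduce G gd T)

-- Four vertices remain: 5 + 4 edges are matched by the 9 of the prism.
after-reduction 0 (book G₂ _ le a c a≢c clash) =
  weaken-lower (ℕₚ.≤-trans le (ℕₚ.+-monoˡ-≤ 4 (numEdges-four G₂ a c a≢c clash))) (lower prism)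
-- Five vertices remain, possibly with a Theta: 7 + 4 edges are matched by the prism with one
-- attached vertex, 9 + 2.
after-reduction 1 (book G₂ gd le _ _ _ _) =
  weaken-lower (ℕₚ.≤-trans le (ℕₚ.+-monoˡ-≤ 4 (numEdges-five G₂ gd))) (lower (grow prism))
after-reduction (suc (suc j)) (book G₂ gd le _ _ _ _) =
  weaken-lower (ℕₚ.≤-trans le (ℕₚ.≤-reflexive (ℕₚ.+-comm _ 4))) (add-two j (theta-free-as-large j G₂ gd (Theta? G₂)))
-- For 6, 7, 8 and 9 vertices the remainder has at most 1, 3, 6 and 7 edges. The totals 7, 9, 12 and
-- 13 stay within the 8, 10, 12 and 14 edges of K₂,ₙ₋₂.
after-reduction 0 (K₄ G₄ _ le) =
  weaken-lower (ℕₚ.≤-trans le (ℕₚ.≤-trans (ℕₚ.+-monoˡ-≤ 6 (numEdges-≤ G₄)) (ℕₚ.m≤m+n 7 1))) (lower-bipartite 0)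
after-reduction 1 (K₄ G₄ _ le) =
  weaken-lower (ℕₚ.≤-trans le (ℕₚ.≤-trans (ℕₚ.+-monoˡ-≤ 6 (numEdges-≤ G₄)) (ℕₚ.m≤m+n 9 1))) (lower-bipartite 1)
after-reduction 2 (K₄ G₄ _ le) =
  weaken-lower (ℕₚ.≤-trans le (ℕₚ.+-monoˡ-≤ 6 (numEdges-≤ G₄))) (lower-bipartite 2)
after-reduction 3 (K₄ G₄ gd le) =
  weaken-lower (ℕₚ.≤-trans le (ℕₚ.≤-trans (ℕₚ.+-monoˡ-≤ 6 (numEdges-five G₄ gd)) (ℕₚ.m≤m+n 13 1))) (lower-bipartite 3)
after-reduction (suc (suc (suc (suc j)))) (K₄ G₄ gd le) =
  weaken-lower (ℕₚ.≤-trans le (ℕₚ.≤-trans (ℕₚ.≤-reflexive (ℕₚ.+-comm _ 6)) (ℕₚ.m≤n+m _ 2)))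
    (add-two (2 + j) (add-two j (theta-free-as-large j G₄ gd (Theta? G₄))))

-- Existence of the maximum by exhaustive search

Searchable : Set → Set₁
Searchable A = ∀ {P : A → Set} → (∀ a → Dec (P a)) → Dec (∃ P)

search-Vec : ∀ {A} → Searchable A → ∀ n → Searchable (Vec A n)
search-Vec s zero    P? = map′ (λ p → [] , p) (λ { ([] , p) → p }) (P? [])
search-Vec s (suc n) P? = map′ (λ (a , v , p) → a ∷ v , p) (λ { (a ∷ v , p) → a , v , p })
  (s λ a → search-Vec s n λ v → P? (a ∷ v))

search-Bool : Searchable Bool
search-Bool P? with P? false | P? true
... | yes p | _     = yes (false , p)
... | no _  | yes q = yes (true , q)
... | no n  | no m  = no λ { (false , p) → n p ; (true , q) → m q }

search-Bits : ∀ n → Searchable (Bits n)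
search-Bits zero    P? = map′ (tt ,_) proj₂ (P? tt)
search-Bits (suc n) P? = map′ (λ (r , b , p) → (r , b) , p) (λ ((r , b) , p) → r , b , p)
  (search-Vec search-Bool n λ r → search-Bits n λ b → P? (r , b))

-- Rotations are searched through their tables. A rotation agrees pointwise with its table, and the
-- identity embedding carries the genus over.
Planar? : ∀ {n} (G : Graph n) → Dec (Planar G)
Planar? {n} G = map′ (λ (M , R , e) → at M , R , e) complete
  (search-Vec (search-Vec Finₚ.any? n) n λ M → isRotationSystem? G (at M) ×-dec
    (n + numFaces G (at M) + numIsolated G ℕ.≟ 2 * numComponents G + numEdges G))
  where
  at : Vec (Vec (Fin n) n) n → Fin n → Fin n → Fin n
  at M u v = lookup (lookup M u) v
  complete : Planar G → ∃[ M ] (IsRotationSystem G (at M) × n + numFaces G (at M) + numIsolated G ≡ 2 * numComponents G + numEdges G)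
  complete (rot , R , e) = M , push R , genus-push R e
    where
    M : Vec (Vec (Fin n) n) n
    M = tabulate (λ u → tabulate (rot u))
    open Embed.Rotations (≈ᴳ-Embedding {G = G} {G} (λ _ _ → refl)) {rot} {at M}
      (λ {x} {y} _ → ≡.sym (≡.trans (cong (λ r → lookup r y) (lookup∘tabulate (λ u → tabulate (rot u)) x)) (lookup∘tabulate (rot x) y)))

ThetaFreePlanar : ℕ → ℕ → Set
ThetaFreePlanar n m = Σ (Graph n) λ G → Planar G × ¬ Theta G × numEdges G ≡ m

ThetaFreePlanar? : ∀ n m → Dec (ThetaFreePlanar n m)
ThetaFreePlanar? n m = map′ (λ (b , p) → decode b , p) complete
  (search-Bits n λ b → Planar? (decode b) ×-dec ¬? (Theta? (decode b)) ×-dec (numEdges (decode b) ℕ.≟ m))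
  where
  complete : ThetaFreePlanar n m → ∃[ b ] (Planar (decode b) × ¬ Theta (decode b) × numEdges (decode b) ≡ m)
  complete (G , P , N , e) = encode G , Embed.Planar-push (≈ᴳ-Embedding {G = G} {decode (encode G)} same) P ,
    N ∘ Theta-≈ {G = G} {decode (encode G)} same , ≡.trans (numEdges-≈ {G = G} {decode (encode G)} same) e
    where
    same : G ≈ᴳ decode (encode G)
    same = decode-encode G

maximum : {P : ℕ → Set} → (∀ m → Dec (P m)) → ∀ B → (∀ m → P m → m ≤ B) → ∃ P → ∃[ m ] (P m × ∀ m′ → P m′ → m′ ≤ m)
maximum P? B bound ex with P? B
... | yes p = B , p , bound
maximum P? zero bound (m , p) | no n with bound m p
... | z≤n = ⊥-elim (n p)
maximum P? (suc B) bound ex | no n = maximum P? B (λ m p → ℕ.s≤s⁻¹ (ℕₚ.≤∧≢⇒< (bound m p) λ { refl → n p })) ex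

Theta⁺? : ∀ {n} (G : Graph n) → Dec (Theta⁺ G)
Theta⁺? G = map′ (λ (a , b , c , d , x , ab , bc , ac , cd , ad , n , bx , p , q , r) →
      record { theta = mkTheta ab bc ac cd ad n ; bx = bx ; x≢a = p ; x≢c = q ; x≢d = r })
    (λ T → let open Theta⁺ T in a , b , c , d , x , ab , bc , ac , cd , ad , b≢d , bx , x≢a , x≢c , x≢d)
    (Finₚ.any? λ a → Finₚ.any? λ b → Finₚ.any? λ c → Finₚ.any? λ d → Finₚ.any? λ x →
      Adj? G a b ×-dec Adj? G b c ×-dec Adj? G a c ×-dec Adj? G c d ×-dec Adj? G a d ×-dec ¬? (b Finₚ.≟ d)
      ×-dec Adj? G b x ×-dec ¬? (x Finₚ.≟ a) ×-dec ¬? (x Finₚ.≟ c) ×-dec ¬? (x Finₚ.≟ d))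

-- Three triangles sharing the edge 01.
book₃ : Graph 5
book₃ = decode ((true ∷ true ∷ true ∷ true ∷ []) , (true ∷ true ∷ true ∷ []) , (false ∷ false ∷ []) , (false ∷ []) , [] , tt)

book₃-Planar : Planar book₃
book₃-Planar = rot , toWitness {a? = isRotationSystem? book₃ rot} tt , refl
  where
  rot : Fin 5 → Fin 5 → Fin 5
  rot u v = lookup (lookup
    ( (0F ∷ 2F ∷ 3F ∷ 4F ∷ 1F ∷ [])
    ∷ (4F ∷ 0F ∷ 0F ∷ 2F ∷ 3F ∷ [])
    ∷ (1F ∷ 0F ∷ 0F ∷ 0F ∷ 0F ∷ [])
    ∷ (1F ∷ 0F ∷ 0F ∷ 0F ∷ 0F ∷ [])
    ∷ (1F ∷ 0F ∷ 0F ∷ 0F ∷ 0F ∷ [])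
    ∷ []) u) v

-- The maximum over Theta-free planar graphs serves both families: its witness is also Theta⁺-free,
-- and every Theta⁺-free planar graph is matched by a Theta-free planar one with at least as many
-- edges.
six-or-more : ∀ k → ∃[ m ] (IsExP (6 + k) Θ₄⁺ m × IsExP (6 + k) Θ₄ m)
six-or-more k = finish (maximum (ThetaFreePlanar? (6 + k)) (binom₂ (6 + k)) (λ { _ (G , _ , _ , refl) → numEdges-≤ G })
    (realized (lower-bipartite k)))
  where
  realized : ∀ {e} (L : Lower (6 + k) e) → ∃ (ThetaFreePlanar (6 + k))
  realized L = numEdges graph , graph , planar , thetaFree , refl
    where open Lower L
  finish : ∃[ m ] (ThetaFreePlanar (6 + k) m × ∀ m′ → ThetaFreePlanar (6 + k) m′ → m′ ≤ m) →
           ∃[ m ] (IsExP (6 + k) Θ₄⁺ m × IsExP (6 + k) Θ₄ m)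
  finish (m , (G , P , N , e) , max) = m ,
    ((G , P , ¬Theta⁺⇒free {G = G} (λ T → N (Theta⁺.theta T)) , e) , upper⁺) ,
    ((G , P , ¬Theta⇒free {G = G} N , e) , λ G′ P′ F → max _ (G′ , P′ , free⇒¬Theta {G = G′} F , refl))
    where
    upper⁺ : ∀ G′ → Planar G′ → Free Θ₄⁺ G′ → numEdges G′ ≤ m
    upper⁺ G′ P′ F = ℕₚ.≤-trans (Lower.enough L) (max _ (proj₂ (realized L)))
      where L = theta-free-as-large k G′ (good P′ (free⇒¬Theta⁺ {G = G′} F)) (Theta? G′)

theorem5p3 : (∀ (n : ℕ) → 6 ≤ n → ∃[ m ] (IsExP n Θ₄⁺ m × IsExP n Θ₄ m))
    × (∃[ m ] (IsExP 5 Θ₄ m × IsExP 5 Θ₄⁺ (m + 1) × m + 1 ≡ 7))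
theorem5p3 =
  (λ n 6≤n → subst (λ n → ∃[ m ] (IsExP n Θ₄⁺ m × IsExP n Θ₄ m)) (ℕₚ.m+[n∸m]≡n 6≤n) (six-or-more (n ∸ 6))) ,
  6 ,
  ((Lower.graph L , Lower.planar L , ¬Theta⇒free {G = Lower.graph L} (Lower.thetaFree L) ,
      ℕₚ.≤-antisym (five-sparse (Lower.graph L) (Lower.thetaFree L)) (Lower.enough L)) ,
    λ G _ F → five-sparse G (free⇒¬Theta {G = G} F)) ,
  ((book₃ , book₃-Planar , ¬Theta⁺⇒free {G = book₃} (toWitnessFalse {a? = Theta⁺? book₃} tt) , refl) ,
    λ G P F → numEdges-five G (good P (free⇒¬Theta⁺ {G = G} F))) ,
  refl
  where
  L : Lower 5 6
  -- This is K₂,₃, which attains the six edges of `five-sparse`.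
  L = lower (K₂ 2)
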